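{- Let $P$ be a polyomino and consider the MWPDV (milling variant) on $P$ with rectangular vision, i.e., $L_\infty$ visibility range $r=1$. Then there is a feasible solution $(T,{\cal S}(T))$ such that simultaneously $|{\cal S}(T)|$ is at most $2.5$ times the minimum number of scan points necessary to cover $P$, and the length of the tour $T$ is at most $2.5$ times the length of an optimum milling tour of $P$.
   Context: A polyomino is a connected axis-parallel polygon with integer coordinates, i.e. a connected union of unit grid squares (pixels); holes are allowed. In the Myopic Watchman Problem with Discrete Vision (MWPDV), a feasible solution is a closed tour $T$ together with a finite set ${\cal S}(T)$ of scan points on $T$ that covers $P$. In the milling variant, tour, scan points and visibility must stay within $P$: a point $q\in P$ is seen from a scan point $p\in P$ if the segment $qp$ is contained in $P$ and $\|q-p\|_\infty\le 1$; a set of scan points covers $P$ if every $q\in P$ is seen from at least one of them. A milling tour of $P$ is a closed tour of the center of an axis-aligned $2\times2$ square cutter such that the cutter stays inside $P$ at all times and the union of the cutter's positions along the tour is all of $P$; an optimum milling tour is a shortest one (the length bound concerns polyominoes for which such a tour exists). -}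

module Defs where

open import Algebra.Bundles using (CommutativeRing)
import Algebra.Definitions.RawMonoid
open import Data.Integer using (ℤ; +_; -[1+_])
import Data.Integer as ℤ
open import Data.List using (List; []; _∷_)
import Data.List as List
open import Data.List.Membership.Propositional using (_∈_)
open import Data.List.Relation.Unary.All using (All)
open import Data.List.Relation.Unary.Any using (Any)
open import Data.List.Relation.Unary.Linked using (Linked)
open import Data.Nat using (ℕ; suc)
import Data.Nat as ℕ
open import Data.Product using (∃; ∃-syntax; _×_; _,_; proj₁; proj₂)
open import Level using (0ℓ) renaming (suc to lsuc)
open import Relation.Binary.Construct.Closure.ReflexiveTransitive using (Star)
open import Relation.Binary.PropositionalEquality using (_≡_; _≢_)
open import Relation.Binary.Structures using (IsTotalOrder)
open import Relation.Nullary using (¬_)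

-- The axioms characterising ℝ. The equality is a setoid equality because
-- quotients (e.g. of Cauchy sequences) are not available as types.
record CompleteOrderedField : Set (lsuc 0ℓ) where
  infix 4 _≤_ _<_
  field
    commutativeRing : CommutativeRing 0ℓ 0ℓ
  open CommutativeRing commutativeRing public
  open Algebra.Definitions.RawMonoid +-rawMonoid using () renaming (_×_ to _·ℕ_)
  field
    _≤_          : Carrier → Carrier → Set
    isTotalOrder : IsTotalOrder _≈_ _≤_
    0≉1          : ¬ (0# ≈ 1#)
    inverse      : ∀ x → ¬ (x ≈ 0#) → ∃[ y ] x * y ≈ 1#
    +-monoˡ-≤    : ∀ z {x y} → x ≤ y → x + z ≤ y + z
    *-nonneg     : ∀ {x y} → 0# ≤ x → 0# ≤ y → 0# ≤ x * y

  _<_ : Carrier → Carrier → Set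
  x < y = x ≤ y × ¬ (x ≈ y)

  IsUpperBound : (Carrier → Set) → Carrier → Set
  IsUpperBound A u = ∀ x → A x → x ≤ u

  IsSupremum : (Carrier → Set) → Carrier → Set
  IsSupremum A s = IsUpperBound A s × (∀ u → IsUpperBound A u → s ≤ u)

  field
    complete : ∀ (A : Carrier → Set) → ∃ A → ∃ (IsUpperBound A) → ∃ (IsSupremum A)

  fromℤ : ℤ → Carrier
  fromℤ (+ n)    = n ·ℕ 1#
  fromℤ -[1+ n ] = - (suc n ·ℕ 1#)

-- (i , j) stands for the closed unit square [i , i + 1] × [j , j + 1].
Pixel : Set
Pixel = ℤ × ℤ

-- The two pixels share an edge.
Adjacent : Pixel → Pixel → Set
Adjacent (i , j) (i′ , j′) = ℤ.∣ i ℤ.- i′ ∣ ℕ.+ ℤ.∣ j ℤ.- j′ ∣ ≡ 1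

record Polyomino : Set where
  field
    pixels    : List Pixel
    nonEmpty  : pixels ≢ []
    connected : ∀ {a b} → a ∈ pixels → b ∈ pixels →
                Star (λ c d → Adjacent c d × d ∈ pixels) a b

module MWPDV (ℝ : CompleteOrderedField) where
  open CompleteOrderedField ℝ

  Point : Set
  Point = Carrier × Carrier

  -- ‖ q - p ‖∞ ≤ r, with absolute values written out as two inequalities.
  Within : Carrier → Point → Point → Set
  Within r (px , py) (qx , qy) =
    (qx - px ≤ r × px - qx ≤ r) × (qy - py ≤ r × py - qy ≤ r)

  InPixel : Point → Pixel → Set
  InPixel (x , y) (i , j) =
    (fromℤ i ≤ x × x ≤ fromℤ i + 1#) × (fromℤ j ≤ y × y ≤ fromℤ j + 1#)

  InRegion : Polyomino → Point → Set
  InRegion P p = Any (InPixel p) (Polyomino.pixels P)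

  OnSegment : Point → Point → Point → Set
  OnSegment (px , py) (qx , qy) (x , y) =
    ∃[ t ] (0# ≤ t × t ≤ 1#) × x ≈ px + t * (qx - px) × y ≈ py + t * (qy - py)

  Sees : Polyomino → Point → Point → Set
  Sees P p q = (∀ x → OnSegment q p x → InRegion P x) × Within 1# p q

  Covers : Polyomino → List Point → Set
  Covers P S = All (InRegion P) S × (∀ q → InRegion P q → Any (λ p → Sees P p q) S)

  IsMinimumScanNumber : Polyomino → ℕ → Set
  IsMinimumScanNumber P k =
    (∃[ S ] Covers P S × List.length S ≡ k) ×
    (∀ S → Covers P S → k ℕ.≤ List.length S)

  -- Euclidean distance.
  IsDistance : Point → Point → Carrier → Set
  IsDistance (px , py) (qx , qy) d =
    0# ≤ d × d * d ≈ (qx - px) * (qx - px) + (qy - py) * (qy - py)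

  data PolylineLength : List Point → Carrier → Set where
    empty  : ∀ {ℓ} → ℓ ≈ 0# → PolylineLength [] ℓ
    single : ∀ {p ℓ} → ℓ ≈ 0# → PolylineLength (p ∷ []) ℓ
    step   : ∀ {p q ps d ℓ m} → IsDistance p q d → PolylineLength (q ∷ ps) ℓ →
             m ≈ d + ℓ → PolylineLength (p ∷ q ∷ ps) m

  InInterval : Carrier → Carrier → Carrier → Set
  InInterval a b t = a ≤ t × t ≤ b

  ContinuousOn : Carrier → Carrier → (Carrier → Point) → Set
  ContinuousOn a b γ =
    ∀ s → InInterval a b s → ∀ ε → 0# < ε →
    ∃[ δ ] 0# < δ × (∀ t → InInterval a b t → t - s ≤ δ → s - t ≤ δ →
                     Within ε (γ s) (γ t))

  InscribedLength : Carrier → Carrier → (Carrier → Point) → Carrier → Set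
  InscribedLength a b γ ℓ =
    ∃[ ts ] Linked _≤_ ts × All (InInterval a b) ts × PolylineLength (List.map γ ts) ℓ

  -- A rectifiable closed curve; path is only meaningful on [start , finish].
  -- Degenerate (one-point) tours are allowed: the optimum milling tour of a
  -- 2 × 2 square has length 0.
  record ClosedTour : Set where
    field
      start finish : Carrier
      start≤finish : start ≤ finish
      path         : Carrier → Point
      continuous   : ContinuousOn start finish path
      closed       : proj₁ (path start) ≈ proj₁ (path finish) ×
                     proj₂ (path start) ≈ proj₂ (path finish)
      length       : Carrier
      isLength     : IsSupremum (InscribedLength start finish path) length

    OnTour : Point → Set
    OnTour (x , y) =
      ∃[ t ] InInterval start finish t × x ≈ proj₁ (path t) × y ≈ proj₂ (path t)

  open ClosedTour public using (length; OnTour)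

  IsFeasible : Polyomino → ClosedTour → List Point → Set
  IsFeasible P T S =
    (∀ p → OnTour T p → InRegion P p) × All (OnTour T) S × Covers P S

  InCutter : Point → Point → Set
  InCutter c q = Within 1# c q

  IsMillingTour : Polyomino → ClosedTour → Set
  IsMillingTour P M =
    (∀ c → OnTour M c → ∀ q → InCutter c q → InRegion P q) ×
    (∀ q → InRegion P q → ∃[ c ] OnTour M c × InCutter c q)

  IsOptimumMillingTour : Polyomino → ClosedTour → Set
  IsOptimumMillingTour P M =
    IsMillingTour P M × (∀ M′ → IsMillingTour P M′ → length M ≤ length M′)

-- If P has no optimum milling tour, a closed walk through a minimum cover
-- suffices. Otherwise let M be an optimum milling tour of length L > 0 and
-- round its points to the lattice, each coordinate with its own threshold
-- modulo 1.
--
-- A rounded centre is at L∞-distance less than 1 from a centre of M, so its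
-- 2 × 2 block of pixels still lies in P. Averaged over the thresholds, rounding
-- preserves the L₁-length, which is at most √2 L ≤ 3/2 L. A pixel can escape all
-- rounded blocks only if M covers the point of the pixel given by the
-- thresholds no better than with the boundary of the cutter; on a line of slope
-- ±1 in the space of thresholds, misses with the same orientation of point and
-- cutter are close together, so that few thresholds are bad. Hence there is a
-- closed lattice tour T of length at most 5/2 L whose blocks cover P.
--
-- For S take an irredundant family of the blocks. Counting pairs of a pixel and
-- one of its corners, where each block has a private pixel, gives 7 |S| ≤ 4 N
-- for the number N of pixels. A scan point sees at most four among suitable
-- points, one in each pixel, so N ≤ 4 k and 2 |S| ≤ 5 k.
module Submission where

open import Defs
open import Algebra.Bundles using (AbelianGroup)
import Algebra.Properties.AbelianGroup
import Algebra.Properties.Ring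
import Algebra.Properties.Semiring.Mult.TCOptimised
import Algebra.Solver.Ring
open import Algebra.Solver.Ring.AlmostCommutativeRing using (_-Raw-AlmostCommutative⟶_; fromCommutativeRing)
open import Axiom.ExcludedMiddle using (ExcludedMiddle)
open import Data.Bool using (if_then_else_)
open import Data.Empty using (⊥; ⊥-elim)
open import Data.Integer using (ℤ; +_; -[1+_])
import Data.Integer as ℤ
import Data.Integer.DivMod as ℤ
import Data.Integer.Properties as ℤ
open import Algebra.Properties.Group (AbelianGroup.group ℤ.+-0-abelianGroup) using () renaming (∙-cancelˡ to ℤ-+-cancelˡ)
open import Data.Integer.Solver using (module +-*-Solver)
open import Data.List using (List; []; _∷_; _++_; map; concat; filter; cartesianProduct; deduplicate; upTo; applyUpTo)
import Data.List as List
open import Data.List.Membership.Propositional using (_∈_; _∉_; find; lose)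
open import Data.List.Membership.Propositional.Properties
  using (∈-++⁻; ∈-++⁺ˡ; ∈-++⁺ʳ; ∈-∃++; ∈-map⁺; ∈-map⁻; ∈-concat⁻′; ∈-filter⁺; ∈-filter⁻; ∈-upTo⁻;
         ∈-deduplicate⁺; ∈-deduplicate⁻; ∈-cartesianProduct⁺)
import Data.List.Properties as List
open import Data.List.Relation.Binary.Disjoint.Propositional using (Disjoint)
open import Data.List.Relation.Unary.All as All using (All; []; _∷_)
import Data.List.Relation.Unary.All.Properties as All
open import Data.List.Relation.Unary.AllPairs using (AllPairs; []; _∷_)
open import Data.List.Relation.Unary.Any as Any using (Any; here; there)
import Data.List.Relation.Unary.Any.Properties as Any
open import Data.List.Relation.Unary.Linked using (Linked; []; [-]; _∷_)
open import Data.List.Relation.Unary.Unique.DecPropositional.Properties using (deduplicate-!)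
open import Data.List.Relation.Unary.Unique.Propositional using (Unique)
import Data.List.Relation.Unary.Unique.Propositional.Properties as Unique
open import Data.Maybe using (Maybe; just; nothing)
open import Data.Nat using (ℕ; zero; suc; NonZero)
import Data.Nat as ℕ
open import Data.Nat.ListAction using (sum)
import Data.Nat.Properties as ℕ
import Data.Nat.Tactic.RingSolver as ℕ-Solver
open import Data.Product using (∃; ∃-syntax; _×_; _,_; proj₁; proj₂)
open import Data.Product.Properties using (≡-dec)
open import Data.Sum using (_⊎_; inj₁; inj₂)
open import Data.Unit using (⊤; tt)
open import Function using (_∘_; id)
open import Level using (0ℓ)
open import Relation.Binary.Bundles using (Poset)
import Relation.Binary.Construct.Closure.ReflexiveTransitive as Star
open import Relation.Binary.Definitions using (DecidableEquality; Tri; tri<; tri≈; tri>)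
open import Relation.Binary.PropositionalEquality as ≡ using (_≡_; _≢_)
import Relation.Binary.Reasoning.PartialOrder
open import Relation.Binary.Structures using (IsTotalOrder)
open import Relation.Nullary using (¬_; Dec; yes; no; contradiction; ¬?; does)

-- The thresholds are taken from a finite grid with `n` values per coordinate, so that averaging
-- becomes counting and no integral has to be defined. This brings in two errors: `M` is used at
-- finitely many times only, and its points are floored to multiples of 1/n. Together they form an
-- error `e` in units of 1/n, and for each pixel and each orientation a line of slope ±1 may then
-- carry up to `e + 1` bad thresholds. Hence `n` has to be large compared with `e` times the number
-- of pixels, although `e` itself grows with `n`; the sampling width is fixed small enough in
-- advance for this to be possible. The constant 5/2 is 5/4 times 2. Sampling turns L into at most
-- (3/2 + 1/2) L, where 3/2 stands for √2 and 1/2 pays for the floors. The factor 5/4 arises because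
-- up to one fifth of the thresholds may be bad, so that the average has to be met by the remaining
-- four fifths. That a rounded centre is strictly less than 1 away matters: only then does the
-- cutter of `M` meet the interior of each of the four pixels of the block, which forces them to
-- belong to P.

least : ExcludedMiddle 0ℓ → (P : ℕ → Set) → ∀ {n} → P n → ∃[ m ] P m × (∀ k → P k → m ℕ.≤ k)
least em P {zero}  pn = 0 , pn , λ _ _ → ℕ.z≤n
least em P {suc n} pn with em {P 0} | least em (λ k → P (suc k)) {n} pn
... | yes p0 | _ = 0 , p0 , λ _ _ → ℕ.z≤n
... | no ¬p0 | m , pm , m-least = suc m , pm , λ where
        zero    p0 → contradiction p0 ¬p0
        (suc k) pk → ℕ.s≤s (m-least k pk)

-- Arithmetic in a complete ordered field: integers, floors, square roots, clamping

module OrderedField (ℝ : CompleteOrderedField) (em : ExcludedMiddle 0ℓ) where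
  open CompleteOrderedField ℝ public
  open IsTotalOrder isTotalOrder public
    using (total; antisym; isPartialOrder)
    renaming (reflexive to ≤-reflexive; trans to ≤-trans; refl to ≤-refl)

  poset : Poset 0ℓ 0ℓ 0ℓ
  poset = record { isPartialOrder = isPartialOrder }

  module ≤-Reasoning = Relation.Binary.Reasoning.PartialOrder poset

  private
    module R  = Algebra.Properties.Ring ring
    module A  = Algebra.Properties.AbelianGroup +-abelianGroup
    module M  = Algebra.Properties.Semiring.Mult.TCOptimised semiring

  -- The embedding of ℤ in which the literals 0 and 1 evaluate to 0# and 1#.
  ι : ℤ → Carrier
  ι (+ n)    = n M.× 1#
  ι -[1+ n ] = - (suc n M.× 1#)

  fromℤ≈ι : ∀ i → fromℤ i ≈ ι i
  fromℤ≈ι (+ n)    = M.×ᵤ≈× n 1#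
  fromℤ≈ι -[1+ n ] = -‿cong (M.×ᵤ≈× (suc n) 1#)

  private
    ι-⊖ : ∀ m n → ι (m ℤ.⊖ n) ≈ m M.× 1# + - (n M.× 1#)
    ι-⊖ m zero = sym (trans (+-congˡ R.-0#≈0#) (+-identityʳ _))
    ι-⊖ zero (suc n) = sym (+-identityˡ _)
    ι-⊖ (suc m) (suc n) = begin-equality
      ι (suc m ℤ.⊖ suc n)                         ≡⟨ ≡.cong ι (ℤ.[1+m]⊖[1+n]≡m⊖n m n) ⟩
      ι (m ℤ.⊖ n)                                 ≈⟨ ι-⊖ m n ⟩
      x + - y                                     ≈⟨ +-congʳ (+-identityʳ x) ⟨
      x + 0# + - y                                ≈⟨ +-congʳ (+-congˡ (-‿inverseʳ 1#)) ⟨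
      x + (1# + - 1#) + - y                       ≈⟨ +-congʳ (+-assoc x 1# (- 1#)) ⟨
      x + 1# + - 1# + - y                         ≈⟨ +-assoc (x + 1#) (- 1#) (- y) ⟩
      (x + 1#) + (- 1# + - y)                     ≈⟨ +-cong (trans (+-comm x 1#) (sym (M.1+× m 1#)))
                                                            (trans (A.⁻¹-∙-comm 1# y) (-‿cong (sym (M.1+× n 1#)))) ⟩
      suc m M.× 1# + - (suc n M.× 1#)             ∎
      where
        open ≤-Reasoning
        x = m M.× 1#
        y = n M.× 1#

    ι-neg : ∀ i → ι (ℤ.- i) ≈ - ι i
    ι-neg (+ zero)    = sym R.-0#≈0#
    ι-neg (+ suc n)   = refl
    ι-neg -[1+ n ]    = sym (R.-‿involutive _)

    ι-+ : ∀ i j → ι (i ℤ.+ j) ≈ ι i + ι j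
    ι-+ (+ m)    (+ n)    = M.×-homo-+ 1# m n
    ι-+ (+ m)    -[1+ n ] = ι-⊖ m (suc n)
    ι-+ -[1+ m ] (+ n)    = trans (ι-⊖ n (suc m)) (+-comm _ _)
    ι-+ -[1+ m ] -[1+ n ] = begin-equality
      - (suc (suc (m ℕ.+ n)) M.× 1#)           ≡⟨ ≡.cong (λ k → - (suc k M.× 1#)) (ℕ.+-suc m n) ⟨
      - ((suc m ℕ.+ suc n) M.× 1#)             ≈⟨ -‿cong (M.×-homo-+ 1# (suc m) (suc n)) ⟩
      - (suc m M.× 1# + suc n M.× 1#)          ≈⟨ A.⁻¹-∙-comm _ _ ⟨
      - (suc m M.× 1#) + - (suc n M.× 1#)      ∎
      where open ≤-Reasoning

    ι-*⁺ : ∀ m j → ι (+ m ℤ.* j) ≈ ι (+ m) * ι j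
    ι-*⁺ m (+ n)    = trans (reflexive (≡.cong ι (≡.sym (ℤ.pos-* m n)))) (M.×1-homo-* m n)
    ι-*⁺ m -[1+ n ] = begin-equality
      ι (+ m ℤ.* -[1+ n ])            ≡⟨ ≡.cong ι (ℤ.neg-distribʳ-* (+ m) (+ suc n)) ⟨
      ι (ℤ.- (+ m ℤ.* + suc n))       ≈⟨ ι-neg (+ m ℤ.* + suc n) ⟩
      - ι (+ m ℤ.* + suc n)           ≈⟨ -‿cong (ι-*⁺ m (+ suc n)) ⟩
      - (ι (+ m) * ι (+ suc n))       ≈⟨ R.-‿distribʳ-* _ _ ⟩
      ι (+ m) * ι -[1+ n ]            ∎
      where open ≤-Reasoning

    ι-* : ∀ i j → ι (i ℤ.* j) ≈ ι i * ι j
    ι-* (+ m) j    = ι-*⁺ m j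
    ι-* -[1+ m ] j = begin-equality
      ι (-[1+ m ] ℤ.* j)              ≡⟨ ≡.cong ι (ℤ.neg-distribˡ-* (+ suc m) j) ⟨
      ι (ℤ.- (+ suc m ℤ.* j))         ≈⟨ ι-neg (+ suc m ℤ.* j) ⟩
      - ι (+ suc m ℤ.* j)             ≈⟨ -‿cong (ι-*⁺ (suc m) j) ⟩
      - (ι (+ suc m) * ι j)           ≈⟨ R.-‿distribˡ-* _ _ ⟩
      ι -[1+ m ] * ι j                ∎
      where open ≤-Reasoning

    ι-homomorphism : ℤ.+-*-rawRing -Raw-AlmostCommutative⟶ fromCommutativeRing commutativeRing
    ι-homomorphism = record
      { ⟦_⟧ = ι ; +-homo = ι-+ ; *-homo = ι-* ; -‿homo = ι-neg ; 0-homo = refl ; 1-homo = refl }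

    _≟ι_ : ∀ i j → Maybe (ι i ≈ ι j)
    i ≟ι j with i ℤ.≟ j
    ... | yes i≡j = just (reflexive (≡.cong ι i≡j))
    ... | no  _   = nothing

  open Algebra.Solver.Ring ℤ.+-*-rawRing (fromCommutativeRing commutativeRing) ι-homomorphism _≟ι_ public
    using (solve; _:=_; con; _:+_; _:*_; _:-_; :-_; Polynomial)

  :1 : ∀ {n} → Polynomial n
  :1 = con (+ 1)

  :0 : ∀ {n} → Polynomial n
  :0 = con (+ 0)

  fromℤ-+ : ∀ i j → fromℤ (i ℤ.+ j) ≈ fromℤ i + fromℤ j
  fromℤ-+ i j = trans (fromℤ≈ι (i ℤ.+ j)) (trans (ι-+ i j) (sym (+-cong (fromℤ≈ι i) (fromℤ≈ι j))))

  fromℤ-* : ∀ i j → fromℤ (i ℤ.* j) ≈ fromℤ i * fromℤ j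
  fromℤ-* i j = trans (fromℤ≈ι (i ℤ.* j)) (trans (ι-* i j) (sym (*-cong (fromℤ≈ι i) (fromℤ≈ι j))))

  fromℤ-neg : ∀ i → fromℤ (ℤ.- i) ≈ - fromℤ i
  fromℤ-neg i = trans (fromℤ≈ι (ℤ.- i)) (trans (ι-neg i) (-‿cong (sym (fromℤ≈ι i))))

  fromℤ-- : ∀ i j → fromℤ (i ℤ.- j) ≈ fromℤ i - fromℤ j
  fromℤ-- i j = trans (fromℤ-+ i (ℤ.- j)) (+-congˡ (fromℤ-neg j))

  opaque
    +-mono-≤ : ∀ {a b c d} → a ≤ b → c ≤ d → a + c ≤ b + d
    +-mono-≤ {a} {b} {c} {d} a≤b c≤d = begin
      a + c  ≤⟨ +-monoˡ-≤ c a≤b ⟩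
      b + c  ≈⟨ +-comm b c ⟩
      c + b  ≤⟨ +-monoˡ-≤ b c≤d ⟩
      d + b  ≈⟨ +-comm d b ⟩
      b + d  ∎
      where open ≤-Reasoning

    0≤b-a : ∀ {a b} → a ≤ b → 0# ≤ b - a
    0≤b-a {a} {b} a≤b = begin
      0#     ≈⟨ -‿inverseʳ a ⟨
      a - a  ≤⟨ +-monoˡ-≤ (- a) a≤b ⟩
      b - a  ∎
      where open ≤-Reasoning

    -- Linear inequalities are derived from hypotheses lᵢ ≤ rᵢ by exhibiting
    -- b - a as a sum of slacks rᵢ - lᵢ, an identity left to the ring solver.
    ≤-by : ∀ {a b e} → 0# ≤ e → b - a ≈ e → a ≤ b
    ≤-by {a} {b} {e} 0≤e b-a≈e = begin
      a            ≈⟨ +-identityˡ a ⟨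
      0# + a       ≤⟨ +-monoˡ-≤ a 0≤e ⟩
      e + a        ≈⟨ +-congʳ b-a≈e ⟨
      b - a + a    ≈⟨ solve 2 (λ a b → b :- a :+ a := b) refl a b ⟩
      b            ∎
      where open ≤-Reasoning

    0≤+ : ∀ {x y} → 0# ≤ x → 0# ≤ y → 0# ≤ x + y
    0≤+ {x} {y} 0≤x 0≤y = ≤-trans (≤-reflexive (sym (+-identityˡ 0#))) (+-mono-≤ 0≤x 0≤y)

    ≤-by₁ : ∀ {a b l r} → l ≤ r → b - a ≈ r - l → a ≤ b
    ≤-by₁ p = ≤-by (0≤b-a p)

    ≤-by₂ : ∀ {a b l r l′ r′} → l ≤ r → l′ ≤ r′ → b - a ≈ (r - l) + (r′ - l′) → a ≤ b
    ≤-by₂ p q = ≤-by (0≤+ (0≤b-a p) (0≤b-a q))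

    ≤-by₃ : ∀ {a b l r l′ r′ l″ r″} → l ≤ r → l′ ≤ r′ → l″ ≤ r″ →
            b - a ≈ (r - l) + (r′ - l′) + (r″ - l″) → a ≤ b
    ≤-by₃ p q s = ≤-by (0≤+ (0≤+ (0≤b-a p) (0≤b-a q)) (0≤b-a s))

    0≤x² : ∀ x → 0# ≤ x * x
    0≤x² x with total 0# x
    ... | inj₁ 0≤x = *-nonneg 0≤x 0≤x
    ... | inj₂ x≤0 = ≤-trans (*-nonneg 0≤-x 0≤-x) (≤-reflexive (solve 1 (λ x → :- x :* :- x := x :* x) refl x))
      where
        0≤-x : 0# ≤ - x
        0≤-x = ≤-by₁ x≤0 (solve 1 (λ x → :- x :- :0 := :0 :- x) refl x)

    0≤1 : 0# ≤ 1#
    0≤1 = ≤-trans (0≤x² 1#) (≤-reflexive (*-identityˡ 1#))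

    1≰0 : ¬ 1# ≤ 0#
    1≰0 1≤0 = 0≉1 (antisym 0≤1 1≤0)

    <⇒≱ : ∀ {x y} → x < y → ¬ y ≤ x
    <⇒≱ (x≤y , x≉y) y≤x = x≉y (antisym x≤y y≤x)

    ≰⇒≥ : ∀ {x y} → ¬ x ≤ y → y ≤ x
    ≰⇒≥ {x} {y} x≰y with total x y
    ... | inj₁ x≤y = contradiction x≤y x≰y
    ... | inj₂ y≤x = y≤x

    ≰⇒> : ∀ {x y} → ¬ x ≤ y → y < x
    ≰⇒> x≰y = ≰⇒≥ x≰y , λ y≈x → x≰y (≤-reflexive (sym y≈x))

    0<1 : 0# < 1#
    0<1 = 0≤1 , 0≉1

    *-monoˡ-≤ : ∀ {c a b} → 0# ≤ c → a ≤ b → c * a ≤ c * b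
    *-monoˡ-≤ {c} {a} {b} 0≤c a≤b =
      ≤-by (*-nonneg 0≤c (0≤b-a a≤b)) (solve 3 (λ a b c → c :* b :- c :* a := c :* (b :- a)) refl a b c)

    *-mono-≤ : ∀ {a b c d} → 0# ≤ a → 0# ≤ d → a ≤ b → c ≤ d → a * c ≤ b * d
    *-mono-≤ {a} {b} {c} {d} 0≤a 0≤d a≤b c≤d = ≤-trans (*-monoˡ-≤ 0≤a c≤d)
      (≤-trans (≤-reflexive (*-comm a d)) (≤-trans (*-monoˡ-≤ 0≤d a≤b) (≤-reflexive (*-comm d b))))

    recip : ∀ {x} → 0# < x → ∃[ y ] 0# < y × x * y ≈ 1#
    recip {x} (0≤x , 0≉x) with inverse x (λ x≈0 → 0≉x (sym x≈0))
    ... | y , xy≈1 = y , ≰⇒> y≰0 , xy≈1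
      where
        y≰0 : ¬ y ≤ 0#
        y≰0 y≤0 = 1≰0 (≤-trans (≤-reflexive (sym xy≈1)) (≤-trans (*-monoˡ-≤ 0≤x y≤0) (≤-reflexive (zeroʳ x))))

    *-cancelˡ-≤ : ∀ {c a b} → 0# < c → c * a ≤ c * b → a ≤ b
    *-cancelˡ-≤ {c} {a} {b} 0<c ca≤cb =
      ≤-trans (≤-reflexive (sym (lemma a))) (≤-trans (*-monoˡ-≤ (proj₁ (proj₁ (proj₂ (recip 0<c)))) ca≤cb) (≤-reflexive (lemma b)))
      where
        lemma : ∀ z → proj₁ (recip 0<c) * (c * z) ≈ z
        lemma z = trans (solve 3 (λ c y z → y :* (c :* z) := c :* y :* z) refl c (proj₁ (recip 0<c)) z)
                        (trans (*-congʳ (proj₂ (proj₂ (recip 0<c)))) (*-identityˡ z))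

    -- If `d ≤ w` fails, then `d + w` is positive and can be cancelled from
    -- `(d + w) * d ≤ (d + w) * w`, which is the hypothesis on the squares in another form.
    square-cancel-≤ : ∀ {d w} → 0# ≤ w → d * d ≤ w * w → d ≤ w
    square-cancel-≤ {d} {w} 0≤w d²≤w² with em {d ≤ w}
    ... | yes d≤w = d≤w
    ... | no  d≰w = *-cancelˡ-≤ 0<d+w (≤-by₁ d²≤w²
            (solve 2 (λ d w → (d :+ w) :* w :- (d :+ w) :* d := w :* w :- d :* d) refl d w))
      where
        0<d+w : 0# < d + w
        0<d+w = ≰⇒> λ d+w≤0 → d≰w (≤-by₃ d+w≤0 0≤w 0≤w
          (solve 2 (λ d w → w :- d := (:0 :- (d :+ w)) :+ (w :- :0) :+ (w :- :0)) refl d w))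

    0<* : ∀ {x y} → 0# < x → 0# < y → 0# < x * y
    0<* {x} {y} 0<x 0<y = ≰⇒> λ xy≤0 →
      <⇒≱ 0<y (*-cancelˡ-≤ 0<x (≤-trans xy≤0 (≤-reflexive (sym (zeroʳ x)))))

    0<b-a : ∀ {a b} → a < b → 0# < b - a
    0<b-a {a} {b} a<b = ≰⇒> λ b-a≤0 → <⇒≱ a<b
      (≤-by₁ b-a≤0 (solve 2 (λ a b → a :- b := :0 :- (b :- a)) refl a b))

    0<⇒x+e≰x : ∀ {x e} → 0# < e → ¬ x + e ≤ x
    0<⇒x+e≰x {x} {e} 0<e p = <⇒≱ 0<e (≤-by₁ p (solve 2 (λ x e → :0 :- e := x :- (x :+ e)) refl x e))

    0<⇒x≰x-e : ∀ {x e} → 0# < e → ¬ x ≤ x - e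
    0<⇒x≰x-e {x} {e} 0<e p = <⇒≱ 0<e (≤-by₁ p (solve 2 (λ x e → :0 :- e := x :- e :- x) refl x e))

  opaque
    0<2 : 0# < 1# + 1#
    0<2 = ≰⇒> λ 2≤0 → 1≰0 (≤-by₂ 2≤0 0≤1 (solve 0 (:0 :- :1 := (:0 :- (:1 :+ :1)) :+ (:1 :- :0)) refl))

    halve : ∀ {x} → 0# < x → ∃[ y ] 0# < y × y + y ≈ x
    halve {x} 0<x with recip 0<2
    ... | h , 0<h , 2h≈1 = x * h , 0<* 0<x 0<h ,
      trans (solve 2 (λ x h → x :* h :+ x :* h := (:1 :+ :1) :* h :* x) refl x h) (trans (*-congʳ 2h≈1) (*-identityˡ x))

  opaque
    fromℤ-1 : fromℤ (+ 1) ≈ 1#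
    fromℤ-1 = +-identityʳ 1#

    fromℤ-+1 : ∀ i → fromℤ (i ℤ.+ + 1) ≈ fromℤ i + 1#
    fromℤ-+1 i = trans (fromℤ-+ i (+ 1)) (+-congˡ fromℤ-1)

    fromℤ-nonneg : ∀ n → 0# ≤ fromℤ (+ n)
    fromℤ-nonneg zero    = ≤-refl
    fromℤ-nonneg (suc n) = 0≤+ 0≤1 (fromℤ-nonneg n)

    fromℤ-mono-≤ : ∀ {i j} → i ℤ.≤ j → fromℤ i ≤ fromℤ j
    fromℤ-mono-≤ {i} {j} i≤j with j ℤ.- i in eq | ℤ.i≤j⇒0≤j-i i≤j
    ... | + k | ℤ.+≤+ _ = ≤-by (fromℤ-nonneg k) (trans (sym (fromℤ-- j i)) (reflexive (≡.cong fromℤ eq)))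

    fromℤ-∣i∣≤ : ∀ {c} i → fromℤ i ≤ c → - fromℤ i ≤ c → fromℤ (+ ℤ.∣ i ∣) ≤ c
    fromℤ-∣i∣≤ (+ n)    i≤c _    = i≤c
    fromℤ-∣i∣≤ -[1+ n ] _   -i≤c = ≤-trans (≤-reflexive (fromℤ-neg -[1+ n ])) -i≤c

    fromℤ-cancel-≤ : ∀ {i j} → fromℤ i ≤ fromℤ j → i ℤ.≤ j
    fromℤ-cancel-≤ {i} {j} p = ℤ.≮⇒≥ λ j<i →
      0<⇒x+e≰x 0<1 (≤-trans (≤-reflexive (trans (+-comm (fromℤ j) 1#) (sym (trans (fromℤ-+ (+ 1) j) (+-congʳ fromℤ-1)))))
                            (≤-trans (fromℤ-mono-≤ (ℤ.i<j⇒suc[i]≤j j<i)) p))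

    -- If some `x` bounded the naturals, they would have a supremum `s`; but `n + 1 ≤ s` for all `n`
    -- makes `s - 1` an upper bound too.
    archimedean : ∀ x → ∃[ n ] ¬ fromℤ (+ n) ≤ x
    archimedean x with em {∃[ n ] ¬ fromℤ (+ n) ≤ x}
    ... | yes found = found
    ... | no  none  = contradiction (supremum-absurd (complete A (0# , 0 , refl) (x , bounded))) id
      where
        A : Carrier → Set
        A y = ∃[ n ] y ≈ fromℤ (+ n)
        bounded : IsUpperBound A x
        bounded y (n , y≈n) with em {fromℤ (+ n) ≤ x}
        ... | yes p = ≤-trans (≤-reflexive y≈n) p
        ... | no ¬p = contradiction (n , ¬p) none
        supremum-absurd : ¬ ∃ (IsSupremum A)
        supremum-absurd (s , upper , lowest) = 0<⇒x≰x-e 0<1 (lowest (s - 1#) λ y (n , y≈n) →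
          ≤-trans (≤-reflexive y≈n) (≤-by₁ (upper (fromℤ (+ suc n)) (suc n , refl))
            (solve 2 (λ s n → s :- :1 :- n := s :- (:1 :+ n)) refl s (fromℤ (+ n)))))

  opaque
    -- Search upwards from an integer `- m` below `x` for the least `k` such that `- m + k + 1`
    -- exceeds `x`. Then `- m + k ≤ x`, by minimality or, for `k = 0`, by the choice of `m`.
    ⌊_⌋-spec : ∀ x → ∃[ i ] fromℤ i ≤ x × ¬ fromℤ i + 1# ≤ x
    ⌊ x ⌋-spec with archimedean (- x) | archimedean x
    ... | m , m≰-x | n , n≰x with least em (λ k → ¬ fromℤ (ℤ.- + m ℤ.+ + k) + 1# ≤ x) {m ℕ.+ n} above
      where
        above : ¬ fromℤ (ℤ.- + m ℤ.+ + (m ℕ.+ n)) + 1# ≤ x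
        above p = n≰x (≤-trans (≤-reflexive (reflexive (≡.cong fromℤ (begin
          + n                            ≡⟨ ℤ.+-identityˡ (+ n) ⟨
          + 0 ℤ.+ + n                    ≡⟨ ≡.cong (ℤ._+ + n) (ℤ.+-inverseˡ (+ m)) ⟨
          ℤ.- + m ℤ.+ + m ℤ.+ + n        ≡⟨ ℤ.+-assoc (ℤ.- + m) (+ m) (+ n) ⟩
          ℤ.- + m ℤ.+ + (m ℕ.+ n)        ∎))))
          (≤-trans (≤-by 0≤1 (solve 1 (λ z → z :+ :1 :- z := :1) refl _)) p))
          where open ≡.≡-Reasoning
    ... | zero , k-above , _ = ℤ.- + m ℤ.+ + 0 , ≤-trans (≤-reflexive (trans (reflexive (≡.cong fromℤ (ℤ.+-identityʳ (ℤ.- + m)))) (fromℤ-neg (+ m))))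
        (≤-by₁ (≰⇒≥ m≰-x) (solve 2 (λ x y → x :- :- y := y :- :- x) refl x (fromℤ (+ m)))) , k-above
    ... | suc j , k-above , k-least with em {fromℤ (ℤ.- + m ℤ.+ + j) + 1# ≤ x}
    ...   | no  ¬p = contradiction (k-least j ¬p) (ℕ.<⇒≱ ℕ.≤-refl)
    ...   | yes p  = ℤ.- + m ℤ.+ + suc j , ≤-trans (≤-reflexive (trans (reflexive (≡.cong fromℤ
                       (≡.trans (≡.cong (λ z → ℤ.- + m ℤ.+ z) (≡.cong +_ (ℕ.+-comm 1 j)))
                                (≡.sym (ℤ.+-assoc (ℤ.- + m) (+ j) (+ 1)))))) (fromℤ-+1 (ℤ.- + m ℤ.+ + j)))) p , k-above

    ⌊_⌋ : Carrier → ℤ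
    ⌊ x ⌋ = proj₁ ⌊ x ⌋-spec

    ⌊x⌋≤x : ∀ x → fromℤ ⌊ x ⌋ ≤ x
    ⌊x⌋≤x x = proj₁ (proj₂ ⌊ x ⌋-spec)

    ⌊x⌋+1≰x : ∀ x → ¬ fromℤ ⌊ x ⌋ + 1# ≤ x
    ⌊x⌋+1≰x x = proj₂ (proj₂ ⌊ x ⌋-spec)

    ⌊⌋-mono : ∀ {x y} → x ≤ y → ⌊ x ⌋ ℤ.≤ ⌊ y ⌋
    ⌊⌋-mono {x} {y} x≤y = ℤ.≮⇒≥ λ y<x → ⌊x⌋+1≰x y
      (≤-trans (≤-reflexive (trans (+-comm _ _) (sym (trans (fromℤ-+ (+ 1) ⌊ y ⌋) (+-congʳ fromℤ-1)))))
        (≤-trans (fromℤ-mono-≤ (ℤ.i<j⇒suc[i]≤j y<x)) (≤-trans (⌊x⌋≤x x) x≤y)))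

    ⌊⌋-cong : ∀ {x y} → x ≈ y → ⌊ x ⌋ ≡ ⌊ y ⌋
    ⌊⌋-cong x≈y = ℤ.≤-antisym (⌊⌋-mono (≤-reflexive x≈y)) (⌊⌋-mono (≤-reflexive (sym x≈y)))

  opaque
    t[xr]≈x : ∀ {t r} → t * r ≈ 1# → ∀ x → t * (x * r) ≈ x
    t[xr]≈x {t} {r} tr≈1 x =
      trans (solve 3 (λ t x r → t :* (x :* r) := t :* r :* x) refl t x r) (trans (*-congʳ tr≈1) (*-identityˡ x))

    0<2d+1 : ∀ {d} → 0# ≤ d → 0# < d + d + 1#
    0<2d+1 {d} 0≤d = ≰⇒> λ t≤0 → 1≰0 (≤-by₃ t≤0 0≤d 0≤d
      (solve 1 (λ d → :0 :- :1 := (:0 :- (d :+ d :+ :1)) :+ (d :- :0) :+ (d :- :0)) refl d))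

    [d+h]²≤ : ∀ {a d h} → 0# ≤ h → h ≤ 1# → (d + d + 1#) * h ≤ a - d * d → (d + h) * (d + h) ≤ a
    [d+h]²≤ {a} {d} {h} 0≤h h≤1 th≤ = ≤-by (0≤+ (0≤b-a th≤) (*-nonneg 0≤h (0≤b-a h≤1)))
      (solve 3 (λ a d h → a :- (d :+ h) :* (d :+ h) :=
         (a :- d :* d :- (d :+ d :+ :1) :* h) :+ h :* (:1 :- h)) refl a d h)

    ≤[d-h]² : ∀ {a d h} → 0# ≤ h → (d + d + 1#) * h ≤ d * d - a → a ≤ (d - h) * (d - h)
    ≤[d-h]² {a} {d} {h} 0≤h th≤ = ≤-by (0≤+ (0≤b-a th≤) (0≤+ (0≤x² h) 0≤h))
      (solve 3 (λ a d h → (d :- h) :* (d :- h) :- a :=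
         (d :* d :- a :- (d :+ d :+ :1) :* h) :+ (h :* h :+ h)) refl a d h)

  opaque
    -- For `0 ≤ h ≤ 1` the square increases by at most `(2 d + 1) h`. So `h = (a - d²) / (2 d + 1)`
    -- is admissible, cut down to 1 if it is larger.
    grow : ∀ {a d} → 0# ≤ d → ¬ a ≤ d * d → ∃[ h ] 0# < h × (d + h) * (d + h) ≤ a
    grow {a} {d} 0≤d a≰d² with recip (0<2d+1 0≤d)
    ... | r , 0<r , tr≈1 with total 1# ((a - d * d) * r)
    ...   | inj₁ 1≤ = 1# , 0<1 ,
      [d+h]²≤ 0≤1 ≤-refl (≤-trans (*-monoˡ-≤ (proj₁ (0<2d+1 0≤d)) 1≤) (≤-reflexive (t[xr]≈x tr≈1 (a - d * d))))
    ...   | inj₂ ≤1 = (a - d * d) * r , 0<h , [d+h]²≤ (proj₁ 0<h) ≤1 (≤-reflexive (t[xr]≈x tr≈1 (a - d * d)))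
      where
        0<h : 0# < (a - d * d) * r
        0<h = 0<* (0<b-a (≰⇒> a≰d²)) 0<r

    -- `(d - h)²` is at least `d² - (2 d + 1) h`, so the analogous quotient works. It is at most
    -- `d`, because `(2 d + 1) d` exceeds `d² - a` by `d² + d + a`.
    shrink : ∀ {a d} → 0# ≤ a → 0# ≤ d → ¬ d * d ≤ a → ∃[ h ] 0# < h × h ≤ d × a ≤ (d - h) * (d - h)
    shrink {a} {d} 0≤a 0≤d d²≰a with recip (0<2d+1 0≤d)
    ... | r , 0<r , tr≈1 = (d * d - a) * r , 0<h ,
        *-cancelˡ-≤ (0<2d+1 0≤d) (≤-trans (≤-reflexive (t[xr]≈x tr≈1 (d * d - a)))
          (≤-by (0≤+ (0≤+ (0≤x² d) 0≤d) 0≤a)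
            (solve 2 (λ a d → (d :+ d :+ :1) :* d :- (d :* d :- a) := d :* d :+ d :+ a) refl a d))) ,
        ≤[d-h]² (proj₁ 0<h) (≤-reflexive (t[xr]≈x tr≈1 (d * d - a)))
      where
        0<h : 0# < (d * d - a) * r
        0<h = 0<* (0<b-a (≰⇒> d²≰a)) 0<r

    sqrt≤1+ : ∀ {a x} → 0# ≤ a → x * x ≤ a → x ≤ a + 1#
    sqrt≤1+ {a} {x} 0≤a x²≤a = square-cancel-≤ (0≤+ 0≤a 0≤1)
      (≤-by (0≤+ (0≤+ (0≤+ (0≤x² a) 0≤a) 0≤1) (0≤b-a x²≤a))
        (solve 2 (λ a x → (a :+ :1) :* (a :+ :1) :- x :* x := a :* a :+ a :+ :1 :+ (a :- x :* x)) refl a x))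

  opaque
    sqrt : ∀ {a} → 0# ≤ a → ∃[ d ] 0# ≤ d × d * d ≈ a
    sqrt {a} 0≤a
      with complete (λ x → 0# ≤ x × x * x ≤ a) (0# , ≤-refl , ≤-trans (≤-reflexive (zeroˡ 0#)) 0≤a)
                    (a + 1# , λ x (_ , x²≤a) → sqrt≤1+ 0≤a x²≤a)
    ... | d , upper , lowest = d , 0≤d , antisym d²≤a a≤d²
      where
        0≤d : 0# ≤ d
        0≤d = upper 0# (≤-refl , ≤-trans (≤-reflexive (zeroˡ 0#)) 0≤a)
        a≤d² : a ≤ d * d
        a≤d² with em {a ≤ d * d}
        ... | yes p = p
        ... | no ¬p with grow 0≤d ¬p
        ...   | h , 0<h , [d+h]²≤a = contradiction (upper (d + h) (0≤+ 0≤d (proj₁ 0<h) , [d+h]²≤a)) (0<⇒x+e≰x 0<h)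
        d²≤a : d * d ≤ a
        d²≤a with em {d * d ≤ a}
        ... | yes p = p
        ... | no ¬p with shrink 0≤a 0≤d ¬p
        ...   | h , 0<h , h≤d , a≤[d-h]² =
          contradiction (lowest (d - h) λ x (_ , x²≤a) → square-cancel-≤ (0≤b-a h≤d) (≤-trans x²≤a a≤[d-h]²))
                        (0<⇒x≰x-e 0<h)

  infixl 7 _⊓_
  infixl 6 _⊔_

  opaque
    _⊓_ _⊔_ : Carrier → Carrier → Carrier
    x ⊓ y with total x y
    ... | inj₁ _ = x
    ... | inj₂ _ = y
    x ⊔ y with total x y
    ... | inj₁ _ = y
    ... | inj₂ _ = x

    x⊓y≤x : ∀ x y → x ⊓ y ≤ x
    x⊓y≤x x y with total x y
    ... | inj₁ _   = ≤-refl
    ... | inj₂ y≤x = y≤x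

    x⊓y≤y : ∀ x y → x ⊓ y ≤ y
    x⊓y≤y x y with total x y
    ... | inj₁ x≤y = x≤y
    ... | inj₂ _   = ≤-refl

    ⊓-glb : ∀ {x y z} → z ≤ x → z ≤ y → z ≤ x ⊓ y
    ⊓-glb {x} {y} z≤x z≤y with total x y
    ... | inj₁ _ = z≤x
    ... | inj₂ _ = z≤y

    x≤x⊔y : ∀ x y → x ≤ x ⊔ y
    x≤x⊔y x y with total x y
    ... | inj₁ x≤y = x≤y
    ... | inj₂ _   = ≤-refl

    y≤x⊔y : ∀ x y → y ≤ x ⊔ y
    y≤x⊔y x y with total x y
    ... | inj₁ _   = ≤-refl
    ... | inj₂ y≤x = y≤x

    ⊔-lub : ∀ {x y z} → x ≤ z → y ≤ z → x ⊔ y ≤ z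
    ⊔-lub {x} {y} x≤z y≤z with total x y
    ... | inj₁ _ = y≤z
    ... | inj₂ _ = x≤z

    ∣_∣ : Carrier → Carrier
    ∣ x ∣ = x ⊔ - x

    0≤∣x∣ : ∀ x → 0# ≤ ∣ x ∣
    0≤∣x∣ x with total 0# x
    ... | inj₁ 0≤x = ≤-trans 0≤x (x≤x⊔y x (- x))
    ... | inj₂ x≤0 = ≤-trans (≤-by₁ x≤0 (solve 1 (λ x → :- x :- :0 := :0 :- x) refl x)) (y≤x⊔y x (- x))

    x≤∣x∣ : ∀ x → x ≤ ∣ x ∣
    x≤∣x∣ x = x≤x⊔y x (- x)

    -x≤∣x∣ : ∀ x → - x ≤ ∣ x ∣
    -x≤∣x∣ x = y≤x⊔y x (- x)

    ∣x∣≈±x : ∀ x → ∣ x ∣ ≈ x ⊎ ∣ x ∣ ≈ - x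
    ∣x∣≈±x x with total x (- x)
    ... | inj₁ _ = inj₂ refl
    ... | inj₂ _ = inj₁ refl

    ∣x∣²≈x² : ∀ x → ∣ x ∣ * ∣ x ∣ ≈ x * x
    ∣x∣²≈x² x with ∣x∣≈±x x
    ... | inj₁ ∣x∣≈x  = *-cong ∣x∣≈x ∣x∣≈x
    ... | inj₂ ∣x∣≈-x = trans (*-cong ∣x∣≈-x ∣x∣≈-x) (solve 1 (λ x → :- x :* :- x := x :* x) refl x)

    ∣x∣≤ : ∀ {x c} → x ≤ c → - x ≤ c → ∣ x ∣ ≤ c
    ∣x∣≤ = ⊔-lub

    clamp : Carrier → Carrier
    clamp x = 0# ⊔ 1# ⊓ x

    0≤clamp : ∀ x → 0# ≤ clamp x
    0≤clamp x = x≤x⊔y 0# (1# ⊓ x)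

    clamp≤1 : ∀ x → clamp x ≤ 1#
    clamp≤1 x = ⊔-lub 0≤1 (x⊓y≤x 1# x)

    clamp-mono : ∀ {x y} → x ≤ y → clamp x ≤ clamp y
    clamp-mono {x} {y} x≤y = ⊔-lub (0≤clamp y)
      (≤-trans (⊓-glb (x⊓y≤x 1# x) (≤-trans (x⊓y≤y 1# x) x≤y)) (y≤x⊔y 0# (1# ⊓ y)))

    clamp-low : ∀ {x} → x ≤ 0# → clamp x ≈ 0#
    clamp-low {x} x≤0 = antisym (⊔-lub ≤-refl (≤-trans (x⊓y≤y 1# x) x≤0)) (0≤clamp x)

    clamp-high : ∀ {x} → 1# ≤ x → clamp x ≈ 1#
    clamp-high {x} 1≤x = antisym (clamp≤1 x) (≤-trans (⊓-glb ≤-refl 1≤x) (y≤x⊔y 0# (1# ⊓ x)))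

    clamp-lipschitz : ∀ {x y} → x ≤ y → clamp y - clamp x ≤ y - x
    clamp-lipschitz {x} {y} x≤y = ≤-by₁ (⊔-lub (0≤+ (0≤clamp x) (0≤b-a x≤y)) (bound (total 1# x)))
        (solve 4 (λ x y a b → y :- x :- (b :- a) := a :+ (y :- x) :- b) refl x y (clamp x) (clamp y))
      where
        bound : 1# ≤ x ⊎ x ≤ 1# → 1# ⊓ y ≤ clamp x + (y - x)
        bound (inj₁ 1≤x) = ≤-trans (x⊓y≤x 1# y) (≤-by₂ (≤-reflexive (sym (clamp-high 1≤x))) (0≤b-a x≤y)
          (solve 2 (λ c z → c :+ z :- :1 := (c :- :1) :+ (z :- :0)) refl (clamp x) (y - x)))
        bound (inj₂ x≤1) = ≤-trans (x⊓y≤y 1# y) (≤-by₁ (≤-trans (⊓-glb x≤1 ≤-refl) (y≤x⊔y 0# (1# ⊓ x)))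
          (solve 3 (λ c x y → c :+ (y :- x) :- y := c :- x) refl (clamp x) x y))

-- Irredundant covers of a set of pixels by 2 × 2 blocks

module BlockCover where
  open ≡ using (refl)
  open +-*-Solver using (solve; _:=_; con; _:+_; _:*_; _:-_; :-_)

  -- The pigeonhole principle for a relation: the partner of the head is deleted from `ys`, and
  -- injectivity ensures that the other elements keep their partners.
  length-≤-via : ∀ {A B : Set} (R : A → B → Set) {xs : List A} {ys : List B} → Unique xs →
                 (∀ {x} → x ∈ xs → ∃[ y ] y ∈ ys × R x y) →
                 (∀ {x x′ y} → x ∈ xs → x′ ∈ xs → R x y → R x′ y → x ≡ x′) →
                 List.length xs ℕ.≤ List.length ys
  length-≤-via R [] _ _ = ℕ.z≤n
  length-≤-via R {x ∷ xs} {ys} (x∉xs ∷ !xs) image injective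
    with y , y∈ys , Rxy ← image (here refl)
    with as , bs , refl ← ∈-∃++ y∈ys = begin
      suc (List.length xs)                           ≤⟨ ℕ.s≤s (length-≤-via R !xs image′ λ p q → injective (there p) (there q)) ⟩
      suc (List.length (as ++ bs))                   ≡⟨ ≡.cong suc (List.length-++ as) ⟩
      suc (List.length as ℕ.+ List.length bs)        ≡⟨ ℕ.+-suc (List.length as) (List.length bs) ⟨
      List.length as ℕ.+ suc (List.length bs)        ≡⟨ List.length-++ as ⟨
      List.length (as ++ y ∷ bs)                     ∎
    where
      open ℕ.≤-Reasoning
      image′ : ∀ {x′} → x′ ∈ xs → ∃[ y′ ] y′ ∈ as ++ bs × R x′ y′
      image′ x′∈xs with y′ , y′∈ , Rx′y′ ← image (there x′∈xs) with ∈-++⁻ as y′∈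
      ... | inj₁ y′∈as          = y′ , ∈-++⁺ˡ y′∈as , Rx′y′
      ... | inj₂ (there y′∈bs)  = y′ , ∈-++⁺ʳ as y′∈bs , Rx′y′
      ... | inj₂ (here refl)    =
        contradiction (injective (here refl) (there x′∈xs) Rxy Rx′y′) (All.lookup x∉xs x′∈xs)

  length-mono-⊆ : ∀ {A : Set} {xs ys : List A} → Unique xs → (∀ {x} → x ∈ xs → x ∈ ys) →
                  List.length xs ℕ.≤ List.length ys
  length-mono-⊆ !xs xs⊆ys = length-≤-via _≡_ !xs (λ x∈ → _ , xs⊆ys x∈ , refl) (λ _ _ p q → ≡.trans p (≡.sym q))

  length-cartesianProduct : ∀ {A B : Set} (xs : List A) (ys : List B) →
                            List.length (cartesianProduct xs ys) ≡ List.length xs ℕ.* List.length ys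
  length-cartesianProduct []       ys = refl
  length-cartesianProduct (x ∷ xs) ys = begin
    List.length (map (x ,_) ys ++ cartesianProduct xs ys)                       ≡⟨ List.length-++ (map (x ,_) ys) ⟩
    List.length (map (x ,_) ys) ℕ.+ List.length (cartesianProduct xs ys)        ≡⟨ ≡.cong₂ ℕ._+_ (List.length-map (x ,_) ys) (length-cartesianProduct xs ys) ⟩
    List.length ys ℕ.+ List.length xs ℕ.* List.length ys                        ∎
    where open ≡.≡-Reasoning

  -- The lattice point (a , b), regarded as the centre of the 2 × 2 block of
  -- pixels (a - 1 , b - 1), …, (a , b).
  Vertex : Set
  Vertex = ℤ × ℤ

  _≟ᵥ_ : DecidableEquality Vertex
  _≟ᵥ_ = ≡-dec ℤ._≟_ ℤ._≟_

  data Corner : Set where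
    sw se nw ne : Corner

  corners : List Corner
  corners = sw ∷ se ∷ nw ∷ ne ∷ []

  ∈-corners : ∀ c → c ∈ corners
  ∈-corners sw = here refl
  ∈-corners se = there (here refl)
  ∈-corners nw = there (there (here refl))
  ∈-corners ne = there (there (there (here refl)))

  corner : Pixel → Corner → Vertex
  corner (i , j) sw = i , j
  corner (i , j) se = i ℤ.+ + 1 , j
  corner (i , j) nw = i , j ℤ.+ + 1
  corner (i , j) ne = i ℤ.+ + 1 , j ℤ.+ + 1

  -- The pixel of the block around a vertex whose corner c is that vertex.
  blockPixel : Vertex → Corner → Pixel
  blockPixel (a , b) sw = a , b
  blockPixel (a , b) se = a ℤ.- + 1 , b
  blockPixel (a , b) nw = a , b ℤ.- + 1
  blockPixel (a , b) ne = a ℤ.- + 1 , b ℤ.- + 1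

  private
    [a-1]+1 : ∀ a → a ℤ.- + 1 ℤ.+ + 1 ≡ a
    [a-1]+1 = solve 1 (λ a → a :- con (+ 1) :+ con (+ 1) := a) refl

  corner-blockPixel : ∀ v c → corner (blockPixel v c) c ≡ v
  corner-blockPixel (a , b) sw = refl
  corner-blockPixel (a , b) se = ≡.cong (_, b) ([a-1]+1 a)
  corner-blockPixel (a , b) nw = ≡.cong (a ,_) ([a-1]+1 b)
  corner-blockPixel (a , b) ne = ≡.cong₂ _,_ ([a-1]+1 a) ([a-1]+1 b)

  others : Corner → List Corner
  others sw = se ∷ nw ∷ ne ∷ []
  others se = sw ∷ nw ∷ ne ∷ []
  others nw = sw ∷ se ∷ ne ∷ []
  others ne = sw ∷ se ∷ nw ∷ []

  length-others : ∀ c → List.length (others c) ≡ 3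
  length-others sw = refl
  length-others se = refl
  length-others nw = refl
  length-others ne = refl

  corners-! : Unique corners
  corners-! = ((λ ()) ∷ (λ ()) ∷ (λ ()) ∷ []) ∷ ((λ ()) ∷ (λ ()) ∷ []) ∷ ((λ ()) ∷ []) ∷ [] ∷ []

  others-! : ∀ c → Unique (others c)
  others-! sw = ((λ ()) ∷ (λ ()) ∷ []) ∷ ((λ ()) ∷ []) ∷ [] ∷ []
  others-! se = ((λ ()) ∷ (λ ()) ∷ []) ∷ ((λ ()) ∷ []) ∷ [] ∷ []
  others-! nw = ((λ ()) ∷ (λ ()) ∷ []) ∷ ((λ ()) ∷ []) ∷ [] ∷ []
  others-! ne = ((λ ()) ∷ (λ ()) ∷ []) ∷ ((λ ()) ∷ []) ∷ [] ∷ []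

  ∉-others : ∀ c → c ∉ others c
  ∉-others sw (there (there (there ())))
  ∉-others se (there (there (there ())))
  ∉-others nw (there (there (there ())))
  ∉-others ne (there (there (there ())))

  m≢1+m : ∀ {i} → i ≢ i ℤ.+ + 1
  m≢1+m {i} eq with ℤ-+-cancelˡ i (+ 0) (+ 1) (≡.trans (ℤ.+-identityʳ i) eq)
  ... | ()

  corner-injective : ∀ p {c d} → corner p c ≡ corner p d → c ≡ d
  corner-injective p {sw} {sw} _  = refl
  corner-injective p {sw} {se} eq = contradiction (≡.cong proj₁ eq) m≢1+m
  corner-injective p {sw} {nw} eq = contradiction (≡.cong proj₂ eq) m≢1+m
  corner-injective p {sw} {ne} eq = contradiction (≡.cong proj₁ eq) m≢1+m
  corner-injective p {se} {sw} eq = contradiction (≡.sym (≡.cong proj₁ eq)) m≢1+m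
  corner-injective p {se} {se} _  = refl
  corner-injective p {se} {nw} eq = contradiction (≡.cong proj₂ eq) m≢1+m
  corner-injective p {se} {ne} eq = contradiction (≡.cong proj₂ eq) m≢1+m
  corner-injective p {nw} {sw} eq = contradiction (≡.sym (≡.cong proj₂ eq)) m≢1+m
  corner-injective p {nw} {se} eq = contradiction (≡.cong proj₁ eq) m≢1+m
  corner-injective p {nw} {nw} _  = refl
  corner-injective p {nw} {ne} eq = contradiction (≡.cong proj₁ eq) m≢1+m
  corner-injective p {ne} {sw} eq = contradiction (≡.sym (≡.cong proj₁ eq)) m≢1+m
  corner-injective p {ne} {se} eq = contradiction (≡.sym (≡.cong proj₂ eq)) m≢1+m
  corner-injective p {ne} {nw} eq = contradiction (≡.sym (≡.cong proj₁ eq)) m≢1+m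
  corner-injective p {ne} {ne} _  = refl

  _∋_ : Vertex → Pixel → Set
  v ∋ p = ∃[ c ] corner p c ≡ v

  Private : List Vertex → Vertex → Pixel → Set
  Private S v p = v ∋ p × (∀ w → w ∈ S → w ∋ p → w ≡ v)

  -- Give each block of S seven tokens: one at each of its (pixel , corner)
  -- incidences, and one at each of the remaining three corners of a private
  -- pixel. All tokens are distinct, and a pixel has only four corners.
  module Tokens (D : List Pixel) {S : List Vertex} (!S : Unique S)
                (inside : ∀ {v} → v ∈ S → ∀ c → blockPixel v c ∈ D)
                (private-pixel : ∀ {v} → v ∈ S → ∃[ p ] p ∈ D × Private S v p) where

    record Member : Set where
      constructor member
      field
        {vertex}  : Vertex
        vertex∈S  : vertex ∈ S

      pixel : Pixel
      pixel = proj₁ (private-pixel vertex∈S)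

      pixel∈D : pixel ∈ D
      pixel∈D = proj₁ (proj₂ (private-pixel vertex∈S))

      pixel-corner : Corner
      pixel-corner = proj₁ (proj₁ (proj₂ (proj₂ (private-pixel vertex∈S))))

      pixel-corner≡ : corner pixel pixel-corner ≡ vertex
      pixel-corner≡ = proj₂ (proj₁ (proj₂ (proj₂ (private-pixel vertex∈S))))

      pixel-only : ∀ w → w ∈ S → w ∋ pixel → w ≡ vertex
      pixel-only = proj₂ (proj₂ (proj₂ (private-pixel vertex∈S)))

      own : Corner → Pixel × Corner
      own c = blockPixel vertex c , c

      tokens : List (Pixel × Corner)
      tokens = map own corners ++ map (pixel ,_) (others pixel-corner)

      -- The two kinds of token differ in whether their lattice point belongs to `S`. An own token
      -- sits at the centre of the block. A token of the second kind sits at another corner of the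
      -- private pixel; a member of `S` there would contain that pixel, hence be `vertex`, whose
      -- corner was left out.
      token-view : ∀ {p c} → (p , c) ∈ tokens →
                   (corner p c ≡ vertex × p ∈ D) ⊎ (p ≡ pixel × corner p c ∉ S)
      token-view t∈ with ∈-++⁻ (map own corners) t∈
      ... | inj₁ t∈own with c , _ , refl ← ∈-map⁻ own {xs = corners} t∈own =
        inj₁ (corner-blockPixel vertex c , inside vertex∈S c)
      ... | inj₂ t∈rest with c , c∈ , refl ← ∈-map⁻ (pixel ,_) t∈rest =
        inj₂ (refl , λ w∈S → ∉-others pixel-corner (≡.subst (_∈ others pixel-corner)
          (corner-injective pixel (≡.trans (pixel-only _ w∈S (c , refl)) (≡.sym pixel-corner≡))) c∈))

      tokens-! : Unique tokens
      tokens-! = Unique.++⁺ (Unique.map⁺ {f = own} (≡.cong proj₂) corners-!)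
                            (Unique.map⁺ (≡.cong proj₂) (others-! pixel-corner)) disjoint
        where
          disjoint : Disjoint (map own corners) (map (pixel ,_) (others pixel-corner))
          disjoint (t∈own , t∈rest) with c , _ , refl ← ∈-map⁻ own {xs = corners} t∈own with d , d∈ , eq ← ∈-map⁻ (pixel ,_) t∈rest =
            ∉-others pixel-corner (≡.subst (_∈ others pixel-corner) (corner-injective pixel (begin
              corner pixel d                  ≡⟨ ≡.cong₂ corner (≡.cong proj₁ eq) (≡.cong proj₂ eq) ⟨
              corner (blockPixel vertex c) c  ≡⟨ corner-blockPixel vertex c ⟩
              vertex                          ≡⟨ pixel-corner≡ ⟨
              corner pixel pixel-corner       ∎)) d∈)
            where open ≡.≡-Reasoning

      length-tokens : List.length tokens ≡ 7
      length-tokens = ≡.cong (4 ℕ.+_) (≡.trans (List.length-map (pixel ,_) (others pixel-corner)) (length-others pixel-corner))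

      tokens⊆ : ∀ {t} → t ∈ tokens → t ∈ cartesianProduct D corners
      tokens⊆ {_ , c} t∈ with token-view t∈
      ... | inj₁ (_ , p∈D)  = ∈-cartesianProduct⁺ p∈D (∈-corners c)
      ... | inj₂ (refl , _) = ∈-cartesianProduct⁺ pixel∈D (∈-corners c)

    open Member

    -- A common token has one lattice point. If it is an own token of both blocks, that point is the
    -- centre of both; if of one block only, the point would be both in and outside `S`; if of
    -- neither, the blocks share a private pixel.
    tokens-disjoint : ∀ {v w} (v∈ : v ∈ S) (w∈ : w ∈ S) → v ≢ w →
                      Disjoint (tokens (member v∈)) (tokens (member w∈))
    tokens-disjoint v∈ w∈ v≢w {_ , c} (t∈v , t∈w)
      with token-view (member v∈) t∈v | token-view (member w∈) t∈w
    ... | inj₁ (v≡ , _)  | inj₁ (w≡ , _)  = v≢w (≡.trans (≡.sym v≡) w≡)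
    ... | inj₁ (v≡ , _)  | inj₂ (_ , ∉S)  = ∉S (≡.subst (_∈ S) (≡.sym v≡) v∈)
    ... | inj₂ (_ , ∉S)  | inj₁ (w≡ , _)  = ∉S (≡.subst (_∈ S) (≡.sym w≡) w∈)
    ... | inj₂ (p≡v , _) | inj₂ (p≡w , _) = v≢w (≡.sym (pixel-only (member v∈) _ w∈
      (pixel-corner (member w∈) ,
       ≡.trans (≡.cong (λ p → corner p (pixel-corner (member w∈))) (≡.trans (≡.sym p≡v) p≡w))
               (pixel-corner≡ (member w∈)))))

    allTokens : ∀ {T} → (∀ {v} → v ∈ T → v ∈ S) → List (List (Pixel × Corner))
    allTokens {[]}    _   = []
    allTokens {v ∷ T} T⊆S = tokens (member (T⊆S (here refl))) ∷ allTokens (T⊆S ∘ there)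

    ∈-allTokens : ∀ {T} (T⊆S : ∀ {v} → v ∈ T → v ∈ S) {ts} → ts ∈ allTokens {T} T⊆S →
                  ∃[ v ] v ∈ T × ∃[ v∈S ] ts ≡ tokens (member {v} v∈S)
    ∈-allTokens {v ∷ T} T⊆S (here refl) = v , here refl , _ , refl
    ∈-allTokens {v ∷ T} T⊆S (there ts∈) with w , w∈T , eq ← ∈-allTokens (T⊆S ∘ there) ts∈ = w , there w∈T , eq

    allTokens-disjoint : ∀ {T} (T⊆S : ∀ {v} → v ∈ T → v ∈ S) → Unique T → AllPairs Disjoint (allTokens {T} T⊆S)
    allTokens-disjoint {[]}    T⊆S []          = []
    allTokens-disjoint {v ∷ T} T⊆S (v∉T ∷ !T) =
      All.tabulate (λ ts∈ → disjoint (∈-allTokens (T⊆S ∘ there) ts∈)) ∷ allTokens-disjoint (T⊆S ∘ there) !T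
      where
        disjoint : ∀ {ts} → ∃[ w ] w ∈ T × ∃[ w∈S ] ts ≡ tokens (member {w} w∈S) →
                   Disjoint (tokens (member (T⊆S (here refl)))) ts
        disjoint (w , w∈T , w∈S , refl) = tokens-disjoint (T⊆S (here refl)) w∈S (All.lookup v∉T w∈T)

    length-allTokens : ∀ {T} (T⊆S : ∀ {v} → v ∈ T → v ∈ S) →
                       List.length (concat (allTokens {T} T⊆S)) ≡ 7 ℕ.* List.length T
    length-allTokens {[]}    T⊆S = refl
    length-allTokens {v ∷ T} T⊆S = begin
      List.length (ts ++ concat (allTokens (T⊆S ∘ there)))            ≡⟨ List.length-++ ts ⟩
      List.length ts ℕ.+ List.length (concat (allTokens (T⊆S ∘ there))) ≡⟨ ≡.cong₂ ℕ._+_ (length-tokens _) (length-allTokens (T⊆S ∘ there)) ⟩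
      7 ℕ.+ 7 ℕ.* List.length T                                        ≡⟨ ℕ.*-suc 7 (List.length T) ⟨
      7 ℕ.* suc (List.length T)                                        ∎
      where
        open ≡.≡-Reasoning
        ts : List (Pixel × Corner)
        ts = tokens (member (T⊆S (here refl)))

    7∣S∣≤4∣D∣ : 7 ℕ.* List.length S ℕ.≤ 4 ℕ.* List.length D
    7∣S∣≤4∣D∣ = begin
      7 ℕ.* List.length S                              ≡⟨ length-allTokens id ⟨
      List.length (concat (allTokens id))              ≤⟨ length-mono-⊆ all-! all⊆ ⟩
      List.length (cartesianProduct D corners)         ≡⟨ length-cartesianProduct D corners ⟩
      List.length D ℕ.* 4                              ≡⟨ ℕ.*-comm (List.length D) 4 ⟩
      4 ℕ.* List.length D                              ∎
      where
        open ℕ.≤-Reasoning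
        all-! : Unique (concat (allTokens id))
        all-! = Unique.concat⁺ (All.tabulate (λ ts∈ → each (∈-allTokens id ts∈))) (allTokens-disjoint id !S)
          where
            each : ∀ {ts} → ∃[ w ] w ∈ S × ∃[ w∈S ] ts ≡ tokens (member {w} w∈S) → Unique ts
            each (_ , _ , w∈S , refl) = tokens-! (member w∈S)
        all⊆ : ∀ {t} → t ∈ concat (allTokens id) → t ∈ cartesianProduct D corners
        all⊆ t∈ with ts , t∈ts , ts∈ ← ∈-concat⁻′ (allTokens id) t∈
                with _ , _ , w∈S , refl ← ∈-allTokens id ts∈ = tokens⊆ (member w∈S) t∈ts

  CoveredBy : List Pixel → List Vertex → Set
  CoveredBy D S = ∀ {p} → p ∈ D → ∃[ v ] v ∈ S × v ∋ p

  -- A cover of minimal length has a private pixel in every block.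
  sparse-subcover : ExcludedMiddle 0ℓ → (D : List Pixel) (W : List Vertex) →
                    (∀ {v} → v ∈ W → ∀ c → blockPixel v c ∈ D) → CoveredBy D W →
                    ∃[ S ] (∀ {v} → v ∈ S → v ∈ W) × CoveredBy D S × 7 ℕ.* List.length S ℕ.≤ 4 ℕ.* List.length D
  sparse-subcover em D W inside W-covers
    with least em (λ n → ∃[ S ] Unique S × (∀ {v} → v ∈ S → v ∈ W) × CoveredBy D S × List.length S ≡ n)
           (deduplicate _≟ᵥ_ W , deduplicate-! _≟ᵥ_ W , ∈-deduplicate⁻ _≟ᵥ_ W ,
            (λ p∈D → let v , v∈W , v∋p = W-covers p∈D in v , ∈-deduplicate⁺ _≟ᵥ_ v∈W , v∋p) , refl)
  ... | _ , (S , !S , S⊆W , S-covers , refl) , S-shortest =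
    S , S⊆W , S-covers , Tokens.7∣S∣≤4∣D∣ D !S (inside ∘ S⊆W) private-pixel
    where
      private-pixel : ∀ {v} → v ∈ S → ∃[ p ] p ∈ D × Private S v p
      private-pixel {v} v∈S with em {∃[ p ] p ∈ D × Private S v p}
      ... | yes found = found
      -- Without a private pixel, every pixel in the block of `v` lies in another block as well, so
      -- that deleting `v` leaves a shorter cover.
      ... | no  none  = contradiction (S-shortest _ (S′ , Unique.filter⁺ (λ w → ¬? (w ≟ᵥ v)) !S ,
              S⊆W ∘ proj₁ ∘ ∈-filter⁻ (λ w → ¬? (w ≟ᵥ v)) , S′-covers , refl)) (ℕ.<⇒≱ shorter)
        where
          S′ : List Vertex
          S′ = filter (λ w → ¬? (w ≟ᵥ v)) S
          shorter : List.length S′ ℕ.< List.length S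
          shorter = List.filter-notAll (λ w → ¬? (w ≟ᵥ v)) S (lose v∈S (λ v≢v → v≢v refl))
          S′-covers : CoveredBy D S′
          S′-covers {p} p∈D with em {∃[ w ] w ∈ S′ × w ∋ p}
          ... | yes found = found
          ... | no  none′ with w , w∈S , w∋p ← S-covers p∈D =
            contradiction (p , p∈D , ≡.subst (_∋ p) (only w w∈S w∋p) w∋p , only) none
            where
              only : ∀ w → w ∈ S → w ∋ p → w ≡ v
              only w w∈S w∋p with w ≟ᵥ v
              ... | yes w≡v = w≡v
              ... | no  w≢v = contradiction (w , ∈-filter⁺ (λ w → ¬? (w ≟ᵥ v)) w∈S w≢v , w∋p) none′

open BlockCover

-- Lattice rounding and the average over a grid of thresholds

module LatticeRounding where
  open ≡ using (refl)
  open +-*-Solver using (solve; _:=_; con; _:+_; _:*_; _:-_; :-_)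

  module Summation where

    ∑ : ∀ {A : Set} → List A → (A → ℕ) → ℕ
    ∑ xs f = sum (map f xs)

    ∑-mono : ∀ {A : Set} (xs : List A) {f g : A → ℕ} → (∀ {x} → x ∈ xs → f x ℕ.≤ g x) → ∑ xs f ℕ.≤ ∑ xs g
    ∑-mono []       f≤g = ℕ.z≤n
    ∑-mono (x ∷ xs) f≤g = ℕ.+-mono-≤ (f≤g (here refl)) (∑-mono xs (f≤g ∘ there))

    ∑-cong : ∀ {A : Set} (xs : List A) {f g : A → ℕ} → (∀ x → f x ≡ g x) → ∑ xs f ≡ ∑ xs g
    ∑-cong xs f≡g = ≡.cong sum (List.map-cong f≡g xs)

    private
      interchange : ∀ a b c d → (a ℕ.+ b) ℕ.+ (c ℕ.+ d) ≡ (a ℕ.+ c) ℕ.+ (b ℕ.+ d)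
      interchange = ℕ-Solver.solve-∀

    ∑-+ : ∀ {A : Set} (xs : List A) (f g : A → ℕ) → ∑ xs (λ x → f x ℕ.+ g x) ≡ ∑ xs f ℕ.+ ∑ xs g
    ∑-+ []       f g = refl
    ∑-+ (x ∷ xs) f g = ≡.trans (≡.cong (f x ℕ.+ g x ℕ.+_) (∑-+ xs f g)) (interchange (f x) (g x) _ _)

    ∑-const : ∀ {A : Set} (xs : List A) c → ∑ xs (λ _ → c) ≡ List.length xs ℕ.* c
    ∑-const []       c = refl
    ∑-const (x ∷ xs) c = ≡.cong (c ℕ.+_) (∑-const xs c)

    ∑-* : ∀ {A : Set} (xs : List A) c (f : A → ℕ) → ∑ xs (λ x → c ℕ.* f x) ≡ c ℕ.* ∑ xs f
    ∑-* []       c f = ≡.sym (ℕ.*-zeroʳ c)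
    ∑-* (x ∷ xs) c f = ≡.trans (≡.cong (c ℕ.* f x ℕ.+_) (∑-* xs c f)) (≡.sym (ℕ.*-distribˡ-+ c (f x) _))

    ∑-swap : ∀ {A B : Set} (xs : List A) (ys : List B) (f : A → B → ℕ) →
             ∑ xs (λ x → ∑ ys (f x)) ≡ ∑ ys (λ y → ∑ xs (λ x → f x y))
    ∑-swap []       ys f = ≡.sym (≡.trans (∑-const ys 0) (ℕ.*-zeroʳ (List.length ys)))
    ∑-swap (x ∷ xs) ys f = ≡.trans (≡.cong (∑ ys (f x) ℕ.+_) (∑-swap xs ys f)) (≡.sym (∑-+ ys (f x) _))

    ∑-member : ∀ {A : Set} {xs : List A} (f : A → ℕ) {x} → x ∈ xs → f x ℕ.≤ ∑ xs f
    ∑-member f (here refl) = ℕ.m≤m+n _ _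
    ∑-member f (there x∈)  = ℕ.≤-trans (∑-member f x∈) (ℕ.m≤n+m _ _)

    ∑∑∑-≤ : ∀ {A B C : Set} (xs : List A) (ys : List B) (zs : List C) (f : A → B → C → ℕ) K →
            (∀ z → ∑ xs (λ x → ∑ ys (λ y → f x y z)) ℕ.≤ K) →
            ∑ xs (λ x → ∑ ys (λ y → ∑ zs (f x y))) ℕ.≤ List.length zs ℕ.* K
    ∑∑∑-≤ xs ys zs f K bound = ℕ.≤-trans (ℕ.≤-reflexive (≡.trans
        (∑-cong xs λ x → ∑-swap ys zs (f x))
        (∑-swap xs zs (λ x z → ∑ ys (λ y → f x y z)))))
      (ℕ.≤-trans (∑-mono zs λ {z} _ → bound z) (ℕ.≤-reflexive (∑-const zs K)))

    ∑-upTo-const : ∀ n c → ∑ (upTo n) (λ _ → c) ≡ n ℕ.* c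
    ∑-upTo-const n c = ≡.trans (∑-const (upTo n) c) (≡.cong (ℕ._* c) (List.length-upTo n))

    -- With C = 5 H + 1, the average of 4 n w + C χ is at most 4 H + C / 5 < C.
    averaging : ∀ n H (w χ : ℕ → ℕ → ℕ) → 0 ℕ.< n → ∑ (upTo n) (λ a → ∑ (upTo n) (w a)) ≡ n ℕ.* H →
                5 ℕ.* ∑ (upTo n) (λ a → ∑ (upTo n) (χ a)) ℕ.≤ n ℕ.* n →
                ¬ (∀ a b → suc (5 ℕ.* H) ℕ.≤ 4 ℕ.* n ℕ.* w a b ℕ.+ suc (5 ℕ.* H) ℕ.* χ a b)
    averaging n H w χ 0<n ∑w≡ 5∑χ≤ large = impossible (n ℕ.* n) H _ (ℕ.*-mono-< 0<n 0<n) 5∑χ≤ (summed (suc (5 ℕ.* H)) large)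
      where
        summed : ∀ C → (∀ a b → C ℕ.≤ 4 ℕ.* n ℕ.* w a b ℕ.+ C ℕ.* χ a b) →
                 n ℕ.* n ℕ.* C ℕ.≤ 4 ℕ.* (n ℕ.* n) ℕ.* H ℕ.+ C ℕ.* ∑ (upTo n) (λ a → ∑ (upTo n) (χ a))
        summed C large = begin
          n ℕ.* n ℕ.* C
            ≡⟨ ≡.trans (ℕ.*-assoc n n C) (≡.sym (∑-upTo-const n (n ℕ.* C))) ⟩
          ∑ (upTo n) (λ a → n ℕ.* C)
            ≡⟨ ∑-cong (upTo n) (λ a → ≡.sym (∑-upTo-const n C)) ⟩
          ∑ (upTo n) (λ a → ∑ (upTo n) (λ b → C))
            ≤⟨ ∑-mono (upTo n) (λ {a} _ → ∑-mono (upTo n) (λ {b} _ → large a b)) ⟩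
          ∑ (upTo n) (λ a → ∑ (upTo n) (λ b → 4 ℕ.* n ℕ.* w a b ℕ.+ C ℕ.* χ a b))
            ≡⟨ ∑-cong (upTo n) (λ a → ≡.trans (∑-+ (upTo n) (λ b → 4 ℕ.* n ℕ.* w a b) (λ b → C ℕ.* χ a b))
                 (≡.cong₂ ℕ._+_ (∑-* (upTo n) (4 ℕ.* n) (w a)) (∑-* (upTo n) C (χ a)))) ⟩
          ∑ (upTo n) (λ a → 4 ℕ.* n ℕ.* ∑ (upTo n) (w a) ℕ.+ C ℕ.* ∑ (upTo n) (χ a))
            ≡⟨ ≡.trans (∑-+ (upTo n) (λ a → 4 ℕ.* n ℕ.* ∑ (upTo n) (w a)) (λ a → C ℕ.* ∑ (upTo n) (χ a)))
                 (≡.cong₂ ℕ._+_ (∑-* (upTo n) (4 ℕ.* n) (λ a → ∑ (upTo n) (w a))) (∑-* (upTo n) C (λ a → ∑ (upTo n) (χ a)))) ⟩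
          4 ℕ.* n ℕ.* ∑ (upTo n) (λ a → ∑ (upTo n) (w a)) ℕ.+ C ℕ.* ∑ (upTo n) (λ a → ∑ (upTo n) (χ a))
            ≡⟨ ≡.cong (ℕ._+ C ℕ.* ∑ (upTo n) (λ a → ∑ (upTo n) (χ a))) (≡.trans (≡.cong (4 ℕ.* n ℕ.*_) ∑w≡) (regroup n H)) ⟩
          4 ℕ.* (n ℕ.* n) ℕ.* H ℕ.+ C ℕ.* ∑ (upTo n) (λ a → ∑ (upTo n) (χ a)) ∎
          where
            open ℕ.≤-Reasoning
            regroup : ∀ n H → 4 ℕ.* n ℕ.* (n ℕ.* H) ≡ 4 ℕ.* (n ℕ.* n) ℕ.* H
            regroup = ℕ-Solver.solve-∀
        impossible : ∀ m H M → 0 ℕ.< m → 5 ℕ.* M ℕ.≤ m → m ℕ.* suc (5 ℕ.* H) ℕ.≤ 4 ℕ.* m ℕ.* H ℕ.+ suc (5 ℕ.* H) ℕ.* M → ⊥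
        -- Five times `total`, with `5 * M` replaced by `m`, has the same terms on both sides except
        -- for a surplus of `4 * m` on the left.
        impossible m H M 0<m 5M≤m total = ℕ.<⇒≱ 0<m (ℕ.≤-trans (ℕ.m≤m+n m (3 ℕ.* m))
          (ℕ.+-cancelˡ-≤ (20 ℕ.* (m ℕ.* H) ℕ.+ m ℕ.* suc (5 ℕ.* H)) (m ℕ.+ 3 ℕ.* m) 0
            (ℕ.≤-trans (ℕ.≤-reflexive (left m H)) (ℕ.≤-trans (ℕ.*-monoʳ-≤ 5 total) (ℕ.≤-trans (ℕ.≤-reflexive (right m H M))
              (ℕ.≤-trans (ℕ.+-monoʳ-≤ (20 ℕ.* (m ℕ.* H)) (ℕ.*-monoˡ-≤ (suc (5 ℕ.* H)) 5M≤m)) (ℕ.≤-reflexive (≡.sym (ℕ.+-identityʳ _)))))))))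
          where
            left : ∀ m H → 20 ℕ.* (m ℕ.* H) ℕ.+ m ℕ.* (1 ℕ.+ 5 ℕ.* H) ℕ.+ (m ℕ.+ 3 ℕ.* m) ≡ 5 ℕ.* (m ℕ.* (1 ℕ.+ 5 ℕ.* H))
            left = ℕ-Solver.solve-∀
            right : ∀ m H M → 5 ℕ.* (4 ℕ.* m ℕ.* H ℕ.+ (1 ℕ.+ 5 ℕ.* H) ℕ.* M) ≡ 20 ℕ.* (m ℕ.* H) ℕ.+ 5 ℕ.* M ℕ.* (1 ℕ.+ 5 ℕ.* H)
            right = ℕ-Solver.solve-∀

    ∑-upTo-suc : ∀ m (f : ℕ → ℕ) → ∑ (upTo (suc m)) f ≡ f 0 ℕ.+ ∑ (upTo m) (f ∘ suc)
    ∑-upTo-suc m f = ≡.cong (f 0 ℕ.+_) (≡.cong sum (begin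
      map f (applyUpTo suc m)     ≡⟨ List.map-applyUpTo suc f m ⟩
      applyUpTo (f ∘ suc) m       ≡⟨ List.map-upTo (f ∘ suc) m ⟨
      map (f ∘ suc) (upTo m)      ∎))
      where open ≡.≡-Reasoning

    ∑ℤ : ℕ → (ℕ → ℤ) → ℤ
    ∑ℤ zero    f = + 0
    ∑ℤ (suc m) f = f 0 ℤ.+ ∑ℤ m (f ∘ suc)

    ∑ℤ-last : ∀ m f → ∑ℤ (suc m) f ≡ ∑ℤ m f ℤ.+ f m
    ∑ℤ-last zero    f = ℤ.+-comm (f 0) (+ 0)
    ∑ℤ-last (suc m) f = ≡.trans (≡.cong (λ z → f 0 ℤ.+ z) (∑ℤ-last m (f ∘ suc)))
                                (≡.sym (ℤ.+-assoc (f 0) (∑ℤ m (f ∘ suc)) (f (suc m))))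

    ∑ℤ-cong : ∀ m {f g : ℕ → ℤ} → (∀ a → f a ≡ g a) → ∑ℤ m f ≡ ∑ℤ m g
    ∑ℤ-cong zero    f≡g = refl
    ∑ℤ-cong (suc m) f≡g = ≡.cong₂ ℤ._+_ (f≡g 0) (∑ℤ-cong m (f≡g ∘ suc))

    -- With the sign of every term known, the absolute values disappear and only two sums remain,
    -- which Hermite's identity can compare.
    ∑-∣-∣ : ∀ m {f g : ℕ → ℤ} → (∀ a → f a ℤ.≤ g a) →
            + ∑ (upTo m) (λ a → ℤ.∣ g a ℤ.- f a ∣) ≡ ∑ℤ m g ℤ.- ∑ℤ m f
    ∑-∣-∣ zero    f≤g = refl
    ∑-∣-∣ (suc m) {f} {g} f≤g = begin
      + ∑ (upTo (suc m)) h                                     ≡⟨ ≡.cong +_ (∑-upTo-suc m h) ⟩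
      + h 0 ℤ.+ + ∑ (upTo m) (h ∘ suc)                         ≡⟨ ≡.cong₂ ℤ._+_ (ℤ.0≤i⇒+∣i∣≡i (ℤ.i≤j⇒0≤j-i (f≤g 0))) (∑-∣-∣ m (f≤g ∘ suc)) ⟩
      (g 0 ℤ.- f 0) ℤ.+ (∑ℤ m (g ∘ suc) ℤ.- ∑ℤ m (f ∘ suc))    ≡⟨ shuffle (g 0) (f 0) _ _ ⟩
      ∑ℤ (suc m) g ℤ.- ∑ℤ (suc m) f                            ∎
      where
        open ≡.≡-Reasoning
        h : ℕ → ℕ
        h a = ℤ.∣ g a ℤ.- f a ∣
        shuffle : ∀ a b c d → (a ℤ.- b) ℤ.+ (c ℤ.- d) ≡ (a ℤ.+ c) ℤ.- (b ℤ.+ d)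
        shuffle = solve 4 (λ a b c d → (a :- b) :+ (c :- d) := (a :+ c) :- (b :+ d)) refl

  open Summation

  private
    0≤j-i : ∀ {i j} → i ℤ.≤ j → + 0 ℤ.≤ j ℤ.- i
    0≤j-i = ℤ.i≤j⇒0≤j-i

  ℤ-≤-by₁ : ∀ {a b l r} → l ℤ.≤ r → b ℤ.- a ≡ r ℤ.- l → a ℤ.≤ b
  ℤ-≤-by₁ p eq = ℤ.0≤i-j⇒j≤i (≡.subst (+ 0 ℤ.≤_) (≡.sym eq) (0≤j-i p))

  ℤ-≤-by₂ : ∀ {a b l r l′ r′} → l ℤ.≤ r → l′ ℤ.≤ r′ → b ℤ.- a ≡ (r ℤ.- l) ℤ.+ (r′ ℤ.- l′) → a ℤ.≤ b
  ℤ-≤-by₂ p q eq = ℤ.0≤i-j⇒j≤i (≡.subst (+ 0 ℤ.≤_) (≡.sym eq) (ℤ.+-mono-≤ (0≤j-i p) (0≤j-i q)))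

  ∣i∣≤ : ∀ {i m} → i ℤ.≤ + m → ℤ.- i ℤ.≤ + m → ℤ.∣ i ∣ ℕ.≤ m
  ∣i∣≤ {+ _}      i≤m _    = ℤ.drop‿+≤+ i≤m
  ∣i∣≤ { -[1+ _ ]} _   -i≤m = ℤ.drop‿+≤+ -i≤m

  ≤∣i∣ : ∀ {i m} → ℤ.∣ i ∣ ℕ.≤ m → i ℤ.≤ + m
  ≤∣i∣ {+ _}       ∣i∣≤m = ℤ.+≤+ ∣i∣≤m
  ≤∣i∣ { -[1+ _ ]} _     = ℤ.-≤+

  taxi : Vertex → Vertex → ℕ
  taxi (x , y) (x′ , y′) = ℤ.∣ x ℤ.- x′ ∣ ℕ.+ ℤ.∣ y ℤ.- y′ ∣

  travel : Vertex → List Vertex → ℕ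
  travel v []       = 0
  travel v (w ∷ ws) = taxi v w ℕ.+ travel w ws

  -- Floors on the lattice refined by the factor n

  module Rounding (n : ℕ) .{{_ : NonZero n}} where

    opaque
      fl : ℤ → ℤ
      fl X = X ℤ./ℕ n

      fl-lower : ∀ X → fl X ℤ.* + n ℤ.≤ X
      fl-lower X = ℤ.[n/ℕd]*d≤n X n

      fl-upper : ∀ X → X ℤ.< ℤ.suc (fl X) ℤ.* + n
      fl-upper X = ℤ.n<s[n/ℕd]*d X n

    private
      instance
        +n-positive : ℤ.Positive (+ n)
        +n-positive = ℤ.positive (ℤ.+<+ (ℕ.>-nonZero⁻¹ n))

    fl-≥ : ∀ {X q} → q ℤ.* + n ℤ.≤ X → q ℤ.≤ fl X
    fl-≥ {X} {q} qn≤X = ℤ.≮⇒≥ λ fl<q → ℤ.<-irrefl refl (ℤ.<-≤-trans (fl-upper X)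
      (ℤ.≤-trans (ℤ.*-monoʳ-≤-nonNeg (+ n) (ℤ.i<j⇒suc[i]≤j fl<q)) qn≤X))

    fl-≤ : ∀ {X q} → X ℤ.< ℤ.suc q ℤ.* + n → fl X ℤ.≤ q
    fl-≤ {X} {q} X<sqn = ℤ.≮⇒≥ λ q<fl → ℤ.<-irrefl refl (ℤ.<-≤-trans X<sqn
      (ℤ.≤-trans (ℤ.*-monoʳ-≤-nonNeg (+ n) (ℤ.i<j⇒suc[i]≤j q<fl)) (fl-lower X)))

    fl-unique : ∀ {X q} → q ℤ.* + n ℤ.≤ X → X ℤ.< ℤ.suc q ℤ.* + n → fl X ≡ q
    fl-unique p q = ℤ.≤-antisym (fl-≤ q) (fl-≥ p)

    fl-mono : ∀ {X Y} → X ℤ.≤ Y → fl X ℤ.≤ fl Y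
    fl-mono {X} X≤Y = fl-≥ (ℤ.≤-trans (fl-lower X) X≤Y)

    fl-+n : ∀ X → fl (X ℤ.+ + n) ≡ ℤ.suc (fl X)
    fl-+n X = fl-unique
      (≡.subst (ℤ._≤ X ℤ.+ + n) (lhs (fl X) (+ n)) (ℤ.+-monoˡ-≤ (+ n) (fl-lower X)))
      (≡.subst (X ℤ.+ + n ℤ.<_) (lhs (ℤ.suc (fl X)) (+ n)) (ℤ.+-monoˡ-< (+ n) (fl-upper X)))
      where
        lhs : ∀ q m → q ℤ.* m ℤ.+ m ≡ ℤ.suc q ℤ.* m
        lhs = solve 2 (λ q m → q :* m :+ m := (con (+ 1) :+ q) :* m) refl

    -- Hermite's identity, in the form of a difference: a full period of
    -- thresholds contains exactly one separating X from X + 1.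
    ∑fl-suc : ∀ X → ∑ℤ n (λ a → fl (ℤ.suc X ℤ.+ + a)) ≡ ℤ.suc (∑ℤ n (λ a → fl (X ℤ.+ + a)))
    ∑fl-suc X = cancel (fl (X ℤ.+ + 0)) _ (∑ℤ n (λ a → fl (X ℤ.+ + a))) (begin
      fl (X ℤ.+ + 0) ℤ.+ ∑ℤ n (λ a → fl (ℤ.suc X ℤ.+ + a))        ≡⟨ ≡.cong (λ z → fl (X ℤ.+ + 0) ℤ.+ z) (∑ℤ-cong n (λ a → ≡.cong fl (assoc X (+ a)))) ⟩
      ∑ℤ (suc n) (λ a → fl (X ℤ.+ + a))                           ≡⟨ ∑ℤ-last n (λ a → fl (X ℤ.+ + a)) ⟩
      ∑ℤ n (λ a → fl (X ℤ.+ + a)) ℤ.+ fl (X ℤ.+ + n)              ≡⟨ ≡.cong (λ z → ∑ℤ n (λ a → fl (X ℤ.+ + a)) ℤ.+ z) (fl-+n X) ⟩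
      ∑ℤ n (λ a → fl (X ℤ.+ + a)) ℤ.+ ℤ.suc (fl X)                ≡⟨ ≡.cong (λ z → ∑ℤ n (λ a → fl (X ℤ.+ + a)) ℤ.+ ℤ.suc (fl z)) (ℤ.+-identityʳ X) ⟨
      ∑ℤ n (λ a → fl (X ℤ.+ + a)) ℤ.+ ℤ.suc (fl (X ℤ.+ + 0))      ∎)
      where
        open ≡.≡-Reasoning
        assoc : ∀ X a → ℤ.suc X ℤ.+ a ≡ X ℤ.+ ℤ.suc a
        assoc = solve 2 (λ X a → con (+ 1) :+ X :+ a := X :+ (con (+ 1) :+ a)) refl
        swap : ∀ t b → b ℤ.+ ℤ.suc t ≡ t ℤ.+ ℤ.suc b
        swap = solve 2 (λ t b → b :+ (con (+ 1) :+ t) := t :+ (con (+ 1) :+ b)) refl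
        cancel : ∀ t a b → t ℤ.+ a ≡ b ℤ.+ ℤ.suc t → a ≡ ℤ.suc b
        cancel t a b eq = ℤ-+-cancelˡ t a (ℤ.suc b) (≡.trans eq (swap t b))

    ∑fl-+ : ∀ X d → ∑ℤ n (λ a → fl (X ℤ.+ + d ℤ.+ + a)) ≡ + d ℤ.+ ∑ℤ n (λ a → fl (X ℤ.+ + a))
    ∑fl-+ X zero    = ≡.trans (∑ℤ-cong n λ a → ≡.cong (λ z → fl (z ℤ.+ + a)) (ℤ.+-identityʳ X)) (≡.sym (ℤ.+-identityˡ _))
    ∑fl-+ X (suc d) = begin
      ∑ℤ n (λ a → fl (X ℤ.+ + suc d ℤ.+ + a))        ≡⟨ ∑ℤ-cong n (λ a → ≡.cong (λ z → fl (z ℤ.+ + a)) (assoc X (+ d))) ⟩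
      ∑ℤ n (λ a → fl (ℤ.suc (X ℤ.+ + d) ℤ.+ + a))    ≡⟨ ∑fl-suc (X ℤ.+ + d) ⟩
      ℤ.suc (∑ℤ n (λ a → fl (X ℤ.+ + d ℤ.+ + a)))    ≡⟨ ≡.cong ℤ.suc (∑fl-+ X d) ⟩
      ℤ.suc (+ d ℤ.+ ∑ℤ n (λ a → fl (X ℤ.+ + a)))    ≡⟨ ℤ.+-assoc (+ 1) (+ d) (∑ℤ n (λ a → fl (X ℤ.+ + a))) ⟨
      + suc d ℤ.+ ∑ℤ n (λ a → fl (X ℤ.+ + a))        ∎
      where
        open ≡.≡-Reasoning
        assoc : ∀ X d → X ℤ.+ ℤ.suc d ≡ ℤ.suc (X ℤ.+ d)
        assoc = solve 2 (λ X d → X :+ (con (+ 1) :+ d) := con (+ 1) :+ (X :+ d)) refl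

    private
      ∑∣fl-fl∣-≥ : ∀ X Y → Y ℤ.≤ X → ∑ (upTo n) (λ a → ℤ.∣ fl (X ℤ.+ + a) ℤ.- fl (Y ℤ.+ + a) ∣) ≡ ℤ.∣ X ℤ.- Y ∣
      ∑∣fl-fl∣-≥ X Y Y≤X with X ℤ.- Y in eq | 0≤j-i Y≤X
      ... | + d | _ = ℤ.+-injective (begin
          + ∑ (upTo n) (λ a → ℤ.∣ fl (X ℤ.+ + a) ℤ.- fl (Y ℤ.+ + a) ∣)            ≡⟨ ∑-∣-∣ n (λ a → fl-mono (ℤ.+-monoˡ-≤ (+ a) Y≤X)) ⟩
          ∑ℤ n (λ a → fl (X ℤ.+ + a)) ℤ.- G                                       ≡⟨ ≡.cong (ℤ._- G) (∑ℤ-cong n λ a → ≡.cong (λ z → fl (z ℤ.+ + a)) X≡Y+d) ⟩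
          ∑ℤ n (λ a → fl (Y ℤ.+ + d ℤ.+ + a)) ℤ.- G                               ≡⟨ ≡.cong (ℤ._- G) (∑fl-+ Y d) ⟩
          + d ℤ.+ G ℤ.- G                                                         ≡⟨ cancel (+ d) G ⟩
          + d                                                                     ∎)
        where
          open ≡.≡-Reasoning
          G : ℤ
          G = ∑ℤ n (λ a → fl (Y ℤ.+ + a))
          cancel : ∀ d g → d ℤ.+ g ℤ.- g ≡ d
          cancel = solve 2 (λ d g → d :+ g :- g := d) refl
          split : ∀ X Y → X ≡ Y ℤ.+ (X ℤ.- Y)
          split = solve 2 (λ X Y → X := Y :+ (X :- Y)) refl
          X≡Y+d : X ≡ Y ℤ.+ + d
          X≡Y+d = ≡.trans (split X Y) (≡.cong (λ z → Y ℤ.+ z) eq)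

    -- A single rounding distorts distances, but over a full period of thresholds each unit step
    -- between `X` and `Y` is cut by exactly one threshold. So the average rounded distance,
    -- measured in pixels, is the exact one.
    ∑∣fl-fl∣ : ∀ X Y → ∑ (upTo n) (λ a → ℤ.∣ fl (X ℤ.+ + a) ℤ.- fl (Y ℤ.+ + a) ∣) ≡ ℤ.∣ X ℤ.- Y ∣
    ∑∣fl-fl∣ X Y with ℤ.≤-total Y X
    ... | inj₁ Y≤X = ∑∣fl-fl∣-≥ X Y Y≤X
    ... | inj₂ X≤Y = ≡.trans (∑-cong (upTo n) λ a → ℤ.∣i-j∣≡∣j-i∣ (fl (X ℤ.+ + a)) (fl (Y ℤ.+ + a)))
                             (≡.trans (∑∣fl-fl∣-≥ Y X X≤Y) (ℤ.∣i-j∣≡∣j-i∣ Y X))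

    fl-two : ∀ {Z g} → (g ℤ.- + 1) ℤ.* + n ℤ.≤ Z → Z ℤ.< ℤ.suc g ℤ.* + n → fl Z ≡ g ℤ.- + 1 ⊎ fl Z ≡ g
    fl-two {Z} {g} lower upper with Z ℤ.<? g ℤ.* + n
    ... | yes Z<gn = inj₁ (fl-unique lower (≡.subst (λ q → Z ℤ.< q ℤ.* + n) (eq g) Z<gn))
      where
        eq : ∀ g → g ≡ ℤ.suc (g ℤ.- + 1)
        eq = solve 1 (λ g → g := con (+ 1) :+ (g :- con (+ 1))) refl
    ... | no  Z≮gn = inj₂ (fl-unique (ℤ.≮⇒≥ Z≮gn) upper)

    -- The cell of the threshold itself is subtracted, so that thresholds beyond the first period
    -- are allowed and still displace a point by less than one pixel.
    round : ℤ → ℤ → Vertex → Vertex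
    round φ ψ (X , Y) = fl (X ℤ.+ φ) ℤ.- fl φ , fl (Y ℤ.+ ψ) ℤ.- fl ψ

    -- The cell of `X + φ` starts no later than `X + φ`, and the cell of `φ` starts at most `n - 1`
    -- before `φ`. The bound is strict, hence the `suc`; blocks would not stay inside P otherwise.
    round-upper : ∀ φ X → ℤ.suc ((fl (X ℤ.+ φ) ℤ.- fl φ) ℤ.* + n) ℤ.≤ X ℤ.+ + n
    round-upper φ X = ℤ-≤-by₂ (fl-lower (X ℤ.+ φ)) (ℤ.i<j⇒suc[i]≤j (fl-upper φ))
      (solve 5 (λ X φ q κ m → X :+ m :- (con (+ 1) :+ (q :- κ) :* m) :=
         (X :+ φ :- q :* m) :+ ((con (+ 1) :+ κ) :* m :- (con (+ 1) :+ φ))) refl X φ (fl (X ℤ.+ φ)) (fl φ) (+ n))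

    round-lower : ∀ φ X → ℤ.suc X ℤ.≤ ℤ.suc (fl (X ℤ.+ φ) ℤ.- fl φ) ℤ.* + n
    round-lower φ X = ℤ-≤-by₂ (fl-lower φ) (ℤ.i<j⇒suc[i]≤j (fl-upper (X ℤ.+ φ)))
      (solve 5 (λ X φ q κ m → (con (+ 1) :+ (q :- κ)) :* m :- (con (+ 1) :+ X) :=
         (φ :- κ :* m) :+ ((con (+ 1) :+ q) :* m :- (con (+ 1) :+ (X :+ φ)))) refl X φ (fl (X ℤ.+ φ)) (fl φ) (+ n))

    -- Both thresholds move together along a diagonal. Each coordinate depends on its own threshold
    -- only, and that threshold runs through a full period.
    ∑-taxi-round : ∀ c d u v → ∑ (upTo n) (λ a → taxi (round (c ℤ.+ + a) (d ℤ.+ + a) u) (round (c ℤ.+ + a) (d ℤ.+ + a) v)) ≡ taxi u v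
    ∑-taxi-round c d (X , Y) (X′ , Y′) = ≡.trans
      (∑-+ (upTo n) (λ a → ℤ.∣ v c X a ℤ.- v c X′ a ∣) (λ a → ℤ.∣ v d Y a ℤ.- v d Y′ a ∣))
      (≡.cong₂ ℕ._+_ (one c X X′) (one d Y Y′))
      where
        open ≡.≡-Reasoning
        v : ℤ → ℤ → ℕ → ℤ
        v c X a = fl (X ℤ.+ (c ℤ.+ + a)) ℤ.- fl (c ℤ.+ + a)
        drop : ∀ p q r → p ℤ.- r ℤ.- (q ℤ.- r) ≡ p ℤ.- q
        drop = solve 3 (λ p q r → p :- r :- (q :- r) := p :- q) refl
        shift : ∀ X c X′ → X ℤ.+ c ℤ.- (X′ ℤ.+ c) ≡ X ℤ.- X′
        shift = solve 3 (λ X c X′ → X :+ c :- (X′ :+ c) := X :- X′) refl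
        one : ∀ c X X′ → ∑ (upTo n) (λ a → ℤ.∣ v c X a ℤ.- v c X′ a ∣) ≡ ℤ.∣ X ℤ.- X′ ∣
        one c X X′ = begin
          ∑ (upTo n) (λ a → ℤ.∣ v c X a ℤ.- v c X′ a ∣)
            ≡⟨ ∑-cong (upTo n) (λ a → ≡.cong ℤ.∣_∣ (≡.trans (drop (fl (X ℤ.+ (c ℤ.+ + a))) _ _)
                 (≡.cong₂ (λ p q → fl p ℤ.- fl q) (≡.sym (ℤ.+-assoc X c (+ a))) (≡.sym (ℤ.+-assoc X′ c (+ a)))))) ⟩
          ∑ (upTo n) (λ a → ℤ.∣ fl (X ℤ.+ c ℤ.+ + a) ℤ.- fl (X′ ℤ.+ c ℤ.+ + a) ∣)
            ≡⟨ ∑∣fl-fl∣ (X ℤ.+ c) (X′ ℤ.+ c) ⟩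
          ℤ.∣ X ℤ.+ c ℤ.- (X′ ℤ.+ c) ∣
            ≡⟨ ≡.cong ℤ.∣_∣ (shift X c X′) ⟩
          ℤ.∣ X ℤ.- X′ ∣ ∎

    ∑-travel-round : ∀ c d u us → ∑ (upTo n) (λ a → travel (round (c ℤ.+ + a) (d ℤ.+ + a) u) (map (round (c ℤ.+ + a) (d ℤ.+ + a)) us)) ≡ travel u us
    ∑-travel-round c d u []       = ≡.trans (∑-const (upTo n) 0) (ℕ.*-zeroʳ (List.length (upTo n)))
    ∑-travel-round c d u (v ∷ us) = ≡.trans
      (∑-+ (upTo n) (λ a → taxi (round (c ℤ.+ + a) (d ℤ.+ + a) u) (round (c ℤ.+ + a) (d ℤ.+ + a) v)) _)
      (≡.cong₂ ℕ._+_ (∑-taxi-round c d u v) (∑-travel-round c d v us))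

    -- A shift by `n` moves the cell by exactly one, and `fl` is monotone. Consecutive vertices of
    -- the rounded tour will thus lie in each other's blocks.
    ∣round-round∣≤1 : ∀ φ {X Y} → ℤ.∣ X ℤ.- Y ∣ ℕ.≤ n → ℤ.∣ fl (X ℤ.+ φ) ℤ.- fl φ ℤ.- (fl (Y ℤ.+ φ) ℤ.- fl φ) ∣ ℕ.≤ 1
    ∣round-round∣≤1 φ {X} {Y} ∣X-Y∣≤n = ∣i∣≤ (rise X Y (≤∣i∣ ∣X-Y∣≤n))
      (≡.subst (ℤ._≤ + 1) (flip (v X) (v Y)) (rise Y X (≤∣i∣ (≡.subst (ℕ._≤ n) (ℤ.∣i-j∣≡∣j-i∣ X Y) ∣X-Y∣≤n))))
      where
        v : ℤ → ℤ
        v Z = fl (Z ℤ.+ φ) ℤ.- fl φ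
        flip : ∀ p q → q ℤ.- p ≡ ℤ.- (p ℤ.- q)
        flip = solve 2 (λ p q → q :- p := :- (p :- q)) refl
        slack : ∀ X Y φ m → Y ℤ.+ φ ℤ.+ m ℤ.- (X ℤ.+ φ) ≡ m ℤ.- (X ℤ.- Y)
        slack = solve 4 (λ X Y φ m → Y :+ φ :+ m :- (X :+ φ) := m :- (X :- Y)) refl
        drop : ∀ p q r → + 1 ℤ.- (p ℤ.- r ℤ.- (q ℤ.- r)) ≡ ℤ.suc q ℤ.- p
        drop = solve 3 (λ p q r → con (+ 1) :- (p :- r :- (q :- r)) := con (+ 1) :+ q :- p) refl
        rise : ∀ X Y → X ℤ.- Y ℤ.≤ + n → v X ℤ.- v Y ℤ.≤ + 1
        rise X Y X-Y≤n = ℤ-≤-by₁ (≡.subst (fl (X ℤ.+ φ) ℤ.≤_) (fl-+n (Y ℤ.+ φ)) (fl-mono {X ℤ.+ φ} {Y ℤ.+ φ ℤ.+ + n} (ℤ-≤-by₁ X-Y≤n (slack X Y φ (+ n)))))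
                                 (drop (fl (X ℤ.+ φ)) (fl (Y ℤ.+ φ)) (fl φ))

  -- Counting the thresholds with a property

  module Counting (em : ExcludedMiddle 0ℓ) where

    χ : Set → ℕ
    χ P = if does (em {P}) then 1 else 0

    χ≤1 : ∀ P → χ P ℕ.≤ 1
    χ≤1 P with em {P}
    ... | yes _ = ℕ.≤-refl
    ... | no  _ = ℕ.z≤n

    χ-yes : ∀ {P} → P → χ P ≡ 1
    χ-yes {P} p with em {P}
    ... | yes _ = refl
    ... | no ¬p = contradiction p ¬p

    χ-no : ∀ {P} → ¬ P → χ P ≡ 0
    χ-no {P} ¬p with em {P}
    ... | yes p = contradiction p ¬p
    ... | no  _ = refl

    χ-mono : ∀ {P m} → (P → 1 ℕ.≤ m) → χ P ℕ.≤ m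
    χ-mono {P} bound with em {P}
    ... | yes p = bound p
    ... | no  _ = ℕ.z≤n

    count-below : ∀ m (P : ℕ → Set) l → (∀ {a} → a ℕ.< m → P a → a ℕ.< l) → ∑ (upTo m) (λ a → χ (P a)) ℕ.≤ l
    count-below zero    P l       below = ℕ.z≤n
    count-below (suc m) P zero    below = ℕ.≤-trans (ℕ.≤-reflexive (∑-upTo-suc m (λ a → χ (P a))))
      (ℕ.+-mono-≤ (ℕ.≤-reflexive (χ-no λ p0 → ℕ.n≮0 (below ℕ.z<s p0)))
                  (count-below m (P ∘ suc) zero λ a<m p → contradiction (below (ℕ.s<s a<m) p) ℕ.n≮0))
    count-below (suc m) P (suc l) below = ℕ.≤-trans (ℕ.≤-reflexive (∑-upTo-suc m (λ a → χ (P a))))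
      (ℕ.+-mono-≤ (χ≤1 (P 0)) (count-below m (P ∘ suc) l λ a<m p → ℕ.s<s⁻¹ (below (ℕ.s<s a<m) p)))

    -- Nothing is counted before the first hit, and from it on all hits lie among `suc e`
    -- consecutive numbers.
    count-close : ∀ m (P : ℕ → Set) e → (∀ {a b} → a ℕ.< m → b ℕ.< m → P a → P b → b ℕ.≤ a ℕ.+ e) →
                  ∑ (upTo m) (λ a → χ (P a)) ℕ.≤ suc e
    count-close zero    P e close = ℕ.z≤n
    count-close (suc m) P e close = ℕ.≤-trans (ℕ.≤-reflexive (∑-upTo-suc m (λ a → χ (P a)))) (split em)
      where
        split : Dec (P 0) → χ (P 0) ℕ.+ ∑ (upTo m) (λ a → χ (P (suc a))) ℕ.≤ suc e
        split (yes p0) = ℕ.+-mono-≤ (χ≤1 (P 0)) (count-below m (P ∘ suc) e λ a<m p → close ℕ.z<s (ℕ.s<s a<m) p0 p)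
        split (no ¬p0) = ℕ.+-mono-≤ (ℕ.≤-reflexive (χ-no ¬p0))
          (count-close m (P ∘ suc) e λ a<m b<m pa pb → ℕ.s≤s⁻¹ (close (ℕ.s<s a<m) (ℕ.s<s b<m) pa pb))

  -- The side of a sample relative to a probe: `up` if the probe is at or above the sample in the
  -- coordinate concerned. It is also the direction in which the threshold has to move for that
  -- sample to cover the pixel.
  data Direction : Set where
    up down : Direction

  along : Direction → ℤ → ℤ
  along up   t = t
  along down t = ℤ.- t

  ∋-intro : ∀ {a b i j} → a ≡ i ⊎ a ≡ i ℤ.+ + 1 → b ≡ j ⊎ b ≡ j ℤ.+ + 1 → (a , b) ∋ (i , j)
  ∋-intro (inj₁ refl) (inj₁ refl) = sw , refl
  ∋-intro (inj₂ refl) (inj₁ refl) = se , refl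
  ∋-intro (inj₁ refl) (inj₂ refl) = nw , refl
  ∋-intro (inj₂ refl) (inj₂ refl) = ne , refl

  -- The vertices u, us sample a closed curve on the lattice refined by the factor
  -- n, up to an error e; D are the pixels swept by the cutter along the curve. The
  -- thresholds are parametrised by (α + β , α - β) mod n, so that the two diagonal
  -- directions become those of α and β.
  module Averaging (em : ExcludedMiddle 0ℓ) (n : ℕ) .{{n≢0 : NonZero n}} (e : ℕ) (D : List Pixel) (u : Vertex) (us : List Vertex) where

    open Rounding n
    open Counting em

    Near : Direction → ℤ → Set
    Near s d = + 0 ℤ.≤ along s d × along s d ℤ.≤ + (n ℕ.+ e)

    CoversPixel : ℤ → ℤ → Pixel → Set
    CoversPixel φ ψ p = ∃[ w ] w ∈ u ∷ us × round φ ψ w ∋ p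

    -- The point of the pixel column i (when κ = fl φ) whose window of length 2n is
    -- exactly the set of X that φ rounds to i or i + 1.
    probe : ℤ → ℤ → ℤ → ℤ
    probe κ i φ = (i ℤ.+ + 1 ℤ.+ κ) ℤ.* + n ℤ.- + 1 ℤ.- φ

    -- As `φ` runs upwards through the cell `κ`, the probe runs downwards through the cell `i`.
    fl-probe : ∀ {κ φ} i → fl φ ≡ κ → fl (probe κ i φ) ≡ i
    fl-probe {φ = φ} i refl = fl-unique {probe (fl φ) i φ} {i}
      (ℤ-≤-by₁ (ℤ.i<j⇒suc[i]≤j (fl-upper φ)) (lower i (fl φ) (+ n) φ))
      (ℤ.suc[i]≤j⇒i<j (ℤ-≤-by₁ (fl-lower φ) (upper i (fl φ) (+ n) φ)))
      where
        lower : ∀ i κ m φ → (i ℤ.+ + 1 ℤ.+ κ) ℤ.* m ℤ.- + 1 ℤ.- φ ℤ.- i ℤ.* m ≡ ℤ.suc κ ℤ.* m ℤ.- ℤ.suc φ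
        lower = solve 4 (λ i κ m φ → (i :+ con (+ 1) :+ κ) :* m :- con (+ 1) :- φ :- i :* m := (con (+ 1) :+ κ) :* m :- (con (+ 1) :+ φ)) refl
        upper : ∀ i κ m φ → ℤ.suc i ℤ.* m ℤ.- ℤ.suc ((i ℤ.+ + 1 ℤ.+ κ) ℤ.* m ℤ.- + 1 ℤ.- φ) ≡ φ ℤ.- κ ℤ.* m
        upper = solve 4 (λ i κ m φ → (con (+ 1) :+ i) :* m :- (con (+ 1) :+ ((i :+ con (+ 1) :+ κ) :* m :- con (+ 1) :- φ)) := φ :- κ :* m) refl

    -- Moving the probe by more than e towards the sample X, which is at distance at
    -- most n + e, brings X into the window of the probe.
    covers-1D : ∀ {κ φ φ′ i X t} s → fl φ′ ≡ κ → Near s (probe κ i φ ℤ.- X) → φ′ ≡ φ ℤ.+ along s t →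
                + e ℤ.< t → t ℤ.< + n →
                fl (X ℤ.+ φ′) ℤ.- fl φ′ ≡ i ⊎ fl (X ℤ.+ φ′) ℤ.- fl φ′ ≡ i ℤ.+ + 1
    covers-1D {φ = φ} {φ′} {i} {X} {t} s refl near refl e<t t<n
      with fl-two {X ℤ.+ φ′} {i ℤ.+ + 1 ℤ.+ fl φ′} (lower s near) (ℤ.suc[i]≤j⇒i<j (upper s near))
      where
        κ : ℤ
        κ = fl φ′
        sucₑ≤t : ℤ.suc (+ e) ℤ.≤ t
        sucₑ≤t = ℤ.i<j⇒suc[i]≤j e<t
        lower-up : ∀ e n i κ φ X t → X ℤ.+ (φ ℤ.+ t) ℤ.- (i ℤ.+ + 1 ℤ.+ κ ℤ.- + 1) ℤ.* n ≡
          (n ℤ.+ e ℤ.- ((i ℤ.+ + 1 ℤ.+ κ) ℤ.* n ℤ.- + 1 ℤ.- φ ℤ.- X)) ℤ.+ (t ℤ.- ℤ.suc e)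
        lower-up = solve 7 (λ e n i κ φ X t → X :+ (φ :+ t) :- (i :+ con (+ 1) :+ κ :- con (+ 1)) :* n :=
          (n :+ e :- ((i :+ con (+ 1) :+ κ) :* n :- con (+ 1) :- φ :- X)) :+ (t :- (con (+ 1) :+ e))) refl
        lower-down : ∀ n i κ φ X t → X ℤ.+ (φ ℤ.+ ℤ.- t) ℤ.- (i ℤ.+ + 1 ℤ.+ κ ℤ.- + 1) ℤ.* n ≡
          (ℤ.- ((i ℤ.+ + 1 ℤ.+ κ) ℤ.* n ℤ.- + 1 ℤ.- φ ℤ.- X) ℤ.- + 0) ℤ.+ (n ℤ.- ℤ.suc t)
        lower-down = solve 6 (λ n i κ φ X t → X :+ (φ :+ :- t) :- (i :+ con (+ 1) :+ κ :- con (+ 1)) :* n :=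
          (:- ((i :+ con (+ 1) :+ κ) :* n :- con (+ 1) :- φ :- X) :- con (+ 0)) :+ (n :- (con (+ 1) :+ t))) refl
        upper-up : ∀ n i κ φ X t → ℤ.suc (i ℤ.+ + 1 ℤ.+ κ) ℤ.* n ℤ.- ℤ.suc (X ℤ.+ (φ ℤ.+ t)) ≡
          ((i ℤ.+ + 1 ℤ.+ κ) ℤ.* n ℤ.- + 1 ℤ.- φ ℤ.- X ℤ.- + 0) ℤ.+ (n ℤ.- t)
        upper-up = solve 6 (λ n i κ φ X t → (con (+ 1) :+ (i :+ con (+ 1) :+ κ)) :* n :- (con (+ 1) :+ (X :+ (φ :+ t))) :=
          ((i :+ con (+ 1) :+ κ) :* n :- con (+ 1) :- φ :- X :- con (+ 0)) :+ (n :- t)) refl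
        upper-down : ∀ e n i κ φ X t → ℤ.suc (i ℤ.+ + 1 ℤ.+ κ) ℤ.* n ℤ.- ℤ.suc (X ℤ.+ (φ ℤ.+ ℤ.- t)) ≡
          (n ℤ.+ e ℤ.- ℤ.- ((i ℤ.+ + 1 ℤ.+ κ) ℤ.* n ℤ.- + 1 ℤ.- φ ℤ.- X)) ℤ.+ (t ℤ.- e)
        upper-down = solve 7 (λ e n i κ φ X t → (con (+ 1) :+ (i :+ con (+ 1) :+ κ)) :* n :- (con (+ 1) :+ (X :+ (φ :+ :- t))) :=
          (n :+ e :- :- ((i :+ con (+ 1) :+ κ) :* n :- con (+ 1) :- φ :- X)) :+ (t :- e)) refl
        -- In either direction, one end of the window is reached because `t > e` makes up for the
        -- sampling error, and the other is not overshot because `t < n`.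
        lower : ∀ s → Near s (probe κ i φ ℤ.- X) → (i ℤ.+ + 1 ℤ.+ κ ℤ.- + 1) ℤ.* + n ℤ.≤ X ℤ.+ (φ ℤ.+ along s t)
        lower up   (_ , d≤) = ℤ-≤-by₂ d≤ sucₑ≤t (lower-up (+ e) (+ n) i κ φ X t)
        lower down (0≤d , _) = ℤ-≤-by₂ 0≤d (ℤ.i<j⇒suc[i]≤j t<n) (lower-down (+ n) i κ φ X t)
        upper : ∀ s → Near s (probe κ i φ ℤ.- X) → ℤ.suc (X ℤ.+ (φ ℤ.+ along s t)) ℤ.≤ ℤ.suc (i ℤ.+ + 1 ℤ.+ κ) ℤ.* + n
        upper up   (0≤d , _) = ℤ-≤-by₂ 0≤d (ℤ.<⇒≤ t<n) (upper-up (+ n) i κ φ X t)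
        upper down (_ , d≤) = ℤ-≤-by₂ d≤ (ℤ.<⇒≤ e<t) (upper-down (+ e) (+ n) i κ φ X t)
    ... | inj₁ eq = inj₁ (≡.trans (≡.cong (ℤ._- fl φ′) eq) (left i (fl φ′)))
      where
        left : ∀ i κ → i ℤ.+ + 1 ℤ.+ κ ℤ.- + 1 ℤ.- κ ≡ i
        left = solve 2 (λ i κ → i :+ con (+ 1) :+ κ :- con (+ 1) :- κ := i) refl
    ... | inj₂ eq = inj₂ (≡.trans (≡.cong (ℤ._- fl φ′) eq) (right i (fl φ′)))
      where
        right : ∀ i κ → i ℤ.+ + 1 ℤ.+ κ ℤ.- κ ≡ i ℤ.+ + 1
        right = solve 2 (λ i κ → i :+ con (+ 1) :+ κ :- κ := i :+ con (+ 1)) refl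

    -- The cells of the two thresholds and the two sides of the sample. Thresholds stay below `2 n`,
    -- so there are two cells per coordinate and sixteen classes.
    Class : Set
    Class = ℤ × ℤ × Direction × Direction

    classes : List Class
    classes = cartesianProduct κs (cartesianProduct κs (cartesianProduct directions directions))
      where
        κs : List ℤ
        κs = + 0 ∷ + 1 ∷ []
        directions : List Direction
        directions = up ∷ down ∷ []

    -- The summand `n` keeps `ψ` nonnegative, so that for `α` and `β` below `n` both thresholds lie
    -- in the first two cells.
    φ ψ : ℕ → ℕ → ℤ
    φ α β = + β ℤ.+ + α
    ψ α β = + n ℤ.- + β ℤ.+ + α

    -- A miss is stored together with a sample that almost reaches the probe. With the class fixed,
    -- this sample can be tried against any other miss of the same class.
    record Bad (p : Pixel) (c : Class) (α β : ℕ) : Set where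
      private
        i = proj₁ p
        j = proj₂ p
        κ = proj₁ c
        κ′ = proj₁ (proj₂ c)
        s = proj₁ (proj₂ (proj₂ c))
        s′ = proj₂ (proj₂ (proj₂ c))
      field
        fl-φ      : fl (φ α β) ≡ κ
        fl-ψ      : fl (ψ α β) ≡ κ′
        uncovered : ¬ CoversPixel (φ α β) (ψ α β) p
        sample    : Vertex
        sample∈   : sample ∈ u ∷ us
        near-x    : Near s (probe κ i (φ α β) ℤ.- proj₁ sample)
        near-y    : Near s′ (probe κ′ j (ψ α β) ℤ.- proj₂ sample)

    open Bad

    private
      Gap : ℕ → ℕ → ℤ → Set
      Gap a b t = t ≡ + b ℤ.- + a × + e ℤ.< t × t ℤ.< + n

      far : ∀ {a b} → ¬ b ℕ.≤ a ℕ.+ e → b ℕ.< n → Gap a b (+ b ℤ.- + a)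
      far {a} {b} b≰a+e b<n = refl ,
        ℤ.suc[i]≤j⇒i<j (ℤ-≤-by₁ (ℤ.+≤+ (ℕ.≰⇒> b≰a+e)) (shift (+ b) (+ a) (+ e))) ,
        ℤ.≤-<-trans (ℤ.i-j≤i (+ b) (+ a)) (ℤ.+<+ b<n)
        where
          shift : ∀ b a e → b ℤ.- a ℤ.- ℤ.suc e ≡ b ℤ.- ℤ.suc (a ℤ.+ e)
          shift = solve 3 (λ b a e → b :- a :- (con (+ 1) :+ e) := b :- (con (+ 1) :+ (a :+ e))) refl

      -- The sample stored with the first miss covers the pixel under the second pair of thresholds:
      -- in each coordinate the threshold has moved by `t` towards the side of that sample, so
      -- `covers-1D` applies twice.
      clash : ∀ {p κ κ′ s s′ α β α′ β′ t} → Bad p (κ , κ′ , s , s′) α β → Bad p (κ , κ′ , s , s′) α′ β′ →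
              φ α′ β′ ≡ φ α β ℤ.+ along s t → ψ α′ β′ ≡ ψ α β ℤ.+ along s′ t → + e ℤ.< t → t ℤ.< + n → ⊥
      clash {s = s} {s′} bad bad′ φ≡ ψ≡ e<t t<n = uncovered bad′ (sample bad , sample∈ bad ,
        ∋-intro (covers-1D s (fl-φ bad′) (near-x bad) φ≡ e<t t<n) (covers-1D s′ (fl-ψ bad′) (near-y bad) ψ≡ e<t t<n))

      φ-α : ∀ α β α′ → + β ℤ.+ α′ ≡ + β ℤ.+ α ℤ.+ (α′ ℤ.- α)
      φ-α α β α′ = solve 3 (λ α β α′ → β :+ α′ := β :+ α :+ (α′ :- α)) refl α (+ β) α′

      ψ-α : ∀ α β α′ → + n ℤ.- β ℤ.+ α′ ≡ + n ℤ.- β ℤ.+ α ℤ.+ (α′ ℤ.- α)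
      ψ-α α β α′ = solve 4 (λ n α β α′ → n :- β :+ α′ := n :- β :+ α :+ (α′ :- α)) refl (+ n) α β α′

      φ-α⁻ : ∀ α β α′ → + β ℤ.+ α ≡ + β ℤ.+ α′ ℤ.+ ℤ.- (α′ ℤ.- α)
      φ-α⁻ α β α′ = solve 3 (λ α β α′ → β :+ α := β :+ α′ :+ :- (α′ :- α)) refl α (+ β) α′

      ψ-α⁻ : ∀ α β α′ → + n ℤ.- β ℤ.+ α ≡ + n ℤ.- β ℤ.+ α′ ℤ.+ ℤ.- (α′ ℤ.- α)
      ψ-α⁻ α β α′ = solve 4 (λ n α β α′ → n :- β :+ α := n :- β :+ α′ :+ :- (α′ :- α)) refl (+ n) α β α′

      φ-β : ∀ α β β′ → β′ ℤ.+ α ≡ β ℤ.+ α ℤ.+ (β′ ℤ.- β)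
      φ-β = solve 3 (λ α β β′ → β′ :+ α := β :+ α :+ (β′ :- β)) refl

      ψ-β : ∀ α β β′ → + n ℤ.- β′ ℤ.+ α ≡ + n ℤ.- β ℤ.+ α ℤ.+ ℤ.- (β′ ℤ.- β)
      ψ-β α β β′ = solve 4 (λ n α β β′ → n :- β′ :+ α := n :- β :+ α :+ :- (β′ :- β)) refl (+ n) α β β′

      φ-β⁻ : ∀ α β β′ → β ℤ.+ α ≡ β′ ℤ.+ α ℤ.+ ℤ.- (β′ ℤ.- β)
      φ-β⁻ = solve 3 (λ α β β′ → β :+ α := β′ :+ α :+ :- (β′ :- β)) refl

      ψ-β⁻ : ∀ α β β′ → + n ℤ.- β ℤ.+ α ≡ + n ℤ.- β′ ℤ.+ α ℤ.+ (β′ ℤ.- β)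
      ψ-β⁻ α β β′ = solve 4 (λ n α β β′ → n :- β :+ α := n :- β′ :+ α :+ (β′ :- β)) refl (+ n) α β β′

      not-far : ∀ {a b} → b ℕ.< n → (+ e ℤ.< + b ℤ.- + a → + b ℤ.- + a ℤ.< + n → ⊥) → b ℕ.≤ a ℕ.+ e
      not-far {a} {b} b<n absurd with b ℕ.≤? a ℕ.+ e
      ... | yes b≤a+e = b≤a+e
      ... | no  b≰a+e = let _ , e<t , t<n = far b≰a+e b<n in ⊥-elim (absurd e<t t<n)

      ∑∑-bound : (f : ℕ → ℕ → ℕ) → (∀ a → ∑ (upTo n) (f a) ℕ.≤ suc e) →
                 ∑ (upTo n) (λ a → ∑ (upTo n) (f a)) ℕ.≤ n ℕ.* suc e
      ∑∑-bound f bound = ℕ.≤-trans (∑-mono (upTo n) (λ {a} _ → bound a))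
        (ℕ.≤-reflexive (≡.trans (∑-const (upTo n) (suc e)) (≡.cong (ℕ._* suc e) (List.length-upTo n))))

    -- Equal sides ask both thresholds to move the same way, which is a change of `α`; opposite
    -- sides ask for a change of `β`. If the first side is `down`, the move goes from the larger
    -- parameter to the smaller one, so the two misses exchange roles.
    bad-bound : ∀ p c → ∑ (upTo n) (λ α → ∑ (upTo n) (λ β → χ (Bad p c α β))) ℕ.≤ n ℕ.* suc e
    bad-bound p c@(_ , _ , up , up) =
      ℕ.≤-trans (ℕ.≤-reflexive (∑-swap (upTo n) (upTo n) (λ α β → χ (Bad p c α β))))
        (∑∑-bound _ λ β → count-close n (λ α → Bad p c α β) e λ {α} {α′} _ α′<n bad bad′ →
          not-far α′<n (clash bad bad′ (φ-α (+ α) β (+ α′)) (ψ-α (+ α) (+ β) (+ α′))))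
    bad-bound p c@(_ , _ , down , down) =
      ℕ.≤-trans (ℕ.≤-reflexive (∑-swap (upTo n) (upTo n) (λ α β → χ (Bad p c α β))))
        (∑∑-bound _ λ β → count-close n (λ α → Bad p c α β) e λ {α} {α′} _ α′<n bad bad′ →
          not-far α′<n (clash bad′ bad (φ-α⁻ (+ α) β (+ α′)) (ψ-α⁻ (+ α) (+ β) (+ α′))))
    bad-bound p c@(_ , _ , up , down) =
      ∑∑-bound _ λ α → count-close n (Bad p c α) e λ {β} {β′} _ β′<n bad bad′ →
        not-far β′<n (clash bad bad′ (φ-β (+ α) (+ β) (+ β′)) (ψ-β (+ α) (+ β) (+ β′)))
    bad-bound p c@(_ , _ , down , up) =
      ∑∑-bound _ λ α → count-close n (Bad p c α) e λ {β} {β′} _ β′<n bad bad′ →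
        not-far β′<n (clash bad′ bad (φ-β⁻ (+ α) (+ β) (+ β′)) (ψ-β⁻ (+ α) (+ β) (+ β′)))

    module _ (dense : ∀ x y → (fl x , fl y) ∈ D →
                      ∃[ w ] w ∈ u ∷ us × ℤ.∣ x ℤ.- proj₁ w ∣ ℕ.≤ n ℕ.+ e × ℤ.∣ y ℤ.- proj₂ w ∣ ℕ.≤ n ℕ.+ e)
             (fine : 80 ℕ.* List.length D ℕ.* suc e ℕ.≤ n) where

      Missed : ℕ → ℕ → Set
      Missed α β = ∃[ p ] p ∈ D × ¬ CoversPixel (φ α β) (ψ α β) p

      cases : List (Pixel × Class)
      cases = cartesianProduct D classes

      private
        fl-01 : ∀ {X} → + 0 ℤ.≤ X → X ℤ.< + n ℤ.+ + n → fl X ≡ + 0 ⊎ fl X ≡ + 1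
        fl-01 {X} 0≤X X<2n = fl-two {X} {+ 1} 0≤X (≡.subst (X ℤ.<_) (double (+ n)) X<2n)
          where
            double : ∀ m → m ℤ.+ m ≡ + 2 ℤ.* m
            double = solve 1 (λ m → m :+ m := con (+ 2) :* m) refl

        near : ∀ d → ℤ.∣ d ∣ ℕ.≤ n ℕ.+ e → ∃[ s ] Near s d
        near (+ k)      k≤ = up , ℤ.+≤+ ℕ.z≤n , ℤ.+≤+ k≤
        near -[1+ k ]   k≤ = down , ℤ.+≤+ ℕ.z≤n , ℤ.+≤+ k≤

        class∈ : ∀ {κ κ′} s s′ → κ ≡ + 0 ⊎ κ ≡ + 1 → κ′ ≡ + 0 ⊎ κ′ ≡ + 1 → (κ , κ′ , s , s′) ∈ classes
        class∈ s s′ κ∈ κ′∈ = ∈-cartesianProduct⁺ (bit κ∈) (∈-cartesianProduct⁺ (bit κ′∈) (∈-cartesianProduct⁺ (dir s) (dir s′)))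
          where
            bit : ∀ {κ} → κ ≡ + 0 ⊎ κ ≡ + 1 → κ ∈ + 0 ∷ + 1 ∷ []
            bit (inj₁ κ≡0) = here κ≡0
            bit (inj₂ κ≡1) = there (here κ≡1)
            dir : ∀ s → s ∈ up ∷ down ∷ []
            dir up   = here refl
            dir down = there (here refl)

      -- The probe lies in the missed pixel, so `dense` supplies a sample within `n + e` of it; the
      -- signs of the two differences and the cells of the thresholds determine the class.
      missed-bad : ∀ {α β} → α ℕ.< n → β ℕ.< n → Missed α β → ∃[ pc ] pc ∈ cases × Bad (proj₁ pc) (proj₂ pc) α β
      missed-bad {α} {β} α<n β<n ((i , j) , p∈D , missed) = classify
          (dense (probe (fl (φ α β)) i (φ α β)) (probe (fl (ψ α β)) j (ψ α β))
            (≡.subst (_∈ D) (≡.sym (≡.cong₂ _,_ (fl-probe {φ = φ α β} i refl) (fl-probe {φ = ψ α β} j refl))) p∈D))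
        where
          0≤φ : + 0 ℤ.≤ φ α β
          0≤φ = ℤ.+≤+ ℕ.z≤n
          φ<2n : φ α β ℤ.< + n ℤ.+ + n
          φ<2n = ℤ.+-mono-< (ℤ.+<+ β<n) (ℤ.+<+ α<n)
          0≤ψ : + 0 ℤ.≤ ψ α β
          0≤ψ = ℤ.+-mono-≤ (0≤j-i (ℤ.+≤+ (ℕ.<⇒≤ β<n))) (ℤ.+≤+ ℕ.z≤n)
          ψ<2n : ψ α β ℤ.< + n ℤ.+ + n
          ψ<2n = ℤ.+-mono-≤-< (ℤ.i-j≤i (+ n) (+ β)) (ℤ.+<+ α<n)
          classify : ∃[ w ] w ∈ u ∷ us × ℤ.∣ probe (fl (φ α β)) i (φ α β) ℤ.- proj₁ w ∣ ℕ.≤ n ℕ.+ e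
                                       × ℤ.∣ probe (fl (ψ α β)) j (ψ α β) ℤ.- proj₂ w ∣ ℕ.≤ n ℕ.+ e →
                     ∃[ pc ] pc ∈ cases × Bad (proj₁ pc) (proj₂ pc) α β
          classify (w , w∈ , ∣dx∣≤ , ∣dy∣≤) =
            let s  , near-x = near (probe (fl (φ α β)) i (φ α β) ℤ.- proj₁ w) ∣dx∣≤
                s′ , near-y = near (probe (fl (ψ α β)) j (ψ α β) ℤ.- proj₂ w) ∣dy∣≤
            in ((i , j) , (fl (φ α β) , fl (ψ α β) , s , s′)) ,
               ∈-cartesianProduct⁺ p∈D (class∈ s s′ (fl-01 {φ α β} 0≤φ φ<2n) (fl-01 {ψ α β} 0≤ψ ψ<2n)) ,
               record { fl-φ = refl ; fl-ψ = refl ; uncovered = missed ; sample = w ; sample∈ = w∈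
                      ; near-x = near-x ; near-y = near-y }

      private
        bad : ℕ → ℕ → Pixel × Class → ℕ
        bad α β pc = χ (Bad (proj₁ pc) (proj₂ pc) α β)

      missed≤bad : ∀ {α β} → α ∈ upTo n → β ∈ upTo n → χ (Missed α β) ℕ.≤ ∑ cases (bad α β)
      missed≤bad {α} {β} α∈ β∈ = χ-mono {Missed α β} λ missed →
        let pc , pc∈ , pc-bad = missed-bad (∈-upTo⁻ α∈) (∈-upTo⁻ β∈) missed
        in ℕ.≤-trans (ℕ.≤-reflexive (≡.sym (χ-yes pc-bad))) (∑-member (bad α β) pc∈)

      ∑missed≤ : ∑ (upTo n) (λ α → ∑ (upTo n) (λ β → χ (Missed α β))) ℕ.≤ List.length D ℕ.* 16 ℕ.* (n ℕ.* suc e)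
      ∑missed≤ = ℕ.≤-trans (∑-mono (upTo n) λ {α} α∈ → ∑-mono (upTo n) λ {β} β∈ → missed≤bad α∈ β∈)
        (ℕ.≤-trans (∑∑∑-≤ (upTo n) (upTo n) cases bad (n ℕ.* suc e) (λ pc → bad-bound (proj₁ pc) (proj₂ pc)))
          (ℕ.≤-reflexive (≡.cong (ℕ._* (n ℕ.* suc e)) (length-cartesianProduct D classes))))

      -- Each pixel and class accounts for at most `n * suc e` of the `n * n` thresholds. The
      -- constant 80 in `fine` is 16, the number of classes, times 5, which leaves one fifth for all
      -- misses.
      missed-bound : 5 ℕ.* ∑ (upTo n) (λ α → ∑ (upTo n) (λ β → χ (Missed α β))) ℕ.≤ n ℕ.* n
      missed-bound = ℕ.≤-trans (ℕ.*-monoʳ-≤ 5 ∑missed≤)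
        (ℕ.≤-trans (ℕ.≤-reflexive (regroup (List.length D) n (suc e))) (ℕ.*-monoʳ-≤ n fine))
        where
          regroup : ∀ l n e → 5 ℕ.* (l ℕ.* 16 ℕ.* (n ℕ.* e)) ≡ n ℕ.* (80 ℕ.* l ℕ.* e)
          regroup = ℕ-Solver.solve-∀

      Rounded : ℤ → ℤ → Set
      Rounded φ ψ = (∀ {p} → p ∈ D → CoversPixel φ ψ p) ×
                    4 ℕ.* n ℕ.* travel (round φ ψ u) (map (round φ ψ) us) ℕ.≤ 5 ℕ.* travel u us

      -- If none existed, every pair of thresholds would miss a pixel or give a walk longer than 5/4
      -- of the average, and `averaging` excludes this.
      rounding-exists : ∃[ φ ] ∃[ ψ ] Rounded φ ψ
      rounding-exists with em {∃[ φ ] ∃[ ψ ] Rounded φ ψ}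
      ... | yes found = found
      ... | no  none  = ⊥-elim (averaging n (travel u us) w (λ α β → χ (Missed α β)) (ℕ.>-nonZero⁻¹ n) ∑w missed-bound long)
        where
          w : ℕ → ℕ → ℕ
          w α β = travel (round (φ α β) (ψ α β) u) (map (round (φ α β) (ψ α β)) us)
          -- For fixed `β`, increasing `α` advances both thresholds through a full period, so each
          -- inner sum is the length of the sampled walk.
          ∑w : ∑ (upTo n) (λ α → ∑ (upTo n) (w α)) ≡ n ℕ.* travel u us
          ∑w = ≡.trans (∑-swap (upTo n) (upTo n) w)
            (≡.trans (∑-cong (upTo n) (λ β → ∑-travel-round (+ β) (+ n ℤ.- + β) u us))
              (∑-upTo-const n (travel u us)))
          covered : ∀ {α β} → ¬ Missed α β → ∀ {p} → p ∈ D → CoversPixel (φ α β) (ψ α β) p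
          covered {α} {β} ¬missed {p} p∈D with em {CoversPixel (φ α β) (ψ α β) p}
          ... | yes c = c
          ... | no ¬c = contradiction (p , p∈D , ¬c) ¬missed
          long : ∀ α β → suc (5 ℕ.* travel u us) ℕ.≤ 4 ℕ.* n ℕ.* w α β ℕ.+ suc (5 ℕ.* travel u us) ℕ.* χ (Missed α β)
          long α β = split em
            where
              split : Dec (Missed α β) → suc (5 ℕ.* travel u us) ℕ.≤ 4 ℕ.* n ℕ.* w α β ℕ.+ suc (5 ℕ.* travel u us) ℕ.* χ (Missed α β)
              split (yes missed) = ℕ.≤-trans (ℕ.≤-reflexive (≡.sym (≡.trans
                (≡.cong (suc (5 ℕ.* travel u us) ℕ.*_) (χ-yes missed)) (ℕ.*-identityʳ _)))) (ℕ.m≤n+m _ (4 ℕ.* n ℕ.* w α β))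
              split (no ¬missed) = ℕ.≤-trans (ℕ.≰⇒> λ short → none (φ α β , ψ α β , covered {α} {β} ¬missed , short)) (ℕ.m≤m+n _ _)

open LatticeRounding

-- Integers of equal parity, and unit steps between pixels

private
  quotient-gap : ∀ {i j r r′ q q′} → i ≡ + r ℤ.+ q ℤ.* + 2 → j ≡ + r′ ℤ.+ q′ ℤ.* + 2 → r ≡ r′ → q ℤ.< q′ →
                 i ℤ.+ + 2 ℤ.≤ j
  quotient-gap {r = r} {q = q} {q′} ≡.refl ≡.refl ≡.refl q<q′ = ℤ-≤-by₂ (ℤ.i<j⇒suc[i]≤j q<q′) (ℤ.i<j⇒suc[i]≤j q<q′)
    (solve 3 (λ r q q′ → r :+ q′ :* con (+ 2) :- (r :+ q :* con (+ 2) :+ con (+ 2)) :=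
                         (q′ :- (con (+ 1) :+ q)) :+ (q′ :- (con (+ 1) :+ q))) ≡.refl (+ r) q q′)
    where open +-*-Solver

parity-gap : ∀ {i j} → i ℤ.%ℕ 2 ≡ j ℤ.%ℕ 2 → i ≢ j → i ℤ.+ + 2 ℤ.≤ j ⊎ j ℤ.+ + 2 ℤ.≤ i
parity-gap {i} {j} r≡ i≢j = compare (ℤ.<-cmp (i ℤ./ℕ 2) (j ℤ./ℕ 2))
  where
    i≡ : i ≡ + (i ℤ.%ℕ 2) ℤ.+ i ℤ./ℕ 2 ℤ.* + 2
    i≡ = ℤ.a≡a%ℕn+[a/ℕn]*n i 2
    j≡ : j ≡ + (j ℤ.%ℕ 2) ℤ.+ j ℤ./ℕ 2 ℤ.* + 2
    j≡ = ℤ.a≡a%ℕn+[a/ℕn]*n j 2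
    compare : Tri (i ℤ./ℕ 2 ℤ.< j ℤ./ℕ 2) (i ℤ./ℕ 2 ≡ j ℤ./ℕ 2) (j ℤ./ℕ 2 ℤ.< i ℤ./ℕ 2) →
              i ℤ.+ + 2 ℤ.≤ j ⊎ j ℤ.+ + 2 ℤ.≤ i
    compare (tri< q<q′ _ _) = inj₁ (quotient-gap i≡ j≡ r≡ q<q′)
    compare (tri> _ _ q′<q) = inj₂ (quotient-gap j≡ i≡ (≡.sym r≡) q′<q)
    compare (tri≈ _ q≡q′ _) = contradiction
      (≡.trans i≡ (≡.trans (≡.cong₂ (λ r q → + r ℤ.+ q ℤ.* + 2) r≡ q≡q′) (≡.sym j≡))) i≢j

-- Meant for the differences of two adjacent pixels. In the first case the lower left corner of the
-- first pixel belongs to the second, in the other case conversely; either way the two corners share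
-- a pixel.
unit-step : ∀ a b → ℤ.∣ a ∣ ℕ.+ ℤ.∣ b ∣ ≡ 1 →
            ((+ 0 ℤ.≤ a × a ℤ.≤ + 1) × + 0 ℤ.≤ b × b ℤ.≤ + 1) ⊎
            ((a ℤ.≤ + 0 × ℤ.- + 1 ℤ.≤ a) × b ℤ.≤ + 0 × ℤ.- + 1 ℤ.≤ b)
unit-step (+ 0)       (+ 1)       _ = inj₁ ((ℤ.+≤+ ℕ.z≤n , ℤ.+≤+ ℕ.z≤n) , ℤ.+≤+ ℕ.z≤n , ℤ.≤-refl)
unit-step (+ 1)       (+ 0)       _ = inj₁ ((ℤ.+≤+ ℕ.z≤n , ℤ.≤-refl) , ℤ.+≤+ ℕ.z≤n , ℤ.+≤+ ℕ.z≤n)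
unit-step (+ 0)       -[1+ 0 ]    _ = inj₂ ((ℤ.≤-refl , ℤ.-≤+) , ℤ.-≤+ , ℤ.≤-refl)
unit-step -[1+ 0 ]    (+ 0)       _ = inj₂ ((ℤ.-≤+ , ℤ.≤-refl) , ℤ.≤-refl , ℤ.-≤+)
unit-step (+ 0)       (+ 0)       ()
unit-step (+ 0)       (+ suc (suc _)) ()
unit-step (+ 0)       -[1+ suc _ ]    ()
unit-step (+ 1)       (+ suc _)   ()
unit-step (+ 1)       -[1+ _ ]    ()
unit-step (+ suc (suc _)) _       ()
unit-step -[1+ 0 ]    (+ suc _)   ()
unit-step -[1+ 0 ]    -[1+ _ ]    ()
unit-step -[1+ suc _ ] _          ()

-- Closed polygons as rectifiable tours

module Polygon (ℝ : CompleteOrderedField) (em : ExcludedMiddle 0ℓ) where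
  open OrderedField ℝ em
  open MWPDV ℝ

  end : Point → List Point → Point
  end p []       = p
  end p (q ∷ qs) = end q qs

  -- The polyline p, p₁, p₂, … traverses each edge in unit time: the time t
  -- has progressed by clamp (t - k) along the k-th edge.
  coord : (Point → Carrier) → Point → List Point → Carrier → Carrier
  coord π p []       t = π p
  coord π p (q ∷ qs) t = coord π q qs (t - 1#) + (clamp t - 1#) * (π q - π p)

  -- The variation of one coordinate up to time `t`. Working with the coordinates separately yields
  -- the L₁-length as a bound and needs no square roots along the curve.
  arc : (Point → Carrier) → Point → List Point → Carrier → Carrier
  arc π p []       t = 0#
  arc π p (q ∷ qs) t = arc π q qs (t - 1#) + clamp t * ∣ π q - π p ∣

  variation : (Point → Carrier) → Point → List Point → Carrier
  variation π p []       = 0#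
  variation π p (q ∷ qs) = variation π q qs + ∣ π q - π p ∣

  duration : List Point → Carrier
  duration []       = 0#
  duration (q ∷ qs) = duration qs + 1#

  opaque
    x-1-mono : ∀ {s t} → s ≤ t → s - 1# ≤ t - 1#
    x-1-mono = +-monoˡ-≤ (- 1#)

    0≤duration : ∀ ps → 0# ≤ duration ps
    0≤duration []       = ≤-refl
    0≤duration (q ∷ qs) = 0≤+ (0≤duration qs) 0≤1

    0≤variation : ∀ π p ps → 0# ≤ variation π p ps
    0≤variation π p []       = ≤-refl
    0≤variation π p (q ∷ qs) = 0≤+ (0≤variation π q qs) (0≤∣x∣ _)

    clamp-cong : ∀ {s t} → s ≈ t → clamp s ≈ clamp t
    clamp-cong s≈t = antisym (clamp-mono (≤-reflexive s≈t)) (clamp-mono (≤-reflexive (sym s≈t)))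

    coord-cong : ∀ π p ps {s t} → s ≈ t → coord π p ps s ≈ coord π p ps t
    coord-cong π p []       s≈t = refl
    coord-cong π p (q ∷ qs) s≈t = +-cong (coord-cong π q qs (+-congʳ s≈t)) (*-congʳ (+-congʳ (clamp-cong s≈t)))

    0≤arc : ∀ π p ps t → 0# ≤ arc π p ps t
    0≤arc π p []       t = ≤-refl
    0≤arc π p (q ∷ qs) t = 0≤+ (0≤arc π q qs (t - 1#)) (*-nonneg (0≤clamp t) (0≤∣x∣ _))

    arc≤variation : ∀ π p ps t → arc π p ps t ≤ variation π p ps
    arc≤variation π p []       t = ≤-refl
    arc≤variation π p (q ∷ qs) t = +-mono-≤ (arc≤variation π q qs (t - 1#))
      (≤-by (*-nonneg (0≤b-a (clamp≤1 t)) (0≤∣x∣ _))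
        (solve 2 (λ c a → a :- c :* a := (:1 :- c) :* a) refl (clamp t) ∣ π q - π p ∣))

    coord-diff : ∀ π p ps {s t} → s ≤ t → coord π p ps t - coord π p ps s ≤ arc π p ps t - arc π p ps s
    coord-diff π p []       s≤t = ≤-reflexive (solve 1 (λ x → x :- x := :0 :- :0) refl (π p))
    coord-diff π p (q ∷ qs) {s} {t} s≤t = ≤-by₂ (coord-diff π q qs (x-1-mono s≤t))
      (*-monoˡ-≤ (0≤b-a (clamp-mono s≤t)) (x≤∣x∣ (π q - π p)))
      (solve 8 (λ c c′ a a′ k k′ d ∣d∣ →
         (a′ :+ k′ :* ∣d∣) :- (a :+ k :* ∣d∣) :- ((c′ :+ (k′ :- :1) :* d) :- (c :+ (k :- :1) :* d)) :=
         ((a′ :- a) :- (c′ :- c)) :+ ((k′ :- k) :* ∣d∣ :- (k′ :- k) :* d)) refl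
        (coord π q qs (s - 1#)) (coord π q qs (t - 1#)) (arc π q qs (s - 1#)) (arc π q qs (t - 1#))
        (clamp s) (clamp t) (π q - π p) ∣ π q - π p ∣)

    coord-diff⁻ : ∀ π p ps {s t} → s ≤ t → coord π p ps s - coord π p ps t ≤ arc π p ps t - arc π p ps s
    coord-diff⁻ π p []       s≤t = ≤-reflexive (solve 1 (λ x → x :- x := :0 :- :0) refl (π p))
    coord-diff⁻ π p (q ∷ qs) {s} {t} s≤t = ≤-by₂ (coord-diff⁻ π q qs (x-1-mono s≤t))
      (*-monoˡ-≤ (0≤b-a (clamp-mono s≤t)) (-x≤∣x∣ (π q - π p)))
      (solve 8 (λ c c′ a a′ k k′ d ∣d∣ →
         (a′ :+ k′ :* ∣d∣) :- (a :+ k :* ∣d∣) :- ((c :+ (k :- :1) :* d) :- (c′ :+ (k′ :- :1) :* d)) :=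
         ((a′ :- a) :- (c :- c′)) :+ ((k′ :- k) :* ∣d∣ :- (k′ :- k) :* :- d)) refl
        (coord π q qs (s - 1#)) (coord π q qs (t - 1#)) (arc π q qs (s - 1#)) (arc π q qs (t - 1#))
        (clamp s) (clamp t) (π q - π p) ∣ π q - π p ∣)

    arc-lipschitz : ∀ π p ps {s t} → s ≤ t → arc π p ps t - arc π p ps s ≤ variation π p ps * (t - s)
    arc-lipschitz π p []       {s} {t} s≤t = ≤-reflexive (solve 2 (λ s t → :0 :- :0 := :0 :* (t :- s)) refl s t)
    arc-lipschitz π p (q ∷ qs) {s} {t} s≤t = ≤-by₂ (arc-lipschitz π q qs (x-1-mono s≤t))
      (*-monoˡ-≤ (0≤∣x∣ (π q - π p)) (clamp-lipschitz s≤t))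
      (solve 8 (λ a a′ k k′ ∣d∣ v s t →
         (v :+ ∣d∣) :* (t :- s) :- ((a′ :+ k′ :* ∣d∣) :- (a :+ k :* ∣d∣)) :=
         (v :* ((t :- :1) :- (s :- :1)) :- (a′ :- a)) :+ (∣d∣ :* (t :- s) :- ∣d∣ :* (k′ :- k))) refl
        (arc π q qs (s - 1#)) (arc π q qs (t - 1#)) (clamp s) (clamp t) ∣ π q - π p ∣ (variation π q qs) s t)

    coord-before : ∀ π p ps {t} → t ≤ 0# → coord π p ps t ≈ π p
    coord-before π p []       t≤0 = refl
    coord-before π p (q ∷ qs) {t} t≤0 = trans
      (+-cong (coord-before π q qs (≤-by₂ t≤0 0≤1 (solve 1 (λ t → :0 :- (t :- :1) := (:0 :- t) :+ (:1 :- :0)) refl t)))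
              (*-congʳ (+-congʳ (clamp-low t≤0))))
      (solve 2 (λ p q → q :+ (:0 :- :1) :* (q :- p) := p) refl (π p) (π q))

    coord-first : ∀ π p q qs {t} → t ≤ 1# → coord π p (q ∷ qs) t ≈ π p + clamp t * (π q - π p)
    coord-first π p q qs {t} t≤1 = trans
      (+-congʳ (coord-before π q qs (≤-by₁ t≤1 (solve 1 (λ t → :0 :- (t :- :1) := :1 :- t) refl t))))
      (solve 3 (λ p q k → q :+ (k :- :1) :* (q :- p) := p :+ k :* (q :- p)) refl (π p) (π q) (clamp t))

    coord-later : ∀ π p q qs {t} → 1# ≤ t → coord π p (q ∷ qs) t ≈ coord π q qs (t - 1#)
    coord-later π p q qs {t} 1≤t = trans (+-congˡ (*-congʳ (+-congʳ (clamp-high 1≤t))))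
      (solve 2 (λ c d → c :+ (:1 :- :1) :* d := c) refl (coord π q qs (t - 1#)) (π q - π p))

    1≤t+1 : ∀ {t} → 0# ≤ t → 1# ≤ t + 1#
    1≤t+1 {t} 0≤t = ≤-by₁ 0≤t (solve 1 (λ t → t :+ :1 :- :1 := t :- :0) refl t)

    coord-suc : ∀ π p q qs {t} → 0# ≤ t → coord π p (q ∷ qs) (t + 1#) ≈ coord π q qs t
    coord-suc π p q qs {t} 0≤t = trans (coord-later π p q qs (1≤t+1 0≤t))
      (coord-cong π q qs (solve 1 (λ t → t :+ :1 :- :1 := t) refl t))

    coord-end : ∀ π p ps → coord π p ps (duration ps) ≈ π (end p ps)
    coord-end π p []       = refl
    coord-end π p (q ∷ qs) = trans (coord-suc π p q qs (0≤duration qs)) (coord-end π q qs)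

  polyline : Point → List Point → Carrier → Point
  polyline p ps t = coord proj₁ p ps t , coord proj₂ p ps t

  perimeter : Point → List Point → Carrier
  perimeter p ps = variation proj₁ p ps + variation proj₂ p ps

  opaque
    -- The square of `a + b` dominates the sum of the squares of `a` and `b`. Each coordinate is
    -- compared through the product of its two slacks, since `(a - x) (a + x) ≥ 0` is `x² ≤ a²`.
    distance≤ : ∀ {p q d a b} → IsDistance p q d → 0# ≤ a → 0# ≤ b →
                proj₁ q - proj₁ p ≤ a → proj₁ p - proj₁ q ≤ a →
                proj₂ q - proj₂ p ≤ b → proj₂ p - proj₂ q ≤ b → d ≤ a + b
    distance≤ {px , py} {qx , qy} {d} {a} {b} (_ , d²≈) 0≤a 0≤b x≤ -x≤ y≤ -y≤ = square-cancel-≤ (0≤+ 0≤a 0≤b)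
      (≤-trans (≤-reflexive d²≈) (≤-by
        (0≤+ (0≤+ (*-nonneg (0≤b-a x≤) (0≤b-a -x≤)) (*-nonneg (0≤b-a y≤) (0≤b-a -y≤)))
             (0≤+ (*-nonneg 0≤a 0≤b) (*-nonneg 0≤a 0≤b)))
        (solve 6 (λ px py qx qy a b →
           (a :+ b) :* (a :+ b) :- ((qx :- px) :* (qx :- px) :+ (qy :- py) :* (qy :- py)) :=
           (a :- (qx :- px)) :* (a :- (px :- qx)) :+ (b :- (qy :- py)) :* (b :- (py :- qy)) :+ (a :* b :+ a :* b))
          refl px py qx qy a b)))

    arcs≤perimeter : ∀ p ps t → arc proj₁ p ps t + arc proj₂ p ps t ≤ perimeter p ps
    arcs≤perimeter p ps t = +-mono-≤ (arc≤variation proj₁ p ps t) (arc≤variation proj₂ p ps t)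

    -- Each chord is at most the growth of the two arcs between its times; by induction, what is
    -- inscribed after `t` is bounded by the variation still to come.
    inscribed≤ : ∀ p ps {ts t ℓ} → Linked _≤_ (t ∷ ts) → PolylineLength (map (polyline p ps) (t ∷ ts)) ℓ →
                 ℓ ≤ perimeter p ps - (arc proj₁ p ps t + arc proj₂ p ps t)
    inscribed≤ p ps {[]} {t} _ (single ℓ≈0) = ≤-trans (≤-reflexive ℓ≈0) (0≤b-a (arcs≤perimeter p ps t))
    inscribed≤ p ps {t′ ∷ ts} {t} (t≤t′ ∷ linked) (step {d = d} {ℓ = ℓ} dist rest m≈) =
      ≤-trans (≤-reflexive m≈) (≤-by₂
        (distance≤ dist (0≤b-a≤ proj₁) (0≤b-a≤ proj₂)
          (coord-diff proj₁ p ps t≤t′) (coord-diff⁻ proj₁ p ps t≤t′) (coord-diff proj₂ p ps t≤t′) (coord-diff⁻ proj₂ p ps t≤t′))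
        (inscribed≤ p ps linked rest)
        (solve 7 (λ v a b a′ b′ d ℓ → v :- (a :+ b) :- (d :+ ℓ) := ((a′ :- a) :+ (b′ :- b) :- d) :+ (v :- (a′ :+ b′) :- ℓ)) refl
          (perimeter p ps) (arc proj₁ p ps t) (arc proj₂ p ps t) (arc proj₁ p ps t′) (arc proj₂ p ps t′) d ℓ))
      where
        0≤b-a≤ : ∀ π → 0# ≤ arc π p ps t′ - arc π p ps t
        0≤b-a≤ π with total 0# (arc π p ps t′ - arc π p ps t)
        ... | inj₁ 0≤ = 0≤
        ... | inj₂ ≤0 = ≤-by₃ (coord-diff π p ps t≤t′) (coord-diff⁻ π p ps t≤t′) (0≤b-a ≤0)
          (solve 4 (λ a a′ c c′ → a′ :- a :- :0 := ((a′ :- a) :- (c′ :- c)) :+ ((a′ :- a) :- (c :- c′)) :+ ((:0 :- (a′ :- a)) :- :0)) refl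
            (arc π p ps t) (arc π p ps t′) (coord π p ps t) (coord π p ps t′))

    inscribed≤perimeter : ∀ p ps a b ℓ → InscribedLength a b (polyline p ps) ℓ → ℓ ≤ perimeter p ps
    inscribed≤perimeter p ps a b ℓ ([] , _ , _ , empty ℓ≈0) =
      ≤-trans (≤-reflexive ℓ≈0) (0≤+ (0≤variation proj₁ p ps) (0≤variation proj₂ p ps))
    inscribed≤perimeter p ps a b ℓ (t ∷ ts , linked , _ , lengths) = ≤-trans (inscribed≤ p ps linked lengths)
      (≤-by (0≤+ (0≤arc proj₁ p ps t) (0≤arc proj₂ p ps t))
        (solve 2 (λ v a → v :- (v :- a) := a) refl (perimeter p ps) (arc proj₁ p ps t + arc proj₂ p ps t)))

    polyline-continuous : ∀ p ps a b → ContinuousOn a b (polyline p ps)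
    -- The perimeter is a Lipschitz constant for both coordinates; the added 1 keeps it positive
    -- when the polygon is a single point.
    polyline-continuous p ps a b s _ ε 0<ε with recip {perimeter p ps + 1#} 0<V
      where
        0<V : 0# < perimeter p ps + 1#
        0<V = ≰⇒> λ V≤0 → 1≰0 (≤-by₂ V≤0 (0≤+ (0≤variation proj₁ p ps) (0≤variation proj₂ p ps))
          (solve 1 (λ v → :0 :- :1 := (:0 :- (v :+ :1)) :+ (v :- :0)) refl (perimeter p ps)))
    ... | r , 0<r , Vr≈1 = ε * r , 0<* 0<ε 0<r , λ t _ t-s≤ s-t≤ →
        close proj₁ (≤-by (0≤+ (0≤variation proj₂ p ps) 0≤1) (solve 2 (λ x y → x :+ y :+ :1 :- x := y :+ :1) refl _ _)) t t-s≤ s-t≤ ,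
        close proj₂ (≤-by (0≤+ (0≤variation proj₁ p ps) 0≤1) (solve 2 (λ x y → x :+ y :+ :1 :- y := x :+ :1) refl _ _)) t t-s≤ s-t≤
      where
        V : Carrier
        V = perimeter p ps + 1#
        bound : ∀ π {s t} → variation π p ps ≤ V → s ≤ t → t - s ≤ ε * r → arc π p ps t - arc π p ps s ≤ ε
        bound π {s} {t} v≤V s≤t t-s≤ = ≤-trans (arc-lipschitz π p ps s≤t)
          (≤-trans (*-mono-≤ (0≤variation π p ps) (proj₁ (0<* 0<ε 0<r)) v≤V t-s≤)
            (≤-reflexive (trans (solve 3 (λ v e r → v :* (e :* r) := v :* r :* e) refl V ε r)
                                (trans (*-congʳ Vr≈1) (*-identityˡ ε)))))
        close : ∀ π → variation π p ps ≤ V → ∀ t → t - s ≤ ε * r → s - t ≤ ε * r →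
                coord π p ps t - coord π p ps s ≤ ε × coord π p ps s - coord π p ps t ≤ ε
        close π v≤V t t-s≤ s-t≤ with total s t
        ... | inj₁ s≤t = ≤-trans (coord-diff π p ps s≤t) (bound π v≤V s≤t t-s≤) , ≤-trans (coord-diff⁻ π p ps s≤t) (bound π v≤V s≤t t-s≤)
        ... | inj₂ t≤s = ≤-trans (coord-diff⁻ π p ps t≤s) (bound π v≤V t≤s s-t≤) , ≤-trans (coord-diff π p ps t≤s) (bound π v≤V t≤s s-t≤)

  polygon-length : ∀ p ps → ∃ (IsSupremum (InscribedLength 0# (duration ps) (polyline p ps)))
  polygon-length p ps = complete _ (0# , [] , [] , [] , empty refl) (perimeter p ps , inscribed≤perimeter p ps 0# (duration ps))

  polygon : ∀ p ps → end p ps ≡ p → ClosedTour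
  polygon p ps end≡p = record
    { start = 0#
    ; finish = duration ps
    ; start≤finish = 0≤duration ps
    ; path = polyline p ps
    ; continuous = polyline-continuous p ps 0# (duration ps)
    ; closed = closed proj₁ , closed proj₂
    ; length = proj₁ (polygon-length p ps)
    ; isLength = proj₂ (polygon-length p ps)
    }
    where
      closed : ∀ π → coord π p ps 0# ≈ coord π p ps (duration ps)
      closed π = trans (coord-before π p ps ≤-refl)
                       (sym (trans (coord-end π p ps) (reflexive (≡.cong π end≡p))))

  polygon-length≤ : ∀ p ps end≡p → length (polygon p ps end≡p) ≤ perimeter p ps
  polygon-length≤ p ps end≡p = proj₂ (proj₂ (polygon-length p ps)) (perimeter p ps) (inscribed≤perimeter p ps 0# (duration ps))

  opaque
    vertex-time : ∀ p ps {q} → q ∈ p ∷ ps → ∃[ t ] InInterval 0# (duration ps) t × (∀ π → π q ≈ coord π p ps t)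
    vertex-time p ps (here ≡.refl) = 0# , (≤-refl , 0≤duration ps) , λ π → sym (coord-before π p ps ≤-refl)
    vertex-time p (q ∷ qs) (there q′∈) with vertex-time q qs q′∈
    ... | t , (0≤t , t≤) , at = t + 1# , (0≤+ 0≤t 0≤1 , +-monoˡ-≤ 1# t≤) , λ π → trans (at π) (sym (coord-suc π p q qs 0≤t))

  vertex-on-polygon : ∀ p ps end≡p {q} → q ∈ p ∷ ps → OnTour (polygon p ps end≡p) q
  vertex-on-polygon p ps end≡p q∈ =
    let t , t∈ , at = vertex-time p ps q∈ in t , t∈ , at proj₁ , at proj₂

  module InPolyomino (P : Polyomino) where

    between : Point → Point → Carrier → Point
    between (px , py) (qx , qy) u = px + u * (qx - px) , py + u * (qy - py)

    Segment⊆ : Point → Point → Set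
    Segment⊆ p q = ∀ u → 0# ≤ u → u ≤ 1# → InRegion P (between p q u)

    Polyline⊆ : Point → List Point → Set
    Polyline⊆ p []       = InRegion P p
    Polyline⊆ p (q ∷ qs) = Segment⊆ p q × Polyline⊆ q qs

    opaque
      inRegion-resp : ∀ {x y x′ y′} → x ≈ x′ → y ≈ y′ → InRegion P (x , y) → InRegion P (x′ , y′)
      inRegion-resp x≈ y≈ = Any.map λ ((a , b) , (c , d)) →
        (≤-trans a (≤-reflexive x≈) , ≤-trans (≤-reflexive (sym x≈)) b) ,
        (≤-trans c (≤-reflexive y≈) , ≤-trans (≤-reflexive (sym y≈)) d)

      path⊆ : ∀ p ps → Polyline⊆ p ps → ∀ t → InRegion P (polyline p ps t)
      path⊆ p []       p∈ t = p∈
      path⊆ p (q ∷ qs) (pq⊆ , qs⊆) t with total t 1#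
      ... | inj₁ t≤1 = inRegion-resp (sym (coord-first proj₁ p q qs t≤1)) (sym (coord-first proj₂ p q qs t≤1))
                         (pq⊆ (clamp t) (0≤clamp t) (clamp≤1 t))
      ... | inj₂ 1≤t = inRegion-resp (sym (coord-later proj₁ p q qs 1≤t)) (sym (coord-later proj₂ p q qs 1≤t))
                         (path⊆ q qs qs⊆ (t - 1#))

    polygon⊆ : ∀ p ps end≡p → Polyline⊆ p ps → ∀ q → OnTour (polygon p ps end≡p) q → InRegion P q
    polygon⊆ p ps end≡p ps⊆ q (t , _ , x≈ , y≈) = inRegion-resp (sym x≈) (sym y≈) (path⊆ p ps ps⊆ t)

-- Cutters, blocks and lines of sight in a polyomino

module Visibility (ℝ : CompleteOrderedField) (em : ExcludedMiddle 0ℓ) (P : Polyomino) where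
  open OrderedField ℝ em
  open MWPDV ℝ
  open Polygon ℝ em
  open InPolyomino P
  open Polyomino P

  point : Vertex → Point
  point (a , b) = fromℤ a , fromℤ b

  opaque
    convex-≥ : ∀ {a x y u} → a ≤ x → a ≤ y → 0# ≤ u → u ≤ 1# → a ≤ x + u * (y - x)
    convex-≥ {a} {x} {y} {u} a≤x a≤y 0≤u u≤1 =
      ≤-by (0≤+ (*-nonneg (0≤b-a u≤1) (0≤b-a a≤x)) (*-nonneg 0≤u (0≤b-a a≤y)))
        (solve 4 (λ a x y u → x :+ u :* (y :- x) :- a := (:1 :- u) :* (x :- a) :+ u :* (y :- a)) refl a x y u)

    convex-≤ : ∀ {b x y u} → x ≤ b → y ≤ b → 0# ≤ u → u ≤ 1# → x + u * (y - x) ≤ b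
    convex-≤ {b} {x} {y} {u} x≤b y≤b 0≤u u≤1 =
      ≤-by (0≤+ (*-nonneg (0≤b-a u≤1) (0≤b-a x≤b)) (*-nonneg 0≤u (0≤b-a y≤b)))
        (solve 4 (λ b x y u → b :- (x :+ u :* (y :- x)) := (:1 :- u) :* (b :- x) :+ u :* (b :- y)) refl b x y u)

    pixel-convex : ∀ {Q p q} → Q ∈ pixels → InPixel p Q → InPixel q Q → Segment⊆ p q
    pixel-convex Q∈ ((a , b) , (c , d)) ((a′ , b′) , (c′ , d′)) u 0≤u u≤1 = lose Q∈
      ((convex-≥ a a′ 0≤u u≤1 , convex-≤ b b′ 0≤u u≤1) , (convex-≥ c c′ 0≤u u≤1 , convex-≤ d d′ 0≤u u≤1))

    x-y≤z⇒x≤y+z : ∀ {x y z} → x - y ≤ z → x ≤ y + z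
    x-y≤z⇒x≤y+z {x} {y} {z} p = ≤-by₁ p (solve 3 (λ x y z → y :+ z :- x := z :- (x :- y)) refl x y z)

    x≤y+z⇒x-y≤z : ∀ {x y z} → x ≤ y + z → x - y ≤ z
    x≤y+z⇒x-y≤z {x} {y} {z} p = ≤-by₁ p (solve 3 (λ x y z → z :- (x :- y) := y :+ z :- x) refl x y z)

    y-x≤z⇒y-z≤x : ∀ {x y z} → y - x ≤ z → y - z ≤ x
    y-x≤z⇒y-z≤x {x} {y} {z} p = ≤-by₁ p (solve 3 (λ x y z → x :- (y :- z) := z :- (y :- x)) refl x y z)

    y-z≤x⇒y-x≤z : ∀ {x y z} → y - z ≤ x → y - x ≤ z
    y-z≤x⇒y-x≤z {x} {y} {z} p = ≤-by₁ p (solve 3 (λ x y z → z :- (y :- x) := x :- (y :- z)) refl x y z)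

    within-refl : ∀ {r} → 0# ≤ r → ∀ p → Within r p p
    within-refl {r} 0≤r (x , y) = (self x , self x) , (self y , self y)
      where
        self : ∀ x → x - x ≤ r
        self x = ≤-trans (≤-reflexive (-‿inverseʳ x)) 0≤r

    within-resp : ∀ {r p x y x′ y′} → x ≈ x′ → y ≈ y′ → Within r p (x , y) → Within r p (x′ , y′)
    within-resp x≈ y≈ ((a , b) , (c , d)) =
      (≤-trans (≤-reflexive (+-congʳ (sym x≈))) a , ≤-trans (≤-reflexive (+-congˡ (-‿cong (sym x≈)))) b) ,
      (≤-trans (≤-reflexive (+-congʳ (sym y≈))) c , ≤-trans (≤-reflexive (+-congˡ (-‿cong (sym y≈)))) d)

    within-convex : ∀ {r p q q′ u} → Within r p q → Within r p q′ → 0# ≤ u → u ≤ 1# → Within r p (between q q′ u)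
    within-convex ((a , b) , (c , d)) ((a′ , b′) , (c′ , d′)) 0≤u u≤1 =
      (x≤y+z⇒x-y≤z (convex-≤ (x-y≤z⇒x≤y+z a) (x-y≤z⇒x≤y+z a′) 0≤u u≤1) ,
       y-z≤x⇒y-x≤z (convex-≥ (y-x≤z⇒y-z≤x b) (y-x≤z⇒y-z≤x b′) 0≤u u≤1)) ,
      (x≤y+z⇒x-y≤z (convex-≤ (x-y≤z⇒x≤y+z c) (x-y≤z⇒x≤y+z c′) 0≤u u≤1) ,
       y-z≤x⇒y-x≤z (convex-≥ (y-x≤z⇒y-z≤x d) (y-x≤z⇒y-z≤x d′) 0≤u u≤1))

    -- The square of the cutter is convex and contains its centre, so a line of sight from the
    -- centre never leaves it.
    cutter-sees : ∀ {p q} → (∀ x → Within 1# p x → InRegion P x) → Within 1# p q → Sees P p q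
    cutter-sees {p} {q} cutter⊆ pq = (λ x (t , (0≤t , t≤1) , x≈ , y≈) →
      cutter⊆ x (within-resp (sym x≈) (sym y≈) (within-convex pq (within-refl 0≤1 p) 0≤t t≤1))) , pq

    cutter-segment : ∀ {p q} → (∀ x → Within 1# p x → InRegion P x) → Within 1# p q → Segment⊆ p q
    cutter-segment {p} cutter⊆ pq u 0≤u u≤1 = cutter⊆ _ (within-convex (within-refl 0≤1 p) pq 0≤u u≤1)

  Milled : Vertex → Set
  Milled v = ∀ c → blockPixel v c ∈ pixels

  opaque
    block⊆ : ∀ {v} → Milled v → ∀ q → Within 1# (point v) q → InRegion P q
    block⊆ {a , b} milled (x , y) ((x-a≤1 , a-x≤1) , (y-b≤1 , b-y≤1)) with column {a} x-a≤1 a-x≤1 | column {b} y-b≤1 b-y≤1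
      where
        column : ∀ {a x} → x - fromℤ a ≤ 1# → fromℤ a - x ≤ 1# →
                 (fromℤ (a ℤ.- + 1) ≤ x × x ≤ fromℤ (a ℤ.- + 1) + 1#) ⊎ (fromℤ a ≤ x × x ≤ fromℤ a + 1#)
        column {a} {x} x-a≤1 a-x≤1 with total x (fromℤ a)
        ... | inj₁ x≤a = inj₁ (≤-trans (≤-reflexive a-1≈) (y-x≤z⇒y-z≤x a-x≤1) , ≤-trans x≤a (≤-reflexive (sym (trans (+-congʳ a-1≈)
                (solve 1 (λ a → a :- :1 :+ :1 := a) refl (fromℤ a))))))
          where
            a-1≈ : fromℤ (a ℤ.- + 1) ≈ fromℤ a - 1#
            a-1≈ = trans (fromℤ-- a (+ 1)) (+-congˡ (-‿cong fromℤ-1))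
        ... | inj₂ a≤x = inj₂ (a≤x , x-y≤z⇒x≤y+z x-a≤1)
    ... | inj₁ X | inj₁ Y = lose (milled ne) (X , Y)
    ... | inj₁ X | inj₂ Y = lose (milled se) (X , Y)
    ... | inj₂ X | inj₁ Y = lose (milled nw) (X , Y)
    ... | inj₂ X | inj₂ Y = lose (milled sw) (X , Y)

    ∋-within : ∀ {v p q} → v ∋ p → InPixel q p → Within 1# (point v) q
    ∋-within {p = i , j} {x , y} (c , ≡.refl) ((i≤x , x≤i+1) , (j≤y , y≤j+1)) = go c
      where
        near : ∀ {i x} → fromℤ i ≤ x → x ≤ fromℤ i + 1# → x - fromℤ i ≤ 1# × fromℤ i - x ≤ 1#
        near {i} {x} i≤x x≤i+1 = x≤y+z⇒x-y≤z x≤i+1 ,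
          ≤-by₂ i≤x 0≤1 (solve 2 (λ i x → :1 :- (i :- x) := (x :- i) :+ (:1 :- :0)) refl (fromℤ i) x)
        near⁺ : ∀ {i x} → fromℤ i ≤ x → x ≤ fromℤ i + 1# → x - fromℤ (i ℤ.+ + 1) ≤ 1# × fromℤ (i ℤ.+ + 1) - x ≤ 1#
        near⁺ {i} {x} i≤x x≤i+1 =
          ≤-trans (≤-reflexive (+-congˡ (-‿cong (fromℤ-+1 i))))
            (≤-by₂ x≤i+1 0≤1 (solve 2 (λ i x → :1 :- (x :- (i :+ :1)) := (i :+ :1 :- x) :+ (:1 :- :0)) refl (fromℤ i) x)) ,
          ≤-trans (≤-reflexive (+-congʳ (fromℤ-+1 i)))
            (≤-by₁ i≤x (solve 2 (λ i x → :1 :- (i :+ :1 :- x) := x :- i) refl (fromℤ i) x))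
        go : ∀ c → Within 1# (point (corner (i , j) c)) (x , y)
        go sw = near {i} i≤x x≤i+1 , near {j} j≤y y≤j+1
        go se = near⁺ {i} i≤x x≤i+1 , near {j} j≤y y≤j+1
        go nw = near {i} i≤x x≤i+1 , near⁺ {j} j≤y y≤j+1
        go ne = near⁺ {i} i≤x x≤i+1 , near⁺ {j} j≤y y≤j+1

    milled-covers : ∀ {S} → All Milled S → CoveredBy pixels S → Covers P (map point S)
    milled-covers {S} all-milled covered =
      All.map⁺ (All.map (λ {v} m → block⊆ m (point v) (within-refl 0≤1 (point v))) all-milled) ,
      λ q q∈P → let Q , Q∈ , q∈Q = find q∈P
                    v , v∈S , v∋Q = covered Q∈
                in Any.map⁺ (lose v∈S (cutter-sees (block⊆ (All.lookup all-milled v∈S)) (∋-within v∋Q q∈Q)))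

  opaque
    -- The last two inequalities say that δ = x / 2 is within distance 1 of x - 1.
    halfway : ∀ {x} → 0# < x → ¬ 1# + 1# ≤ x → ∃[ δ ] 0# < δ × ¬ 1# ≤ δ × 1# - x + δ ≤ 1# × x - 1# - δ ≤ 1#
    halfway {x} 0<x 2≰x with halve 0<x
    ... | δ , 0<δ , 2δ≈x = δ , 0<δ ,
      (λ 1≤δ → 2≰x (≤-by₂ 1≤δ 1≤δ
        (trans (+-congʳ (sym 2δ≈x)) (solve 1 (λ d → d :+ d :- (:1 :+ :1) := (d :- :1) :+ (d :- :1)) refl δ)))) ,
      ≤-by (proj₁ 0<δ) (trans (+-congˡ (-‿cong (+-congʳ (+-congˡ (-‿cong (sym 2δ≈x))))))
        (solve 1 (λ d → :1 :- (:1 :- (d :+ d) :+ d) := d) refl δ)) ,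
      ≤-by₂ (≰⇒≥ 2≰x) (proj₁ 0<δ) (solve 2 (λ x d → :1 :- (x :- :1 :- d) := (:1 :+ :1 :- x) :+ (d :- :0)) refl x δ)

  Interior : Carrier → ℤ → Set
  Interior z i = ¬ z ≤ fromℤ i × ¬ fromℤ i + 1# ≤ z

  Close : Carrier → ℤ → Set
  Close c a = ¬ fromℤ a + 1# ≤ c × ¬ c + 1# ≤ fromℤ a

  MeetsCutter : Carrier → ℤ → Set
  MeetsCutter c i = ∃[ z ] Interior z i × z - c ≤ 1# × c - z ≤ 1#

  opaque
    -- A point in the interior of a pixel lies in no other closed pixel.
    pixel-of-interior : ∀ {z w i j} → Interior z i → Interior w j → InRegion P (z , w) → (i , j) ∈ pixels
    pixel-of-interior {z} {w} {i} {j} z∈ w∈ zw∈P with find zw∈P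
    ... | (i′ , j′) , Q∈ , (i′≤z , z≤) , (j′≤w , w≤) = ≡.subst (_∈ pixels) (≡.cong₂ _,_ (same z∈ i′≤z z≤) (same w∈ j′≤w w≤)) Q∈
      where
        same : ∀ {z i i′} → Interior z i → fromℤ i′ ≤ z → z ≤ fromℤ i′ + 1# → i′ ≡ i
        same {z} {i} {i′} (z≰i , i+1≰z) i′≤z z≤i′+1 = ℤ.≤-antisym
          (bound λ i+1≤i′ → i+1≰z (≤-trans i+1≤i′ i′≤z))
          (bound λ i′+1≤i → z≰i (≤-trans z≤i′+1 i′+1≤i))
          where
            bound : ∀ {i j} → ¬ fromℤ j + 1# ≤ fromℤ i → i ℤ.≤ j
            bound {i} {j} ¬p = ℤ.≮⇒≥ λ j<i → ¬p (≤-trans (≤-reflexive (trans (+-comm _ _) (sym (trans (fromℤ-+ (+ 1) j) (+-congʳ fromℤ-1)))))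
                                                        (fromℤ-mono-≤ (ℤ.i<j⇒suc[i]≤j j<i)))

    -- The cutter reaches beyond `a` by `x = c + 1 - a`, where `0 < x < 2`. The point `a + x / 2` is
    -- then inside the column and within reach.
    interior-right : ∀ {c a} → Close c a → MeetsCutter c a
    interior-right {c} {a} (a+1≰c , c+1≰a) with halfway {c + 1# - fromℤ a}
        (≰⇒> λ x≤0 → c+1≰a (≤-by₁ x≤0 (solve 2 (λ c a → a :- (c :+ :1) := :0 :- (c :+ :1 :- a)) refl c (fromℤ a))))
        (λ 2≤x → a+1≰c (≤-by₁ 2≤x (solve 2 (λ c a → c :- (a :+ :1) := c :+ :1 :- a :- (:1 :+ :1)) refl c (fromℤ a))))
    ... | δ , 0<δ , 1≰δ , low , high = fromℤ a + δ ,
      (0<⇒x+e≰x 0<δ , λ p → 1≰δ (≤-by₁ p (solve 2 (λ a d → d :- :1 := a :+ d :- (a :+ :1)) refl (fromℤ a) δ))) ,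
      ≤-trans (≤-reflexive (solve 3 (λ a d c → a :+ d :- c := :1 :- (c :+ :1 :- a) :+ d) refl (fromℤ a) δ c)) low ,
      ≤-trans (≤-reflexive (solve 3 (λ a d c → c :- (a :+ d) := c :+ :1 :- a :- :1 :- d) refl (fromℤ a) δ c)) high

    interior-left : ∀ {c a} → Close c a → MeetsCutter c (a ℤ.- + 1)
    interior-left {c} {a} (a+1≰c , c+1≰a) with halfway {fromℤ a + 1# - c}
        (≰⇒> λ x≤0 → a+1≰c (≤-by₁ x≤0 (solve 2 (λ c a → c :- (a :+ :1) := :0 :- (a :+ :1 :- c)) refl c (fromℤ a))))
        (λ 2≤x → c+1≰a (≤-by₁ 2≤x (solve 2 (λ c a → a :- (c :+ :1) := a :+ :1 :- c :- (:1 :+ :1)) refl c (fromℤ a))))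
    ... | δ , 0<δ , 1≰δ , low , high = fromℤ a - δ ,
      ((λ p → 1≰δ (≤-by₁ (≤-trans p (≤-reflexive a-1≈)) (solve 2 (λ a d → d :- :1 := a :- :1 :- (a :- d)) refl (fromℤ a) δ))) ,
       (λ p → 0<⇒x≰x-e 0<δ (≤-trans (≤-reflexive (sym (trans (+-congʳ a-1≈) (solve 1 (λ a → a :- :1 :+ :1 := a) refl (fromℤ a))))) p))) ,
      ≤-trans (≤-reflexive (solve 3 (λ a d c → a :- d :- c := a :+ :1 :- c :- :1 :- d) refl (fromℤ a) δ c)) high ,
      ≤-trans (≤-reflexive (solve 3 (λ a d c → c :- (a :- d) := :1 :- (a :+ :1 :- c) :+ d) refl (fromℤ a) δ c)) low
      where
        a-1≈ : fromℤ (a ℤ.- + 1) ≈ fromℤ a - 1#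
        a-1≈ = trans (fromℤ-- a (+ 1)) (+-congˡ (-‿cong fromℤ-1))

    -- A cutter whose centre is less than 1 away overlaps the two columns and the two rows around
    -- `v`, and therefore the interiors of all four pixels of the block.
    close-milled : ∀ {x y} v → (∀ q → Within 1# (x , y) q → InRegion P q) →
                   Close x (proj₁ v) → Close y (proj₂ v) → Milled v
    close-milled {x} {y} (a , b) cutter⊆ cx cy = pick
      where
        both : ∀ i j → MeetsCutter x i → MeetsCutter y j → (i , j) ∈ pixels
        both i j (z , z∈ , zx) (w , w∈ , wy) = pixel-of-interior z∈ w∈ (cutter⊆ (z , w) (zx , wy))
        pick : ∀ c → blockPixel (a , b) c ∈ pixels
        pick sw = both a b (interior-right {x} {a} cx) (interior-right {y} {b} cy)
        pick se = both (a ℤ.- + 1) b (interior-left {x} {a} cx) (interior-right {y} {b} cy)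
        pick nw = both a (b ℤ.- + 1) (interior-right {x} {a} cx) (interior-left {y} {b} cy)
        pick ne = both (a ℤ.- + 1) (b ℤ.- + 1) (interior-left {x} {a} cx) (interior-left {y} {b} cy)

  -- A lower bound for the number of scan points

  distinctPixels : List Pixel
  distinctPixels = deduplicate _≟ᵥ_ pixels

  radius : List Pixel → ℕ
  -- Starting from 1 keeps the divisor `2r` of the drift positive.
  radius []            = 1
  radius ((i , j) ∷ D) = ℤ.∣ i ∣ ℕ.+ ℤ.∣ j ∣ ℕ.+ radius D

  radius-bound : ∀ {i j D} → (i , j) ∈ D → ℤ.∣ i ∣ ℕ.≤ radius D × ℤ.∣ j ∣ ℕ.≤ radius D
  radius-bound {i} {j} {D = _ ∷ D} (here ≡.refl) =
    ℕ.≤-trans (ℕ.m≤m+n _ _) (ℕ.m≤m+n _ (radius D)) , ℕ.≤-trans (ℕ.m≤n+m _ ℤ.∣ i ∣) (ℕ.m≤m+n _ (radius D))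
  radius-bound {D = (i′ , j′) ∷ D} (there ij∈) with radius-bound ij∈
  ... | i≤ , j≤ = ℕ.≤-trans i≤ (ℕ.m≤n+m _ _) , ℕ.≤-trans j≤ (ℕ.m≤n+m _ _)

  0<radius : ∀ D → 0 ℕ.< radius D
  0<radius []      = ℕ.z<s
  0<radius (_ ∷ D) = ℕ.≤-trans (0<radius D) (ℕ.m≤n+m _ _)

  private
    r : ℕ
    r = radius pixels

    2r : Carrier
    2r = fromℤ (+ (r ℕ.+ r))

    opaque
      drift-spec : ∃[ h ] 0# < h × 2r * h ≈ 1#
      drift-spec = recip (≰⇒> λ 2r≤0 → 1≰0 (≤-trans (≤-reflexive (sym fromℤ-1))
        (≤-trans (fromℤ-mono-≤ (ℤ.+≤+ (ℕ.≤-trans (0<radius pixels) (ℕ.m≤m+n r r)))) 2r≤0)))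

    h : Carrier
    h = proj₁ drift-spec

  -- The witness of column i drifts from left to right within its column, so
  -- that witnesses two columns apart are more than 2 apart.
  witness : ℤ → Carrier
  witness i = fromℤ i + fromℤ (i ℤ.+ + r) * h

  opaque
    witness∈ : ∀ {i} → ℤ.∣ i ∣ ℕ.≤ r → fromℤ i ≤ witness i × witness i ≤ fromℤ i + 1#
    witness∈ {i} ∣i∣≤r =
      ≤-by (*-nonneg 0≤i+r (proj₁ 0<h)) (solve 2 (λ i d → i :+ d :- i := d) refl (fromℤ i) (fromℤ (i ℤ.+ + r) * h)) ,
      +-mono-≤ ≤-refl (≤-trans (*-mono-≤ 0≤i+r (proj₁ 0<h) (fromℤ-mono-≤ i+r≤2r) ≤-refl) (≤-reflexive 2rh≈1))
      where
        0<h : 0# < h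
        0<h = proj₁ (proj₂ drift-spec)
        2rh≈1 : 2r * h ≈ 1#
        2rh≈1 = proj₂ (proj₂ drift-spec)
        i+r≤2r : i ℤ.+ + r ℤ.≤ + (r ℕ.+ r)
        i+r≤2r = ℤ.+-monoˡ-≤ (+ r) (≤∣i∣ {i} ∣i∣≤r)
        0≤i+r : 0# ≤ fromℤ (i ℤ.+ + r)
        0≤i+r = fromℤ-mono-≤ {+ 0} {i ℤ.+ + r} (ℤ-≤-by₁ (≤∣i∣ {ℤ.- i} (≡.subst (ℕ._≤ r) (≡.sym (ℤ.∣-i∣≡∣i∣ i)) ∣i∣≤r))
          (S.solve 2 (λ i r → i S.:+ r S.:- S.con (+ 0) S.:= r S.:- S.:- i) ≡.refl i (+ r)))
          where module S = +-*-Solver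

    -- The columns contribute at least 2 to the distance of the witnesses and the drift at least
    -- `h`, while two points within 1 of `p` differ by at most 2.
    witness-gap : ∀ {i j p} → i ℤ.+ + 2 ℤ.≤ j → witness j - p ≤ 1# → p - witness i ≤ 1# → ⊥
    witness-gap {i} {j} {p} i+2≤j j-p≤1 p-i≤1 = <⇒≱ (proj₁ (proj₂ drift-spec)) (≤-by₂ (≤-by₃ j-p≤1 p-i≤1 gap
        (solve 5 (λ i j I J p → :0 :- (J :- I) := (:1 :- (j :+ J :- p)) :+ (:1 :- (p :- (i :+ I))) :+ (j :- (i :+ (:1 :+ :1)))) refl
           (fromℤ i) (fromℤ j) I J p))
        drift
        (solve 3 (λ I J h → :0 :- h := (:0 :- (J :- I)) :+ (J :- (I :+ h))) refl I J h))
      where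
        I J : Carrier
        I = fromℤ (i ℤ.+ + r) * h
        J = fromℤ (j ℤ.+ + r) * h
        gap : fromℤ i + (1# + 1#) ≤ fromℤ j
        gap = ≤-trans (≤-reflexive (sym (trans (fromℤ-+ i (+ 2)) (+-congˡ (fromℤ≈ι (+ 2)))))) (fromℤ-mono-≤ i+2≤j)
        i+r+1≤j+r : i ℤ.+ + r ℤ.+ + 1 ℤ.≤ j ℤ.+ + r
        i+r+1≤j+r = ℤ-≤-by₂ i+2≤j (ℤ.+≤+ {0} {1} ℕ.z≤n)
          (S.solve 3 (λ i j r → j S.:+ r S.:- (i S.:+ r S.:+ S.con (+ 1)) S.:= (j S.:- (i S.:+ S.con (+ 2))) S.:+ (S.con (+ 1) S.:- S.con (+ 0))) ≡.refl i j (+ r))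
          where module S = +-*-Solver
        drift : I + h ≤ J
        drift = ≤-trans (≤-reflexive (trans (solve 2 (λ a h → a :* h :+ h := (a :+ :1) :* h) refl (fromℤ (i ℤ.+ + r)) h)
                                            (*-congʳ (sym (fromℤ-+1 (i ℤ.+ + r))))))
                  (≤-trans (≤-reflexive (*-comm _ h)) (≤-trans (*-monoˡ-≤ (proj₁ (proj₁ (proj₂ drift-spec))) (fromℤ-mono-≤ {i ℤ.+ + r ℤ.+ + 1} {j ℤ.+ + r} i+r+1≤j+r)) (≤-reflexive (*-comm h _))))

  private
    bits : List ℕ
    bits = 0 ∷ 1 ∷ []

    ∈-bits : ∀ i → i ℤ.%ℕ 2 ∈ bits
    ∈-bits i with i ℤ.%ℕ 2 | ℤ.n%ℕd<d i 2
    ... | 0 | _ = here ≡.refl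
    ... | 1 | _ = there (here ≡.refl)
    ... | suc (suc _) | ℕ.s≤s (ℕ.s≤s ())

    Label : Set
    Label = Point × ℕ × ℕ

    LabelledBy : Pixel → Label → Set
    LabelledBy (i , j) (p , a , b) = Within 1# p (witness i , witness j) × i ℤ.%ℕ 2 ≡ a × j ℤ.%ℕ 2 ≡ b

    same-column : ∀ {i i′ p} → i ℤ.%ℕ 2 ≡ i′ ℤ.%ℕ 2 → witness i - p ≤ 1# × p - witness i ≤ 1# →
                  witness i′ - p ≤ 1# × p - witness i′ ≤ 1# → i ≡ i′
    same-column {i} {i′} {p} r≡ (a , b) (a′ , b′) with i ℤ.≟ i′
    ... | yes i≡i′ = i≡i′
    ... | no  i≢i′ with parity-gap r≡ i≢i′
    ...   | inj₁ gap = ⊥-elim (witness-gap {i} {i′} gap a′ b)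
    ...   | inj₂ gap = ⊥-elim (witness-gap {i′} {i} gap a b′)

  -- A scan point sees at most one witness of each pair of parities.
  pixels≤4scans : ∀ S → Covers P S → List.length distinctPixels ℕ.≤ 4 ℕ.* List.length S
  pixels≤4scans S (_ , covers) = ℕ.≤-trans
    (length-≤-via LabelledBy (deduplicate-! _≟ᵥ_ pixels) labelled injective)
    (ℕ.≤-reflexive (≡.trans (length-cartesianProduct S (cartesianProduct bits bits)) (ℕ.*-comm (List.length S) 4)))
    where
      labelled : ∀ {Q} → Q ∈ distinctPixels → ∃[ l ] l ∈ cartesianProduct S (cartesianProduct bits bits) × LabelledBy Q l
      labelled {i , j} Q∈ =
        let Q∈P = ∈-deduplicate⁻ _≟ᵥ_ pixels Q∈
            ∣i∣≤ , ∣j∣≤ = radius-bound Q∈P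
            s , s∈S , _ , near = find (covers (witness i , witness j) (lose Q∈P (witness∈ {i} ∣i∣≤ , witness∈ {j} ∣j∣≤)))
        in (s , i ℤ.%ℕ 2 , j ℤ.%ℕ 2) , ∈-cartesianProduct⁺ s∈S (∈-cartesianProduct⁺ (∈-bits i) (∈-bits j)) , near , ≡.refl , ≡.refl
      injective : ∀ {Q Q′ l} → Q ∈ distinctPixels → Q′ ∈ distinctPixels → LabelledBy Q l → LabelledBy Q′ l → Q ≡ Q′
      injective _ _ ((x , y) , a , b) ((x′ , y′) , a′ , b′) =
        ≡.cong₂ _,_ (same-column (≡.trans a (≡.sym a′)) x x′) (same-column (≡.trans b (≡.sym b′)) y y′)

-- Fine partitions of a continuous path, and the L₁-length of inscribed polygons

module Partition (ℝ : CompleteOrderedField) (em : ExcludedMiddle 0ℓ) where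
  open OrderedField ℝ em
  open MWPDV ℝ
  open Polygon ℝ em

  final : Carrier → List Carrier → Carrier
  final t []       = t
  final t (u ∷ us) = final u us

  final-∷ʳ : ∀ t us v → final t (us ++ v ∷ []) ≡ v
  final-∷ʳ t []       v = ≡.refl
  final-∷ʳ t (u ∷ us) v = final-∷ʳ u us v

  module _ (γ : Carrier → Point) (η : Carrier) where

    -- The whole time interval is controlled, not only its end, so that the sample at `s` can stand
    -- in for the cutter at every time up to `t`.
    Step : Carrier → Carrier → Set
    Step s t = s ≤ t × (∀ u → s ≤ u → u ≤ t → Within η (γ s) (γ u))

    Steps : Carrier → List Carrier → Set
    Steps s []       = ⊤
    Steps s (t ∷ ts) = Step s t × Steps t ts

    Steps-∷ʳ : ∀ s ts {t} → Steps s ts → Step (final s ts) t → Steps s (ts ++ t ∷ [])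
    Steps-∷ʳ s []       _            last = last , tt
    Steps-∷ʳ s (u ∷ us) (su , steps) last = su , Steps-∷ʳ u us steps last

    opaque
      steps-start≤ : ∀ {s} ts → Steps s ts → All (s ≤_) (s ∷ ts)
      steps-start≤ []       _                   = ≤-refl ∷ []
      steps-start≤ (t ∷ ts) ((s≤t , _) , steps) = ≤-refl ∷ All.map (≤-trans s≤t) (steps-start≤ ts steps)

      steps-≤final : ∀ {s} ts → Steps s ts → All (_≤ final s ts) (s ∷ ts)
      steps-≤final []       _                   = ≤-refl ∷ []
      steps-≤final (t ∷ ts) ((s≤t , _) , steps) with steps-≤final ts steps
      ... | t≤ ∷ ts≤ = ≤-trans s≤t t≤ ∷ t≤ ∷ ts≤

      steps-linked : ∀ {s} ts → Steps s ts → Linked _≤_ (s ∷ ts)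
      steps-linked []       _                   = [-]
      steps-linked (t ∷ ts) ((s≤t , _) , steps) = s≤t ∷ steps-linked ts steps

      steps-near : ∀ {s} u us → Steps s (u ∷ us) → ∀ {t} → s ≤ t → t ≤ final u us →
                   ∃[ v ] v ∈ s ∷ u ∷ us × Within η (γ v) (γ t)
      steps-near {s} u []       ((_ , near) , _)     {t} s≤t t≤u = s , here ≡.refl , near t s≤t t≤u
      steps-near {s} u (w ∷ us) ((_ , near) , steps) {t} s≤t t≤ with total t u
      ... | inj₁ t≤u = s , here ≡.refl , near t s≤t t≤u
      ... | inj₂ u≤t with steps-near w us steps u≤t t≤
      ...   | v , v∈ , vt = v , there v∈ , vt

  opaque
    within-+ : ∀ {ε ε′ η} p q q′ → ε + ε′ ≈ η → Within ε p q → Within ε′ p q′ → Within η q q′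
    within-+ {ε} {ε′} {η} (px , py) (qx , qy) (x , y) sum ((a , b) , (c , d)) ((a′ , b′) , (c′ , d′)) =
      (add px qx x a′ b , add′ px qx x a b′) , (add py qy y c′ d , add′ py qy y c d′)
      where
        add : ∀ p q x → x - p ≤ ε′ → p - q ≤ ε → x - q ≤ η
        add p q x x-p≤ p-q≤ = ≤-trans (≤-by₂ x-p≤ p-q≤
          (solve 5 (λ p q x e e′ → e :+ e′ :- (x :- q) := (e′ :- (x :- p)) :+ (e :- (p :- q))) refl p q x ε ε′)) (≤-reflexive sum)
        add′ : ∀ p q x → q - p ≤ ε → p - x ≤ ε′ → q - x ≤ η
        add′ p q x q-p≤ p-x≤ = ≤-trans (≤-by₂ q-p≤ p-x≤
          (solve 5 (λ p q x e e′ → e :+ e′ :- (q :- x) := (e :- (q :- p)) :+ (e′ :- (p :- x))) refl p q x ε ε′)) (≤-reflexive sum)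

  module _ (γ : Carrier → Point) {a b : Carrier} (a≤b : a ≤ b) (continuous : ContinuousOn a b γ)
           {η : Carrier} (0<η : 0# < η) where

    private
      Reached : Carrier → Set
      Reached t = (a ≤ t × t ≤ b) × ∃[ ts ] Steps γ η a ts × final a ts ≡ t

    opaque
      -- The supremum of the times reached by fine steps is itself passed by one
      -- further step, by continuity there.
      fine-partition : ∃[ t ] ∃[ ts ] Steps γ η a (t ∷ ts) × final t ts ≡ b
      fine-partition with complete Reached (a , (≤-refl , a≤b) , [] , tt , ≡.refl) (b , λ t ((_ , t≤b) , _) → t≤b) | halve 0<η
      ... | σ , upper , lowest | ε , 0<ε , ε+ε≈η
        with continuous σ (upper a ((≤-refl , a≤b) , [] , tt , ≡.refl) , lowest b λ t ((_ , t≤b) , _) → t≤b) ε 0<ε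
      ... | δ , 0<δ , near = finish (total b (σ + δ)) late
        where
          late : ∃[ t ] Reached t × ¬ t ≤ σ - δ
          late with em {∃[ t ] Reached t × ¬ t ≤ σ - δ}
          ... | yes found = found
          ... | no  none  = contradiction (lowest (σ - δ) bound) (0<⇒x≰x-e 0<δ)
            where
              bound : IsUpperBound Reached (σ - δ)
              bound t t∈ with em {t ≤ σ - δ}
              ... | yes t≤ = t≤
              ... | no  t≰ = contradiction (t , t∈ , t≰) none
          short-step : ∀ {t t′} → Reached t → ¬ t ≤ σ - δ → t ≤ t′ → t′ ≤ b → t′ ≤ σ + δ → Step γ η t t′
          short-step {t} {t′} ((a≤t , t≤b) , rest) t≰ t≤t′ t′≤b t′≤ = t≤t′ , λ u t≤u u≤t′ →
            within-+ (γ σ) (γ t) (γ u) ε+ε≈η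
              (near t (a≤t , t≤b) (before (≤-trans t≤t′ t′≤)) (after (≰⇒≥ t≰)))
              (near u (≤-trans a≤t t≤u , ≤-trans u≤t′ t′≤b) (before (≤-trans u≤t′ t′≤)) (after (≤-trans (≰⇒≥ t≰) t≤u)))
            where
              before : ∀ {u} → u ≤ σ + δ → u - σ ≤ δ
              before {u} p = ≤-by₁ p (solve 3 (λ u s d → d :- (u :- s) := s :+ d :- u) refl u σ δ)
              after : ∀ {u} → σ - δ ≤ u → σ - u ≤ δ
              after {u} p = ≤-by₁ p (solve 3 (λ u s d → d :- (s :- u) := u :- (s :- d)) refl u σ δ)
          -- A first step has to be named; the appended `b` provides one even for empty `ts`.
          nonempty : ∀ ts → Steps γ η a (ts ++ b ∷ []) → ∃[ t ] ∃[ us ] Steps γ η a (t ∷ us) × final t us ≡ b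
          nonempty []       steps = b , [] , steps , ≡.refl
          nonempty (t ∷ ts) steps = t , ts ++ b ∷ [] , steps , final-∷ʳ t ts b
          finish : b ≤ σ + δ ⊎ σ + δ ≤ b → ∃[ t ] Reached t × ¬ t ≤ σ - δ →
                   ∃[ t ] ∃[ ts ] Steps γ η a (t ∷ ts) × final t ts ≡ b
          finish (inj₁ b≤) (_ , t∈@((_ , t≤b) , ts , steps , ≡.refl) , t≰) =
            nonempty ts (Steps-∷ʳ γ η a ts steps (short-step t∈ t≰ t≤b ≤-refl b≤))
          finish (inj₂ σ+δ≤b) (_ , t∈@((a≤t , _) , ts , steps , ≡.refl) , t≰) =
            contradiction (upper (σ + δ) ((≤-trans a≤t t≤σ+δ , σ+δ≤b) , ts ++ (σ + δ) ∷ [] ,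
              Steps-∷ʳ γ η a ts steps (short-step t∈ t≰ t≤σ+δ σ+δ≤b ≤-refl) , final-∷ʳ a ts (σ + δ)))
              (0<⇒x+e≰x 0<δ)
            where
              t≤σ+δ : final a ts ≤ σ + δ
              t≤σ+δ = ≤-by₂ (upper _ t∈) (proj₁ 0<δ) (solve 3 (λ t s d → s :+ d :- t := (s :- t) :+ (d :- :0)) refl (final a ts) σ δ)

  opaque
    -- The rational substitute 3/2 for √2: with `A` and `B` the absolute differences,
    -- `9 (A² + B²) - 4 (A + B)²` equals `A² + B² + 4 (A - B)²`.
    manhattan≤ : ∀ {p q d} → IsDistance p q d →
                 (1# + 1#) * (∣ proj₁ q - proj₁ p ∣ + ∣ proj₂ q - proj₂ p ∣) ≤ (1# + 1# + 1#) * d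
    manhattan≤ {px , py} {qx , qy} {d} (0≤d , d²≈) = square-cancel-≤ 0≤3d (≤-by
        (0≤+ (0≤x² A) (0≤+ (0≤x² B) (0≤+ (0≤+ (0≤x² (A - B)) (0≤x² (A - B))) (0≤+ (0≤x² (A - B)) (0≤x² (A - B))))))
        (trans (+-congʳ 9d²) (solve 2 (λ A B →
          (:1 :+ :1 :+ :1) :* (:1 :+ :1 :+ :1) :* (A :* A :+ B :* B) :- (:1 :+ :1) :* (A :+ B) :* ((:1 :+ :1) :* (A :+ B)) :=
          A :* A :+ (B :* B :+ (((A :- B) :* (A :- B) :+ (A :- B) :* (A :- B)) :+ ((A :- B) :* (A :- B) :+ (A :- B) :* (A :- B))))) refl A B)))
      where
        A B : Carrier
        A = ∣ qx - px ∣
        B = ∣ qy - py ∣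
        0≤3d : 0# ≤ (1# + 1# + 1#) * d
        0≤3d = *-nonneg (0≤+ (0≤+ 0≤1 0≤1) 0≤1) 0≤d
        9d² : (1# + 1# + 1#) * d * ((1# + 1# + 1#) * d) ≈ (1# + 1# + 1#) * (1# + 1# + 1#) * (A * A + B * B)
        9d² = trans (solve 1 (λ d → (:1 :+ :1 :+ :1) :* d :* ((:1 :+ :1 :+ :1) :* d) := (:1 :+ :1 :+ :1) :* (:1 :+ :1 :+ :1) :* (d :* d)) refl d)
                    (*-congˡ (trans d²≈ (sym (+-cong (∣x∣²≈x² (qx - px)) (∣x∣²≈x² (qy - py))))))

    distance-exists : ∀ p q → ∃ (IsDistance p q)
    distance-exists (px , py) (qx , qy) = sqrt (0≤+ (0≤x² (qx - px)) (0≤x² (qy - py)))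

    polyline-length : ∀ p ps → ∃[ ℓ ] PolylineLength (p ∷ ps) ℓ × (1# + 1#) * perimeter p ps ≤ (1# + 1# + 1#) * ℓ
    polyline-length p []       = 0# , single refl ,
      ≤-reflexive (solve 0 ((:1 :+ :1) :* (:0 :+ :0) := (:1 :+ :1 :+ :1) :* :0) refl)
    polyline-length p (q ∷ qs) with distance-exists p q | polyline-length q qs
    ... | d , dist | ℓ , polyline , bound = d + ℓ , step dist polyline refl ,
      ≤-by₂ (manhattan≤ dist) bound
        (solve 6 (λ a b v w d l → (:1 :+ :1 :+ :1) :* (d :+ l) :- (:1 :+ :1) :* (v :+ a :+ (w :+ b)) :=
            ((:1 :+ :1 :+ :1) :* d :- (:1 :+ :1) :* (a :+ b)) :+ ((:1 :+ :1 :+ :1) :* l :- (:1 :+ :1) :* (v :+ w))) refl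
          ∣ proj₁ q - proj₁ p ∣ ∣ proj₂ q - proj₂ p ∣ (variation proj₁ q qs) (variation proj₂ q qs) d ℓ)

    partition-perimeter : ∀ γ {a b η L} → IsSupremum (InscribedLength a b γ) L → ∀ ts → Steps γ η a ts → final a ts ≡ b →
                          (1# + 1#) * perimeter (γ a) (map γ ts) ≤ (1# + 1# + 1#) * L
    partition-perimeter γ {a} {η = η} {L} (upper , _) ts steps ≡.refl with polyline-length (γ a) (map γ ts)
    ... | ℓ , polyline , bound = ≤-trans bound (*-monoˡ-≤ (0≤+ (0≤+ 0≤1 0≤1) 0≤1) (upper ℓ (a ∷ ts , steps-linked γ η ts steps ,
        All.zip (steps-start≤ γ η ts steps , steps-≤final γ η ts steps) , polyline)))

-- Sampling points of the plane on the refined lattice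

module Grid (ℝ : CompleteOrderedField) (em : ExcludedMiddle 0ℓ) (n : ℕ) .{{n≢0 : NonZero n}} where
  open OrderedField ℝ em
  open MWPDV ℝ
  open Polygon ℝ em
  open Rounding n

  ν : Carrier
  ν = fromℤ (+ n)

  opaque
    0<ν : 0# < ν
    0<ν = ≰⇒> λ ν≤0 → 1≰0 (≤-trans (≤-reflexive (sym fromℤ-1))
      (≤-trans (fromℤ-mono-≤ (ℤ.+≤+ (ℕ.>-nonZero⁻¹ n))) ν≤0))

  grid : Point → Vertex
  grid (x , y) = ⌊ ν * x ⌋ , ⌊ ν * y ⌋

  opaque
    grid-cong : ∀ {p q} → proj₁ p ≈ proj₁ q → proj₂ p ≈ proj₂ q → grid p ≡ grid q
    grid-cong x≈ y≈ = ≡.cong₂ _,_ (⌊⌋-cong (*-congˡ x≈)) (⌊⌋-cong (*-congˡ y≈))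

    x-1≤⌊x⌋ : ∀ x → x ≤ fromℤ ⌊ x ⌋ + 1#
    x-1≤⌊x⌋ x = ≰⇒≥ (⌊x⌋+1≰x x)

    ⌊fromℤ⌋ : ∀ i → ⌊ fromℤ i ⌋ ≡ i
    ⌊fromℤ⌋ i = ℤ.≤-antisym (fromℤ-cancel-≤ (⌊x⌋≤x (fromℤ i)))
      (ℤ.≮⇒≥ λ ⌊i⌋<i → ⌊x⌋+1≰x (fromℤ i) (≤-trans (≤-reflexive (sym (trans (fromℤ-+ (+ 1) ⌊ fromℤ i ⌋)
        (trans (+-congʳ fromℤ-1) (+-comm 1# _))))) (fromℤ-mono-≤ (ℤ.i<j⇒suc[i]≤j ⌊i⌋<i))))

    fromℤ-suc : ∀ i → fromℤ (ℤ.suc i) ≈ fromℤ i + 1#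
    fromℤ-suc i = trans (fromℤ-+ (+ 1) i) (trans (+-congʳ fromℤ-1) (+-comm 1# _))

    -- Floors err in one direction only, so a difference of two floors is off by at most 1, not 2.
    ⌊⌋-difference : ∀ a b c → ν * (a - b) + 1# ≤ c → ν * (b - a) + 1# ≤ c → fromℤ (+ ℤ.∣ ⌊ ν * a ⌋ ℤ.- ⌊ ν * b ⌋ ∣) ≤ c
    ⌊⌋-difference a b c ab≤ ba≤ = fromℤ-∣i∣≤ (⌊ ν * a ⌋ ℤ.- ⌊ ν * b ⌋)
      (≤-trans (≤-reflexive (fromℤ-- ⌊ ν * a ⌋ ⌊ ν * b ⌋)) (≤-trans (half a b) ab≤))
      (≤-trans (≤-reflexive (trans (-‿cong (fromℤ-- ⌊ ν * a ⌋ ⌊ ν * b ⌋))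
        (solve 2 (λ a b → :- (a :- b) := b :- a) refl (fromℤ ⌊ ν * a ⌋) (fromℤ ⌊ ν * b ⌋)))) (≤-trans (half b a) ba≤))
      where
        half : ∀ a b → fromℤ ⌊ ν * a ⌋ - fromℤ ⌊ ν * b ⌋ ≤ ν * (a - b) + 1#
        half a b = ≤-by₂ (⌊x⌋≤x (ν * a)) (x-1≤⌊x⌋ (ν * b))
          (solve 5 (λ v a b A B → v :* (a :- b) :+ :1 :- (A :- B) := (v :* a :- A) :+ (B :+ :1 :- v :* b)) refl
            ν a b (fromℤ ⌊ ν * a ⌋) (fromℤ ⌊ ν * b ⌋))

    ⌊⌋-near : ∀ {a b η m} → ν * η ≤ fromℤ (+ m) → a - b ≤ η → b - a ≤ η → ℤ.∣ ⌊ ν * a ⌋ ℤ.- ⌊ ν * b ⌋ ∣ ℕ.≤ suc m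
    ⌊⌋-near {a} {b} {η} {m} νη≤m ab≤ ba≤ = ℤ.drop‿+≤+ (fromℤ-cancel-≤ {+ ℤ.∣ ⌊ ν * a ⌋ ℤ.- ⌊ ν * b ⌋ ∣} {+ suc m}
      (⌊⌋-difference a b _ (half ab≤) (half ba≤)))
      where
        half : ∀ {d} → d ≤ η → ν * d + 1# ≤ fromℤ (+ suc m)
        half d≤η = ≤-trans (+-monoˡ-≤ 1# (≤-trans (*-monoˡ-≤ (proj₁ 0<ν) d≤η) νη≤m)) (≤-reflexive (+-comm (fromℤ (+ m)) 1#))

    grid-taxi : ∀ p q → fromℤ (+ taxi (grid p) (grid q)) ≤ ν * (∣ proj₁ q - proj₁ p ∣ + ∣ proj₂ q - proj₂ p ∣) + (1# + 1#)
    grid-taxi (px , py) (qx , qy) = ≤-trans (≤-reflexive (fromℤ-+ (+ ℤ.∣ ⌊ ν * px ⌋ ℤ.- ⌊ ν * qx ⌋ ∣) (+ ℤ.∣ ⌊ ν * py ⌋ ℤ.- ⌊ ν * qy ⌋ ∣)))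
      (≤-trans (+-mono-≤ (one px qx) (one py qy))
        (≤-reflexive (solve 3 (λ v a b → v :* a :+ :1 :+ (v :* b :+ :1) := v :* (a :+ b) :+ (:1 :+ :1)) refl ν ∣ qx - px ∣ ∣ qy - py ∣)))
      where
        one : ∀ p q → fromℤ (+ ℤ.∣ ⌊ ν * p ⌋ ℤ.- ⌊ ν * q ⌋ ∣) ≤ ν * ∣ q - p ∣ + 1#
        one p q = ⌊⌋-difference p q _
          (+-monoˡ-≤ 1# (*-monoˡ-≤ (proj₁ 0<ν) (≤-trans (≤-reflexive (solve 2 (λ p q → p :- q := :- (q :- p)) refl p q)) (-x≤∣x∣ (q - p)))))
          (+-monoˡ-≤ 1# (*-monoˡ-≤ (proj₁ 0<ν) (x≤∣x∣ (q - p))))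

    -- Every edge loses at most 1 per coordinate to the floors, whence twice the number of edges. A
    -- large `n` later makes this term at most half of `ν * length M`.
    grid-travel : ∀ p ps → fromℤ (+ travel (grid p) (map grid ps)) ≤ ν * perimeter p ps + (1# + 1#) * fromℤ (+ List.length ps)
    grid-travel p []       = ≤-reflexive (solve 1 (λ v → :0 := v :* (:0 :+ :0) :+ (:1 :+ :1) :* :0) refl ν)
    grid-travel p (q ∷ qs) = ≤-trans (≤-reflexive (fromℤ-+ (+ taxi (grid p) (grid q)) (+ travel (grid q) (map grid qs))))
      (≤-trans (+-mono-≤ (grid-taxi p q) (grid-travel q qs))
        (≤-reflexive (solve 6 (λ v a b x y m → v :* (a :+ b) :+ (:1 :+ :1) :+ (v :* (x :+ y) :+ (:1 :+ :1) :* m) :=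
             v :* (x :+ a :+ (y :+ b)) :+ (:1 :+ :1) :* (:1 :+ m)) refl
          ν ∣ proj₁ q - proj₁ p ∣ ∣ proj₂ q - proj₂ p ∣ (variation proj₁ q qs) (variation proj₂ q qs) (fromℤ (+ List.length qs)))))

    fl-cell : ∀ {x X} → ν * x ≈ fromℤ X → fromℤ (fl X) ≤ x × x ≤ fromℤ (fl X) + 1#
    fl-cell {x} {X} νx≈X =
      *-cancelˡ-≤ 0<ν (≤-trans (≤-reflexive (trans (*-comm ν _) (sym (fromℤ-* (fl X) (+ n))))) (≤-trans (fromℤ-mono-≤ (fl-lower X)) (≤-reflexive (sym νx≈X)))) ,
      *-cancelˡ-≤ 0<ν (≤-trans (≤-reflexive νx≈X) (≤-trans (fromℤ-mono-≤ (ℤ.<⇒≤ (fl-upper X)))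
        (≤-reflexive (trans (fromℤ-* (ℤ.suc (fl X)) (+ n)) (trans (*-comm _ ν) (*-congˡ (fromℤ-suc (fl X))))))))

    -- The integer estimate leaves a full unit to spare, which is more than the floor of `ν * x`
    -- loses. With `round-not-above` it amounts to `Close`.
    round-not-below : ∀ φ x → ¬ fromℤ (fl (⌊ ν * x ⌋ ℤ.+ φ) ℤ.- fl φ) + 1# ≤ x
    round-not-below φ x a+1≤x = ⌊x⌋+1≰x (ν * x) (≤-trans (≤-reflexive (sym (fromℤ-suc X)))
      (≤-trans (fromℤ-mono-≤ (round-lower φ X)) (≤-trans (≤-reflexive (trans (fromℤ-* (ℤ.suc a) (+ n))
        (trans (*-comm _ ν) (*-congˡ (fromℤ-suc a))))) (*-monoˡ-≤ (proj₁ 0<ν) a+1≤x))))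
      where
        X a : ℤ
        X = ⌊ ν * x ⌋
        a = fl (X ℤ.+ φ) ℤ.- fl φ

    round-not-above : ∀ φ x → ¬ x + 1# ≤ fromℤ (fl (⌊ ν * x ⌋ ℤ.+ φ) ℤ.- fl φ)
    round-not-above φ x x+1≤a = 1≰0 (≤-by₃ an+1≤X+n (⌊x⌋≤x (ν * x)) (*-monoˡ-≤ (proj₁ 0<ν) x+1≤a)
        (solve 4 (λ v x a X → :0 :- :1 := (X :+ v :- (a :* v :+ :1)) :+ (v :* x :- X) :+ (v :* a :- v :* (x :+ :1))) refl ν x (fromℤ a) (fromℤ X)))
      where
        X a : ℤ
        X = ⌊ ν * x ⌋
        a = fl (X ℤ.+ φ) ℤ.- fl φ
        an+1≤X+n : fromℤ a * ν + 1# ≤ fromℤ X + ν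
        an+1≤X+n = ≤-trans (≤-reflexive (sym (trans (fromℤ-suc (a ℤ.* + n)) (+-congʳ (fromℤ-* a (+ n))))))
          (≤-trans (fromℤ-mono-≤ (round-upper φ X)) (≤-reflexive (fromℤ-+ X (+ n))))

-- Numerical estimates, and the tour built from a milling tour

module Milling (ℝ : CompleteOrderedField) (em : ExcludedMiddle 0ℓ) (P : Polyomino) where
  open OrderedField ℝ em
  open MWPDV ℝ
  open Polygon ℝ em
  open InPolyomino P
  open Polyomino P
  open Visibility ℝ em P
  open Partition ℝ em

  opaque
    0≤ι : ∀ n → 0# ≤ ι (+ n)
    0≤ι n = ≤-trans (fromℤ-nonneg n) (≤-reflexive (fromℤ≈ι (+ n)))

    -- `7 |S| ≤ 4 N` and `N ≤ 4 k` give `14 |S| ≤ 32 k`, and 32 is less than 35.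
    scan-bound : ∀ {S : List Vertex} → 7 ℕ.* List.length S ℕ.≤ 4 ℕ.* List.length distinctPixels →
                 ∀ k → IsMinimumScanNumber P k → 2 ℕ.* List.length (map point S) ℕ.≤ 5 ℕ.* k
    scan-bound {S} 7S≤4D k ((S* , covers , ≡.refl) , _) = ℕ.*-cancelˡ-≤ 7 (begin
      7 ℕ.* (2 ℕ.* List.length (map point S))    ≡⟨ ≡.cong (λ l → 7 ℕ.* (2 ℕ.* l)) (List.length-map point S) ⟩
      7 ℕ.* (2 ℕ.* List.length S)                ≡⟨ swap (List.length S) ⟩
      2 ℕ.* (7 ℕ.* List.length S)                ≤⟨ ℕ.*-monoʳ-≤ 2 7S≤4D ⟩
      2 ℕ.* (4 ℕ.* List.length distinctPixels)   ≤⟨ ℕ.*-monoʳ-≤ 2 (ℕ.*-monoʳ-≤ 4 (pixels≤4scans S* covers)) ⟩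
      2 ℕ.* (4 ℕ.* (4 ℕ.* List.length S*))       ≤⟨ ℕ.m≤m+n _ (3 ℕ.* List.length S*) ⟩
      2 ℕ.* (4 ℕ.* (4 ℕ.* List.length S*)) ℕ.+ 3 ℕ.* List.length S*  ≡⟨ tally (List.length S*) ⟩
      7 ℕ.* (5 ℕ.* List.length S*)               ∎)
      where
        open ℕ.≤-Reasoning
        swap : ∀ s → 7 ℕ.* (2 ℕ.* s) ≡ 2 ℕ.* (7 ℕ.* s)
        swap = ℕ-Solver.solve-∀
        tally : ∀ k → 2 ℕ.* (4 ℕ.* (4 ℕ.* k)) ℕ.+ 3 ℕ.* k ≡ 7 ℕ.* (5 ℕ.* k)
        tally = ℕ-Solver.solve-∀

    -- Here `V ≤ 3/2 L` and `2 m ≤ n L / 2`, so `H ≤ 2 n L`; and `w` is at most 5/4 of `H / n`.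
    length-estimate : ∀ {n w H m} {V L ℓ : Carrier} → 0# < fromℤ (+ n) → 4 ℕ.* n ℕ.* w ℕ.≤ 5 ℕ.* H →
                      fromℤ (+ H) ≤ fromℤ (+ n) * V + (1# + 1#) * fromℤ (+ m) →
                      (1# + 1#) * V ≤ (1# + 1# + 1#) * L → ι (+ 4) * fromℤ (+ m) ≤ fromℤ (+ n) * L →
                      ℓ ≤ fromℤ (+ w) → fromℤ (+ 2) * ℓ ≤ fromℤ (+ 5) * L
    length-estimate {n} {w} {H} {m} {V} {L} {ℓ} 0<ν 4nw≤5H H≤ V≤ m≤ ℓ≤w = begin
      fromℤ (+ 2) * ℓ    ≤⟨ *-monoˡ-≤ (fromℤ-nonneg 2) ℓ≤w ⟩
      fromℤ (+ 2) * W    ≈⟨ *-congʳ (fromℤ≈ι (+ 2)) ⟩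
      ι (+ 2) * W        ≤⟨ *-cancelˡ-≤ 0<4 (*-cancelˡ-≤ 0<ν scaled) ⟩
      ι (+ 5) * L        ≈⟨ *-congʳ (fromℤ≈ι (+ 5)) ⟨
      fromℤ (+ 5) * L    ∎
      where
        open ≤-Reasoning
        ν W : Carrier
        ν = fromℤ (+ n)
        W = fromℤ (+ w)
        0<4 : 0# < ι (+ 4)
        0<4 = ≰⇒> λ 4≤0 → 1≰0 (≤-by₂ 4≤0 (0≤ι 3) (solve 0 (:0 :- :1 := (:0 :- con (+ 4)) :+ (con (+ 3) :- :0)) refl))
        4νW≤5H : ι (+ 4) * ν * W ≤ ι (+ 5) * fromℤ (+ H)
        4νW≤5H = ≤-trans (≤-reflexive (sym (trans (reflexive (≡.cong fromℤ (≡.trans (ℤ.pos-* (4 ℕ.* n) w) (≡.cong (ℤ._* + w) (ℤ.pos-* 4 n)))))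
              (trans (fromℤ-* (+ 4 ℤ.* + n) (+ w)) (*-congʳ (trans (fromℤ-* (+ 4) (+ n)) (*-congʳ (fromℤ≈ι (+ 4)))))))))
          (≤-trans (fromℤ-mono-≤ (ℤ.+≤+ 4nw≤5H)) (≤-reflexive (trans (reflexive (≡.cong fromℤ (ℤ.pos-* 5 H)))
            (trans (fromℤ-* (+ 5) (+ H)) (*-congʳ (fromℤ≈ι (+ 5)))))))
        scaled : ν * (ι (+ 4) * (ι (+ 2) * W)) ≤ ν * (ι (+ 4) * (ι (+ 5) * L))
        scaled = ≤-by (0≤+ (0≤+ (*-nonneg (0≤ι 2) (0≤b-a 4νW≤5H)) (*-nonneg (0≤ι 10) (0≤b-a H≤)))
                           (0≤+ (*-nonneg (*-nonneg (0≤ι 5) (proj₁ 0<ν)) (0≤b-a V≤)) (*-nonneg (0≤ι 5) (0≤b-a m≤))))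
          (solve 6 (λ ν W H V m L →
            ν :* (con (+ 4) :* (con (+ 5) :* L)) :- ν :* (con (+ 4) :* (con (+ 2) :* W)) :=
            con (+ 2) :* (con (+ 5) :* H :- con (+ 4) :* ν :* W) :+ con (+ 10) :* (ν :* V :+ (:1 :+ :1) :* m :- H) :+
            (con (+ 5) :* ν :* ((:1 :+ :1 :+ :1) :* L :- (:1 :+ :1) :* V) :+ con (+ 5) :* (ν :* L :- con (+ 4) :* m))) refl
            ν W (fromℤ (+ H)) V (fromℤ (+ m)) L)

  point∈pixel : ∀ Q → InPixel (point Q) Q
  point∈pixel (i , j) = (≤-refl , i≤i+1 (fromℤ i)) , (≤-refl , i≤i+1 (fromℤ j))
    where
      i≤i+1 : ∀ x → x ≤ x + 1#
      i≤i+1 x = ≤-by 0≤1 (solve 1 (λ x → x :+ :1 :- x := :1) refl x)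

  some-pixel : ∃[ Q ] Q ∈ pixels
  some-pixel = head∈ pixels nonEmpty
    where
      head∈ : ∀ (xs : List Pixel) → xs ≢ [] → ∃[ x ] x ∈ xs
      head∈ []       []≢[] = contradiction ≡.refl []≢[]
      head∈ (x ∷ xs) _     = x , here ≡.refl

  module _ (M : ClosedTour) (milling : IsMillingTour P M) where
    open ClosedTour M hiding (length; OnTour)

    Approximation : Set
    Approximation = ∃[ T ] ∃[ S ] IsFeasible P T S ×
      (∀ k → IsMinimumScanNumber P k → 2 ℕ.* List.length S ℕ.≤ 5 ℕ.* k) ×
      fromℤ (+ 2) * length T ≤ fromℤ (+ 5) * length M

    -- `E` bounds, in units of 1/n, how far `M` moves between samples. The floors add 1, so the
    -- averaging receives the error `suc E`, and `E < n` keeps consecutive samples at most one pixel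
    -- side apart.
    module Construction
      (n : ℕ) {{n≢0 : NonZero n}} (E : ℕ) (E<n : E ℕ.< n)
      (fine : 80 ℕ.* List.length distinctPixels ℕ.* suc (suc E) ℕ.≤ n)
      (η : Carrier) (νη≤E : fromℤ (+ n) * η ≤ fromℤ (+ E))
      (t : Carrier) (ts : List Carrier) (steps : Steps path η start (t ∷ ts)) (final≡ : final t ts ≡ finish)
      (few-steps : ι (+ 4) * fromℤ (+ List.length (map path (t ∷ ts))) ≤ fromℤ (+ n) * length M) where

      open Grid ℝ em n
      open Rounding n

      times : List Carrier
      times = start ∷ t ∷ ts

      u : Vertex
      u = grid (path start)

      us : List Vertex
      us = map grid (map path (t ∷ ts))

      opaque
        times-in-interval : All (InInterval start finish) times
        times-in-interval = All.zip (steps-start≤ path η (t ∷ ts) steps ,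
          ≡.subst (λ b → All (_≤ b) times) final≡ (steps-≤final path η (t ∷ ts) steps))

        swept-near : ∀ q → InRegion P q → ∃[ v ] v ∈ times × Within (η + 1#) (path v) q
        swept-near q q∈ with proj₂ milling q q∈
        ... | (cx , cy) , (τ , (a≤τ , τ≤b) , x≈ , y≈) , ((a , b) , (c , d))
          with steps-near path η t ts steps a≤τ (≡.subst (τ ≤_) (≡.sym final≡) τ≤b)
        ...   | v , v∈ , ((a′ , b′) , (c′ , d′)) = v , v∈ , within-+ (path τ) (path v) q refl ((b′ , a′) , (d′ , c′))
          ((≤-trans (≤-reflexive (+-congˡ (-‿cong (sym x≈)))) a , ≤-trans (≤-reflexive (+-congʳ (sym x≈))) b) ,
           (≤-trans (≤-reflexive (+-congˡ (-‿cong (sym y≈)))) c , ≤-trans (≤-reflexive (+-congʳ (sym y≈))) d))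

        unscaled : ∀ {μ} → ν * μ ≈ 1# → ∀ i → ν * (fromℤ i * μ) ≈ fromℤ i
        unscaled {μ} νμ≈1 i = trans (solve 3 (λ v i m → v :* (i :* m) := v :* m :* i) refl ν (fromℤ i) μ)
                                    (trans (*-congʳ νμ≈1) (*-identityˡ (fromℤ i)))

        sample-near : ∀ {x} i z → ν * x ≈ fromℤ i → x - z ≤ η + 1# → z - x ≤ η + 1# → ℤ.∣ i ℤ.- ⌊ ν * z ⌋ ∣ ℕ.≤ n ℕ.+ suc E
        sample-near {x} i z νx≈i p q = ≡.subst₂ (λ j k → ℤ.∣ j ℤ.- ⌊ ν * z ⌋ ∣ ℕ.≤ k)
          (≡.trans (⌊⌋-cong νx≈i) (⌊fromℤ⌋ i)) (≡.sym (ℕ.+-suc n E))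
          (⌊⌋-near {x} {z} {η + 1#} {n ℕ.+ E}
            (≤-trans (≤-by₁ νη≤E (solve 3 (λ v h e → v :+ e :- v :* (h :+ :1) := e :- v :* h) refl ν η (fromℤ (+ E))))
              (≤-reflexive (sym (fromℤ-+ (+ n) (+ E))))) p q)

      Sampled : ℤ → ℤ → Set
      Sampled x y = ∃[ w ] w ∈ u ∷ us × ℤ.∣ x ℤ.- proj₁ w ∣ ℕ.≤ n ℕ.+ suc E × ℤ.∣ y ℤ.- proj₂ w ∣ ℕ.≤ n ℕ.+ suc E

      opaque
        sampled : ∀ x y {μ} → ν * μ ≈ 1# → ∃[ v ] v ∈ times × Within (η + 1#) (path v) (fromℤ x * μ , fromℤ y * μ) → Sampled x y
        sampled x y νμ≈1 (v , v∈ , ((a , b) , (c , d))) = grid (path v) , ∈-map⁺ grid (∈-map⁺ path v∈) ,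
          sample-near x (proj₁ (path v)) (unscaled νμ≈1 x) a b , sample-near y (proj₂ (path v)) (unscaled νμ≈1 y) c d

        -- Divided by `n`, the lattice point lies in the pixel of its cell. `M` mills that point,
        -- and the last sample before it does so is at most `η` further off.
        dense : ∀ x y → (fl x , fl y) ∈ distinctPixels → Sampled x y
        dense x y cell∈ =
          let μ , _ , νμ≈1 = recip 0<ν
          in sampled x y νμ≈1 (swept-near (fromℤ x * μ , fromℤ y * μ)
               (lose (∈-deduplicate⁻ _≟ᵥ_ pixels cell∈) (fl-cell (unscaled νμ≈1 x) , fl-cell (unscaled νμ≈1 y))))

      rounding : ∃[ φ ] ∃[ ψ ] Averaging.Rounded em n (suc E) distinctPixels u us dense fine φ ψ
      rounding = Averaging.rounding-exists em n (suc E) distinctPixels u us dense fine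

      φ ψ : ℤ
      φ = proj₁ rounding
      ψ = proj₁ (proj₂ rounding)

      vertex : Carrier → Vertex
      vertex τ = round φ ψ (grid (path τ))

      vertices : List Carrier → List Vertex
      vertices τs = map (round φ ψ) (map grid (map path τs))

      opaque
        vertices-milled : All Milled (vertices times)
        vertices-milled = All.map⁺ (All.map⁺ (All.map⁺ (All.map milled times-in-interval)))
          where
            milled : ∀ {τ} → InInterval start finish τ → Milled (vertex τ)
            milled {τ} τ∈ = close-milled (vertex τ) (proj₁ milling (path τ) (τ , τ∈ , refl , refl))
              (round-not-below φ (proj₁ (path τ)) , round-not-above φ (proj₁ (path τ)))
              (round-not-below ψ (proj₂ (path τ)) , round-not-above ψ (proj₂ (path τ)))

        tour-end : ∀ s τs → end (point (vertex s)) (map point (vertices τs)) ≡ point (vertex (final s τs))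
        tour-end s []       = ≡.refl
        tour-end s (τ ∷ τs) = tour-end τ τs

        -- `path` closes up to `≈` only, but floors of equal reals are identical integers, so the
        -- rounded polygon closes exactly.
        tour-closed : end (point (vertex start)) (map point (vertices (t ∷ ts))) ≡ point (vertex start)
        tour-closed = ≡.trans (tour-end start (t ∷ ts)) (≡.cong (λ w → point (round φ ψ w))
          (≡.trans (≡.cong (λ τ → grid (path τ)) final≡) (≡.sym (grid-cong (proj₁ closed) (proj₂ closed)))))

        adjacent-within : ∀ {i j} → ℤ.∣ i ℤ.- j ∣ ℕ.≤ 1 → fromℤ j - fromℤ i ≤ 1# × fromℤ i - fromℤ j ≤ 1#
        adjacent-within {i} {j} ∣i-j∣≤1 = half j i (≡.subst (ℕ._≤ 1) (ℤ.∣i-j∣≡∣j-i∣ i j) ∣i-j∣≤1) , half i j ∣i-j∣≤1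
          where
            half : ∀ i j → ℤ.∣ i ℤ.- j ∣ ℕ.≤ 1 → fromℤ i - fromℤ j ≤ 1#
            half i j p = ≤-trans (≤-reflexive (sym (fromℤ-- i j))) (≤-trans (fromℤ-mono-≤ (≤∣i∣ {i ℤ.- j} p)) (≤-reflexive fromℤ-1))

        -- The end of an edge is within L∞-distance 1 of its start, so the edge stays in the block
        -- around the start.
        tour⊆ : ∀ s τs → Steps path η s τs → All Milled (vertices (s ∷ τs)) → Polyline⊆ (point (vertex s)) (map point (vertices τs))
        tour⊆ s []       _                       (milled ∷ _) = block⊆ milled (point (vertex s)) (within-refl 0≤1 (point (vertex s)))
        tour⊆ s (τ ∷ τs) ((s≤τ , near) , steps) (milled ∷ all-milled) =
          cutter-segment (block⊆ milled) (adjacent φ x≤ -x≤ , adjacent ψ y≤ -y≤) , tour⊆ τ τs steps all-milled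
          where
            x≤ : proj₁ (path τ) - proj₁ (path s) ≤ η
            x≤ = proj₁ (proj₁ (near τ s≤τ ≤-refl))
            -x≤ : proj₁ (path s) - proj₁ (path τ) ≤ η
            -x≤ = proj₂ (proj₁ (near τ s≤τ ≤-refl))
            y≤ : proj₂ (path τ) - proj₂ (path s) ≤ η
            y≤ = proj₁ (proj₂ (near τ s≤τ ≤-refl))
            -y≤ : proj₂ (path s) - proj₂ (path τ) ≤ η
            -y≤ = proj₂ (proj₂ (near τ s≤τ ≤-refl))
            adjacent : ∀ φ {x y} → y - x ≤ η → x - y ≤ η →
                       fromℤ (fl (⌊ ν * y ⌋ ℤ.+ φ) ℤ.- fl φ) - fromℤ (fl (⌊ ν * x ⌋ ℤ.+ φ) ℤ.- fl φ) ≤ 1# ×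
                       fromℤ (fl (⌊ ν * x ⌋ ℤ.+ φ) ℤ.- fl φ) - fromℤ (fl (⌊ ν * y ⌋ ℤ.+ φ) ℤ.- fl φ) ≤ 1#
            adjacent φ {x} {y} yx≤ xy≤ = adjacent-within {fl (⌊ ν * x ⌋ ℤ.+ φ) ℤ.- fl φ} {fl (⌊ ν * y ⌋ ℤ.+ φ) ℤ.- fl φ}
              (∣round-round∣≤1 φ {⌊ ν * x ⌋} {⌊ ν * y ⌋} (ℕ.≤-trans (⌊⌋-near {x} {y} {η} {E} νη≤E xy≤ yx≤) E<n))

        perimeter≤travel : ∀ v vs → perimeter (point v) (map point vs) ≤ fromℤ (+ travel v vs)
        perimeter≤travel v []       = ≤-reflexive (+-identityˡ 0#)
        perimeter≤travel (a , b) ((a′ , b′) ∷ vs) = ≤-trans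
          (≤-by₃ (perimeter≤travel (a′ , b′) vs) (∣Δ∣≤ a a′) (∣Δ∣≤ b b′)
            (solve 7 (λ x y p q w r s → w :+ r :+ s :- (x :+ p :+ (y :+ q)) := (w :- (x :+ y)) :+ (r :- p) :+ (s :- q)) refl
              (variation proj₁ (point (a′ , b′)) (map point vs)) (variation proj₂ (point (a′ , b′)) (map point vs))
              ∣ fromℤ a′ - fromℤ a ∣ ∣ fromℤ b′ - fromℤ b ∣ (fromℤ (+ travel (a′ , b′) vs))
              (fromℤ (+ ℤ.∣ a ℤ.- a′ ∣)) (fromℤ (+ ℤ.∣ b ℤ.- b′ ∣))))
          (≤-reflexive (sym (trans (fromℤ-+ (+ taxi (a , b) (a′ , b′)) (+ travel (a′ , b′) vs))
            (trans (+-congʳ (fromℤ-+ (+ ℤ.∣ a ℤ.- a′ ∣) (+ ℤ.∣ b ℤ.- b′ ∣)))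
              (solve 3 (λ r s w → r :+ s :+ w := w :+ r :+ s) refl (fromℤ (+ ℤ.∣ a ℤ.- a′ ∣)) (fromℤ (+ ℤ.∣ b ℤ.- b′ ∣)) (fromℤ (+ travel (a′ , b′) vs)))))))
          where
            ∣Δ∣≤ : ∀ a a′ → ∣ fromℤ a′ - fromℤ a ∣ ≤ fromℤ (+ ℤ.∣ a ℤ.- a′ ∣)
            ∣Δ∣≤ a a′ = ∣x∣≤
              (≤-trans (≤-reflexive (sym (fromℤ-- a′ a))) (fromℤ-mono-≤ (≤∣i∣ {a′ ℤ.- a} (ℕ.≤-reflexive (ℤ.∣i-j∣≡∣j-i∣ a′ a)))))
              (≤-trans (≤-reflexive (trans (solve 2 (λ x y → :- (x :- y) := y :- x) refl (fromℤ a′) (fromℤ a)) (sym (fromℤ-- a a′))))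
                (fromℤ-mono-≤ (≤∣i∣ {a ℤ.- a′} ℕ.≤-refl)))

      tour : ClosedTour
      tour = polygon (point (vertex start)) (map point (vertices (t ∷ ts))) tour-closed

      subcover : ∃[ S ] (∀ {v} → v ∈ S → v ∈ vertices times) × CoveredBy distinctPixels S ×
                        7 ℕ.* List.length S ℕ.≤ 4 ℕ.* List.length distinctPixels
      subcover = sparse-subcover em distinctPixels (vertices times)
        (λ v∈ c → ∈-deduplicate⁺ _≟ᵥ_ (All.lookup vertices-milled v∈ c))
        (λ p∈ → let w , w∈ , w∋p = proj₁ (proj₂ (proj₂ rounding)) p∈ in round φ ψ w , ∈-map⁺ (round φ ψ) w∈ , w∋p)

      approximation : Approximation
      approximation = tour , map point S ,
          (polygon⊆ _ _ tour-closed (tour⊆ start (t ∷ ts) steps vertices-milled) ,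
           All.map⁺ (All.tabulate λ v∈S → vertex-on-polygon _ _ tour-closed (∈-map⁺ point (proj₁ (proj₂ subcover) v∈S))) ,
           milled-covers (All.tabulate λ v∈S → All.lookup vertices-milled (proj₁ (proj₂ subcover) v∈S))
                         (λ p∈ → proj₁ (proj₂ (proj₂ subcover)) (∈-deduplicate⁺ _≟ᵥ_ p∈))) ,
          scan-bound {S} (proj₂ (proj₂ (proj₂ subcover))) ,
          length-estimate {n} {travel (vertex start) (vertices (t ∷ ts))} {travel u us} {List.length (map path (t ∷ ts))}
            0<ν (proj₂ (proj₂ (proj₂ rounding))) (grid-travel (path start) (map path (t ∷ ts)))
            (partition-perimeter path isLength (t ∷ ts) steps final≡) few-steps
            (≤-trans (polygon-length≤ _ _ tour-closed) (perimeter≤travel (vertex start) (vertices (t ∷ ts))))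
        where
          S : List Vertex
          S = proj₁ subcover

    opaque
      -- `E + 3 ≤ 3 (E + 1)`, and 240 is three times 80. That `R` works for all `E` at once is
      -- essential: `η = 1 / R` determines the partition, and `E` is chosen only after the number of
      -- its steps is known. With `n = (E + 1) R` the error grows in proportion to `n`.
      scale : ∀ N → ∃[ R ] 1 ℕ.< R × (∀ E → 80 ℕ.* N ℕ.* suc (suc (suc E)) ℕ.≤ suc E ℕ.* R)
      scale N = suc N ℕ.* 240 , ℕ.≤-trans (ℕ.m≤m+n 2 238) (ℕ.m≤m+n 240 (N ℕ.* 240)) , λ E → begin
        80 ℕ.* N ℕ.* suc (suc (suc E))                                  ≤⟨ ℕ.m≤m+n _ (160 ℕ.* N ℕ.* E ℕ.+ 240 ℕ.* suc E) ⟩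
        80 ℕ.* N ℕ.* suc (suc (suc E)) ℕ.+ (160 ℕ.* N ℕ.* E ℕ.+ 240 ℕ.* suc E) ≡⟨ tally N E ⟩
        suc E ℕ.* (suc N ℕ.* 240)                                      ∎
        where
          open ℕ.≤-Reasoning
          tally : ∀ N E → 80 ℕ.* N ℕ.* (3 ℕ.+ E) ℕ.+ (160 ℕ.* N ℕ.* E ℕ.+ 240 ℕ.* (1 ℕ.+ E)) ≡ (1 ℕ.+ E) ℕ.* ((1 ℕ.+ N) ℕ.* 240)
          tally = ℕ-Solver.solve-∀

      0<fromℤ : ∀ {n} → 0 ℕ.< n → 0# < fromℤ (+ n)
      0<fromℤ 0<n = ≰⇒> λ n≤0 → 1≰0 (≤-trans (≤-reflexive (sym fromℤ-1)) (≤-trans (fromℤ-mono-≤ (ℤ.+≤+ 0<n)) n≤0))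

      fine-enough : ∀ {R E η} → fromℤ (+ R) * η ≈ 1# → fromℤ (+ (suc E ℕ.* R)) * η ≤ fromℤ (+ suc E)
      fine-enough {R} {E} {η} Rη≈1 = ≤-reflexive (trans
        (*-congʳ (trans (reflexive (≡.cong fromℤ (ℤ.pos-* (suc E) R))) (fromℤ-* (+ suc E) (+ R))))
        (trans (*-assoc _ _ _) (trans (*-congˡ Rη≈1) (*-identityʳ _))))

      enough-steps : ∀ {x r L E R} → 0# ≤ L → L * r ≈ 1# → 1 ℕ.< R → ¬ fromℤ (+ E) ≤ x * r → x ≤ fromℤ (+ (suc E ℕ.* R)) * L
      enough-steps {x} {r} {L} {E} {R} 0≤L Lr≈1 1<R E≰xr = begin
        x                                   ≈⟨ trans (*-congˡ Lr≈1) (*-identityʳ x) ⟨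
        x * (L * r)                         ≈⟨ solve 3 (λ x L r → x :* (L :* r) := L :* (x :* r)) refl x L r ⟩
        L * (x * r)                         ≤⟨ *-monoˡ-≤ 0≤L (≤-trans (≰⇒≥ E≰xr) (fromℤ-mono-≤ (ℤ.+≤+ E≤))) ⟩
        L * fromℤ (+ (suc E ℕ.* R))         ≈⟨ *-comm L _ ⟩
        fromℤ (+ (suc E ℕ.* R)) * L         ∎
        where
          open ≤-Reasoning
          E≤ : E ℕ.≤ suc E ℕ.* R
          E≤ = ℕ.≤-trans (ℕ.n≤1+n E) (ℕ.<⇒≤ (ℕ.m<m*n (suc E) R 1<R))

    long-tour : 0# < length M → Approximation
    long-tour 0<L =
      let R , 1<R , fine = scale (List.length distinctPixels)
          η , 0<η , Rη≈1 = recip (0<fromℤ (ℕ.<-trans ℕ.z<s 1<R))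
          t , ts , steps , final≡ = fine-partition path start≤finish continuous 0<η
          r , _ , Lr≈1 = recip 0<L
          E , E≰ = archimedean (ι (+ 4) * fromℤ (+ List.length (map path (t ∷ ts))) * r)
          E<n = ℕ.m<m*n (suc E) R 1<R
      in Construction.approximation (suc E ℕ.* R) {{ℕ.>-nonZero (ℕ.≤-<-trans ℕ.z≤n E<n)}} (suc E) E<n (fine E) η
           (fine-enough {R} {E} Rη≈1) t ts steps final≡ (enough-steps {E = E} {R} (proj₁ 0<L) Lr≈1 1<R E≰)

    opaque
      0≤length : 0# ≤ length M
      0≤length = proj₁ isLength 0# ([] , [] , [] , empty refl)

      stationary : length M ≤ 0# → ∀ {τ} → InInterval start finish τ →
                   proj₁ (path τ) ≈ proj₁ (path start) × proj₂ (path τ) ≈ proj₂ (path start)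
      stationary L≤0 {τ} (a≤τ , τ≤b) with distance-exists (path start) (path τ)
      ... | d , dist@(0≤d , d²≈) = same dx²≤0 , same dy²≤0
        where
          dx dy : Carrier
          dx = proj₁ (path τ) - proj₁ (path start)
          dy = proj₂ (path τ) - proj₂ (path start)
          d≤0 : d ≤ 0#
          d≤0 = ≤-trans (≤-reflexive (sym (+-identityʳ d))) (≤-trans (proj₁ isLength (d + 0#)
            (start ∷ τ ∷ [] , a≤τ ∷ [-] , (≤-refl , start≤finish) ∷ (a≤τ , τ≤b) ∷ [] , step dist (single refl) refl)) L≤0)
          d²≤0 : d * d ≤ 0#
          d²≤0 = ≤-trans (*-monoˡ-≤ 0≤d d≤0) (≤-reflexive (zeroʳ d))
          dx²≤0 : dx * dx ≤ 0# * 0#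
          dx²≤0 = ≤-by₃ d²≤0 (≤-reflexive (sym d²≈)) (0≤x² dy)
            (solve 3 (λ x y e → :0 :* :0 :- x :* x := (:0 :- e) :+ (e :- (x :* x :+ y :* y)) :+ (y :* y :- :0)) refl dx dy (d * d))
          dy²≤0 : dy * dy ≤ 0# * 0#
          dy²≤0 = ≤-by₃ d²≤0 (≤-reflexive (sym d²≈)) (0≤x² dx)
            (solve 3 (λ x y e → :0 :* :0 :- y :* y := (:0 :- e) :+ (e :- (x :* x :+ y :* y)) :+ (x :* x :- :0)) refl dx dy (d * d))
          same : ∀ {x y} → (x - y) * (x - y) ≤ 0# * 0# → x ≈ y
          same {x} {y} p = antisym
            (≤-by₁ (square-cancel-≤ ≤-refl p) (solve 2 (λ x y → y :- x := :0 :- (x :- y)) refl x y))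
            (≤-by₁ (square-cancel-≤ {y - x} ≤-refl (≤-trans (≤-reflexive (solve 2 (λ x y → (y :- x) :* (y :- x) := (x :- y) :* (x :- y)) refl x y)) p))
              (solve 2 (λ x y → x :- y := :0 :- (y :- x)) refl x y))

    -- The choice of `n` divides by the length of `M` and fails for length 0. Such an `M` stands
    -- still, its one cutter position fills P, and a single scan point is enough.
    point-tour : length M ≤ 0# → Approximation
    point-tour L≤0 = M , path start ∷ [] ,
        ((λ p on → proj₁ milling p on p (within-refl 0≤1 p)) ,
         start-on ∷ [] ,
         (proj₁ milling (path start) start-on (path start) (within-refl 0≤1 (path start)) ∷ []) ,
         λ q q∈ → here (cutter-sees (proj₁ milling (path start) start-on) (near-start q q∈))) ,
        positive ,
        ≤-trans (≤-reflexive (*-congʳ (fromℤ≈ι (+ 2)))) (≤-trans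
          (≤-by (*-nonneg (0≤ι 3) 0≤length) (solve 1 (λ L → con (+ 5) :* L :- con (+ 2) :* L := con (+ 3) :* L) refl (length M)))
          (≤-reflexive (*-congʳ (sym (fromℤ≈ι (+ 5))))))
      where
        start-on : OnTour M (path start)
        start-on = start , (≤-refl , start≤finish) , refl , refl
        near-start : ∀ q → InRegion P q → Within 1# (path start) q
        near-start q q∈ with proj₂ milling q q∈
        ... | _ , (τ , τ∈ , x≈ , y≈) , ((a , b) , (c , d)) with stationary L≤0 τ∈
        ...   | x≈₀ , y≈₀ = shift (trans x≈ x≈₀) a b , shift (trans y≈ y≈₀) c d
          where
            shift : ∀ {x x′ z} → x ≈ x′ → z - x ≤ 1# → x - z ≤ 1# → z - x′ ≤ 1# × x′ - z ≤ 1#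
            shift x≈ p q = ≤-trans (≤-reflexive (+-congˡ (-‿cong (sym x≈)))) p , ≤-trans (≤-reflexive (+-congʳ (sym x≈))) q
        positive : ∀ k → IsMinimumScanNumber P k → 2 ℕ.≤ 5 ℕ.* k
        positive (suc k) _ = ℕ.≤-trans (ℕ.m≤m+n 2 3) (ℕ.m≤m*n 5 (suc k))
        positive zero (([] , (_ , covers) , _) , _) =
          let Q , Q∈ = some-pixel in case-[] (covers (point Q) (lose Q∈ (point∈pixel Q)))
          where
            case-[] : ∀ {A : Set} {R : Point → Set} → Any R [] → A
            case-[] ()

    approximation : Approximation
    approximation with em {length M ≤ 0#}
    ... | yes L≤0 = point-tour L≤0
    ... | no  L≰0 = long-tour (≰⇒> L≰0)

  -- Closed walks through prescribed points of a polyomino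

  record Walk (p q : Point) : Set where
    constructor walk
    field
      stops  : List Point
      inside : Polyline⊆ p stops
      ends   : end p stops ≡ q

  open Walk

  Polyline⊆-++ : ∀ p ps {qs} → Polyline⊆ p ps → Polyline⊆ (end p ps) qs → Polyline⊆ p (ps ++ qs)
  Polyline⊆-++ p []        _            qs⊆ = qs⊆
  Polyline⊆-++ p (p′ ∷ ps) (seg , ps⊆) qs⊆ = seg , Polyline⊆-++ p′ ps ps⊆ qs⊆

  end-++ : ∀ p ps {qs} → end p (ps ++ qs) ≡ end (end p ps) qs
  end-++ p []        = ≡.refl
  end-++ p (p′ ∷ ps) = end-++ p′ ps

  infixr 5 _▸_

  _▸_ : ∀ {p q r} → Walk p q → Walk q r → Walk p r
  _▸_ {p} v w = walk (stops v ++ stops w)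
    (Polyline⊆-++ p (stops v) (inside v) (≡.subst (λ q → Polyline⊆ q (stops w)) (≡.sym (ends v)) (inside w)))
    (≡.trans (end-++ p (stops v)) (≡.trans (≡.cong (λ q → end q (stops w)) (ends v)) (ends w)))

  stroll : ∀ {Q p q} → Q ∈ pixels → InPixel p Q → InPixel q Q → Walk p q
  stroll {q = q} Q∈ p∈ q∈ = walk (q ∷ []) (pixel-convex Q∈ p∈ q∈ , lose Q∈ q∈) ≡.refl

  adjacent-walk : ∀ {a b} → a ∈ pixels → b ∈ pixels → Adjacent a b → Walk (point a) (point b)
  adjacent-walk {a@(i , j)} {b@(i′ , j′)} a∈ b∈ adj with unit-step (i ℤ.- i′) (j ℤ.- j′) adj
  ... | inj₁ ((x , x′) , (y , y′)) = stroll b∈ (between-ints i i′ x x′ , between-ints j j′ y y′) (point∈pixel b)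
    where
      between-ints : ∀ i i′ → + 0 ℤ.≤ i ℤ.- i′ → i ℤ.- i′ ℤ.≤ + 1 → fromℤ i′ ≤ fromℤ i × fromℤ i ≤ fromℤ i′ + 1#
      between-ints i i′ p q = fromℤ-mono-≤ {i′} {i} (ℤ.0≤i-j⇒j≤i p) , x-y≤z⇒x≤y+z (≤-trans (≤-reflexive (sym (fromℤ-- i i′)))
        (≤-trans (fromℤ-mono-≤ q) (≤-reflexive fromℤ-1)))
  ... | inj₂ ((x , x′) , (y , y′)) = stroll a∈ (point∈pixel a) (between-ints i i′ x x′ , between-ints j j′ y y′)
    where
      between-ints : ∀ i i′ → i ℤ.- i′ ℤ.≤ + 0 → ℤ.- + 1 ℤ.≤ i ℤ.- i′ → fromℤ i ≤ fromℤ i′ × fromℤ i′ ≤ fromℤ i + 1#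
      between-ints i i′ p q = fromℤ-mono-≤ {i} {i′} (ℤ.i-j≤0⇒i≤j p) ,
        ≤-by₁ (≤-trans (≤-reflexive (trans (-‿cong (sym fromℤ-1)) (sym (fromℤ-neg (+ 1))))) (≤-trans (fromℤ-mono-≤ q) (≤-reflexive (fromℤ-- i i′))))
          (solve 2 (λ x y → x :+ :1 :- y := x :- y :- :- :1) refl (fromℤ i) (fromℤ i′))

  star-walk : ∀ {a b} → a ∈ pixels → Star.Star (λ c d → Adjacent c d × d ∈ pixels) a b → Walk (point a) (point b)
  star-walk {a} a∈ Star.ε                = walk [] (lose a∈ (point∈pixel a)) ≡.refl
  star-walk     a∈ ((adj , d∈) Star.◅ rest) = adjacent-walk a∈ d∈ adj ▸ star-walk d∈ rest

  visit : ∀ {a s} → a ∈ pixels → InRegion P s → ∃[ w ] s ∈ stops {point a} {point a} w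
  visit {a} {s} a∈ s∈P with find s∈P
  ... | Q , Q∈ , s∈Q =
    there-walk ▸ stroll Q∈ (point∈pixel Q) s∈Q ▸ stroll Q∈ s∈Q (point∈pixel Q) ▸ star-walk Q∈ (connected Q∈ a∈) ,
    ∈-++⁺ʳ (stops there-walk) (here ≡.refl)
    where
      there-walk : Walk (point a) (point Q)
      there-walk = star-walk a∈ (connected a∈ Q∈)

  visit-all : ∀ {a S} → a ∈ pixels → All (InRegion P) S → ∃[ w ] All (_∈ stops {point a} {point a} w) S
  visit-all {a} a∈ []         = walk [] (lose a∈ (point∈pixel a)) ≡.refl , []
  visit-all {a} a∈ (s∈ ∷ S∈) with visit a∈ s∈ | visit-all a∈ S∈
  ... | v , s∈v | w , S∈w = v ▸ w , ∈-++⁺ˡ s∈v ∷ All.map (∈-++⁺ʳ (stops v)) S∈w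

  walk-feasible : ∀ S → Covers P S → ∃[ T ] IsFeasible P T S
  walk-feasible S covers =
    let Q , Q∈ = some-pixel
        w , S∈ = visit-all Q∈ (proj₁ covers)
    in polygon (point Q) (stops w) (ends w) ,
       polygon⊆ (point Q) (stops w) (ends w) (inside w) ,
       All.map (λ s∈ → vertex-on-polygon (point Q) (stops w) (ends w) (there s∈)) S∈ ,
       covers

  -- Shows that finite covers exist, so that there is a minimum one; a corner of a pixel sees all of
  -- it by convexity.
  pixel-corners-cover : Covers P (map point pixels)
  pixel-corners-cover = All.map⁺ (All.tabulate λ {Q} Q∈ → lose Q∈ (point∈pixel Q)) ,
    λ q q∈ → let Q , Q∈ , q∈Q = find q∈ in Any.map⁺ (lose Q∈
      ((λ x (t , (0≤t , t≤1) , x≈ , y≈) → inRegion-resp (sym x≈) (sym y≈) (pixel-convex Q∈ q∈Q (point∈pixel Q) t 0≤t t≤1)) ,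
       ∋-within {p = Q} (sw , ≡.refl) q∈Q))

  minimum-cover : ∃[ k ] IsMinimumScanNumber P k
  minimum-cover =
    let k , cover , shortest = least em (λ k → ∃[ S ] Covers P S × List.length S ≡ k) (map point pixels , pixel-corners-cover , ≡.refl)
    in k , cover , λ S covers → shortest (List.length S) (S , covers , ≡.refl)

  minimum-feasible : ∃[ T ] ∃[ S ] IsFeasible P T S × (∀ k → IsMinimumScanNumber P k → 2 ℕ.* List.length S ℕ.≤ 5 ℕ.* k)
  minimum-feasible =
    let _ , (S , covers , length≡) , shortest = minimum-cover
        T , feasible = walk-feasible S covers
    in T , S , feasible , λ k ((S′ , covers′ , length′≡) , _) → ℕ.*-mono-≤ (ℕ.m≤m+n 2 3)
         (≡.subst₂ ℕ._≤_ (≡.sym length≡) length′≡ (shortest S′ covers′))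

open import Data.Nat using (_*_) renaming (_≤_ to _≤ℕ_)

theorem5 : (ℝ : CompleteOrderedField) → ExcludedMiddle 0ℓ →
    let open MWPDV ℝ
        module R = CompleteOrderedField ℝ
    in
    (P : Polyomino) →
    ∃[ T ] ∃[ S ]
      IsFeasible P T S ×
      (∀ k → IsMinimumScanNumber P k → 2 * List.length S ≤ℕ 5 * k) ×
      (∀ M → IsOptimumMillingTour P M →
        R.fromℤ (+ 2) R.* length T R.≤ R.fromℤ (+ 5) R.* length M)
theorem5 ℝ em P with em {∃[ M ] MWPDV.IsOptimumMillingTour ℝ P M}
... | no  none =
  let T , S , feasible , scans = Milling.minimum-feasible ℝ em P
  in T , S , feasible , scans , λ M optimum → contradiction (M , optimum) none
-- One pair has to serve every optimum, since it is chosen before `M′` is given. The optimality of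
-- `M` carries the bound over.
... | yes (M , milling , shortest) =
  let T , S , feasible , scans , short = Milling.approximation ℝ em P M milling
  in T , S , feasible , scans , λ M′ (milling′ , _) →
       ≤-trans short (*-monoˡ-≤ (fromℤ-nonneg 5) (shortest M′ milling′))
  where open OrderedField ℝ em
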